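{- Let $n\ge 1$ and $X_n=(x_1,\dots,x_n)$. For $1\le k\le n$ define the Boolean product polynomial $$B_{n,k}(X_n)=\prod_{1\le i_1<\cdots<i_k\le n}(x_{i_1}+\cdots+x_{i_k}),$$ and define $B_n(X_n)=\prod_{k=1}^n B_{n,k}(X_n)$. Then for every $1\le k\le n$ the polynomial $B_{n,k}(X_n)$ is Schur positive, and $B_n(X_n)$ is Schur positive; that is, each of them is a linear combination of Schur polynomials $s_\lambda(x_1,\dots,x_n)$ (with $\lambda$ ranging over partitions with at most $n$ parts) with nonnegative integer coefficients.
   Context: For a partition $\lambda$, $s_\lambda(X_n)=\sum_T x^T$ is the Schur polynomial, the sum over semistandard Young tableaux $T$ of shape $\lambda$ with entries in $\{1,\dots,n\}$, where $x^T=\prod_i x_i^{(\text{number of entries } i \text{ in } T)}$. A symmetric polynomial is Schur positive if its expansion in the Schur basis has nonnegative integer coefficients. -}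

module Defs where

open import Data.Nat using (ℕ; zero; suc; _+_; _≤_; _<ᵇ_; _≡ᵇ_)
open import Data.Bool using (Bool; true; false; _∧_; if_then_else_)
open import Data.Fin using (Fin; toℕ)
open import Data.Fin.Properties using () renaming (_≟_ to _≟F_)
import Data.Fin as F
open import Data.Vec using (Vec; []; _∷_; zipWith; replicate; tabulate; lookup; toList)
open import Data.Vec.Properties using (≡-dec)
import Data.Nat.Properties as ℕP
open import Data.List using (List; []; _∷_; [_]; map; concatMap; concat; foldr;
  filter; length; cartesianProductWith; upTo)
open import Data.Bool.ListAction using (and)
import Data.List as L
open import Data.Product using (Σ; _×_; _,_; proj₁; ∃)
open import Relation.Nullary.Decidable using (⌊_⌋)
open import Relation.Binary.PropositionalEquality using (_≡_)

-- Polynomials in x₁,…,xₙ with nonnegative integer coefficients,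
-- represented as a finite multiset (list) of exponent vectors:
-- the list [α₁, …, αₘ] stands for x^{α₁} + ⋯ + x^{αₘ}.
-- Variable x_{i+1} corresponds to index i : Fin n.

Monomial : ℕ → Set
Monomial n = Vec ℕ n

Poly : ℕ → Set
Poly n = List (Monomial n)

coeff : ∀ {n} → Monomial n → Poly n → ℕ
coeff α p = length (filter (λ β → ≡-dec ℕP._≟_ α β) p)

_≈P_ : ∀ {n} → Poly n → Poly n → Set
p ≈P q = ∀ α → coeff α p ≡ coeff α q

_+P_ : ∀ {n} → Poly n → Poly n → Poly n
p +P q = p L.++ q

_*P_ : ∀ {n} → Poly n → Poly n → Poly n
p *P q = cartesianProductWith (zipWith _+_) p q

oneP : ∀ {n} → Poly n
oneP {n} = [ replicate n 0 ]

prodP : ∀ {n} → List (Poly n) → Poly n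
prodP = foldr _*P_ oneP

scaleP : ∀ {n} → ℕ → Poly n → Poly n
scaleP zero    p = []
scaleP (suc c) p = p L.++ scaleP c p

var : ∀ {n} → Fin n → Poly n
var {n} i = [ tabulate (λ j → if ⌊ i ≟F j ⌋ then 1 else 0) ]

allSubsets : (n : ℕ) → List (Vec Bool n)
allSubsets zero    = [ [] ]
allSubsets (suc n) = concatMap (λ S → (true ∷ S) ∷ (false ∷ S) ∷ []) (allSubsets n)

card : ∀ {n} → Vec Bool n → ℕ
card []           = 0
card (true ∷ S)  = suc (card S)
card (false ∷ S) = card S

kSubsets : (n k : ℕ) → List (Vec Bool n)
kSubsets n k = filter (λ S → card S ℕP.≟ k) (allSubsets n)

linSum : ∀ {n} → Vec Bool n → Poly n
linSum {n} S = concatMap (λ i → if lookup S i then var i else []) (L.allFin n)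

B : (n k : ℕ) → Poly n
B n k = prodP (map linSum (kSubsets n k))

Bfull : (n : ℕ) → Poly n
Bfull n = prodP (map (λ k → B n (suc k)) (upTo n))

-- Partitions with at most n parts, as weakly decreasing vectors
-- λ₁ ≥ λ₂ ≥ ⋯ ≥ λₙ ≥ 0 (padded with zeros).

IsPartition : ∀ {n} → Vec ℕ n → Set
IsPartition {n} λ′ = ∀ (i j : Fin n) → i F.≤ j → lookup λ′ j ≤ lookup λ′ i

Partition : ℕ → Set
Partition n = Σ (Vec ℕ n) IsPartition

listsOfLength : (n m : ℕ) → List (List (Fin n))
listsOfLength n zero    = [ [] ]
listsOfLength n (suc m) =
  concatMap (λ a → map (a ∷_) (listsOfLength n m)) (L.allFin n)

fillings : (n : ℕ) → List ℕ → List (List (List (Fin n)))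
fillings n []       = [ [] ]
fillings n (r ∷ rs) =
  cartesianProductWith _∷_ (listsOfLength n r) (fillings n rs)

_≤F_ : ∀ {n} → Fin n → Fin n → Bool
a ≤F b = toℕ a Data.Nat.≤ᵇ toℕ b

_<F_ : ∀ {n} → Fin n → Fin n → Bool
a <F b = toℕ a <ᵇ toℕ b

rowWeak : ∀ {n} → List (Fin n) → Bool
rowWeak []           = true
rowWeak (a ∷ [])     = true
rowWeak (a ∷ b ∷ r) = (a ≤F b) ∧ rowWeak (b ∷ r)

-- the entries of the lower row r′ strictly exceed the entries directly above
-- them in row r (for a partition shape, r′ is no longer than r)
colStrict : ∀ {n} → List (Fin n) → List (Fin n) → Bool
colStrict r r′ = and (L.zipWith _<F_ r r′)

isSSYT : ∀ {n} → List (List (Fin n)) → Bool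
isSSYT []              = true
isSSYT (r ∷ [])        = rowWeak r
isSSYT (r ∷ r′ ∷ rs) = rowWeak r ∧ colStrict r r′ ∧ isSSYT (r′ ∷ rs)

SSYT : ∀ {n} → Partition n → List (List (List (Fin n)))
SSYT {n} λ′ = filter (λ T → isSSYT T Data.Bool.≟ true) (fillings n (toList (proj₁ λ′)))

weight : ∀ {n} → List (List (Fin n)) → Monomial n
weight {n} T =
  tabulate (λ i → length (filter (λ a → i ≟F a) (concat T)))

schur : ∀ {n} → Partition n → Poly n
schur λ′ = map weight (SSYT λ′)

SchurPositive : ∀ {n} → Poly n → Set
SchurPositive {n} p =
  ∃ λ (cs : List (ℕ × Partition n)) →
    p ≈P foldr (λ { (c , λ′) acc → scaleP c (schur λ′) +P acc }) [] cs

{-# OPTIONS --safe #-}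

-- Let C be a set of subsets of {1, …, n} closed under passing to subsets of the same
-- size, with p elements.  The matrix with rows (v , R) and columns S ∈ C whose entries
-- are those of the contraction of e_S by the v-th coordinate has p × p minors ω(w), one
-- for each word w of p rows, and Andréief's identity gives
--   ∑_w ω(w)² x^{v₁ + ⋯ + v_p} = p! ∏_{S ∈ C} ∑_{i ∈ S} xᵢ.
-- Contraction is equivariant and C is closed, so ω is killed by the off-diagonal
-- elementary matrices E_ab of gl_n.
--
-- For every ω with this invariance and every set M of positions, the polynomial
-- f_M = ∑_w ω(w)² x^{∑_{j ∈ M} v_j} is Schur positive, by induction on |M|.  By Jacobi's
-- bialternant formula the Schur coefficients are the coefficients of V f_M at strictly
-- decreasing exponents, V being the Vandermonde product.  Since V is translation
-- invariant, the coefficient of V ∑ₐ ∂f_M/∂xₐ = ∑_{j ∈ M} V f_{M ∖ j} at m is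
-- ∑_b (m_b + 1) times that of V f_M at m + ε_b.  The Casimir operator of gl_n on the
-- positions in M multiplies the coefficient at l by an affine function of ∑ lᵢ², so a
-- polynomial in it, applied to ω, leaves a single b and multiplies its term by a square.
-- Hence that coefficient is nonnegative by the induction hypothesis.
module Submission where

open import Defs
open import Level using (0ℓ)
open import Algebra.Bundles using (CommutativeRing; RawRing)
import Algebra.Solver.Ring as Solver
import Algebra.Solver.Ring.AlmostCommutativeRing as ACR
open import Data.Nat as ℕ using (ℕ; zero; suc; _∸_; _>_; _≥_; _!)
import Data.Nat.Properties as ℕP
open import Data.Maybe.Base using (Maybe; just; nothing)
open import Data.List as L using (List; []; _∷_; _++_; length)
open import Data.List.Relation.Unary.Linked as Linked using (Linked; []; [-]; _∷_)
open import Data.Product using (_×_; _,_; proj₁; proj₂; ∃; ∃₂)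
open import Relation.Nullary using (¬_; yes; no; Dec; ¬?)
import Relation.Binary.PropositionalEquality as ≡
open ≡ using (_≡_)

-- That the Casimir operator acts on coefficients by an affine function is a radial part
-- computation. Let Y_ab be the form of ω and E_ab E_ba η, where E acts on the positions in M. The
-- total action kills η, so E_ab can be traded for minus the action on everything outside M; this
-- commutes with E and leaves the weight alone. Hence x_b Y_ab = x_a Y_ba. Together with the
-- commutator of E_ab and E_ba this determines (x_a - x_b) Y_ab, and collecting one such term for
-- each factor of V turns the Casimir operator, conjugated by V, into the sum of the squares of the
-- Euler operators up to a constant. Invariance concerns all positions, although only those in M
-- carry variables, and it is inherited by polynomials in the Casimir operator applied to ω; this is
-- what lets the induction hypothesis apply to the modified state. The full product B_n comes from
-- one closed family containing all sizes, so products of Schur polynomials are never expanded.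
-- Everything stays over the integers: p! and the other positive factors are cancelled in
-- inequalities.

-- Integer coefficients are represented by reduced formal differences (a , b) of naturals.
module IntegerRingSolver (R : CommutativeRing 0ℓ 0ℓ) where
  open CommutativeRing R
  open import Algebra.Properties.Ring ring
  open import Algebra.Properties.Group +-group using () renaming (x∙y⁻¹≈ε⇒x≈y to x-y≈0⇒x≈y)
  open import Algebra.Properties.CommutativeSemigroup +-commutativeSemigroup using (interchange)
  import Algebra.Properties.Semiring.Mult semiring as M
  open import Relation.Binary.Reasoning.Setoid setoid

  private
    nat : ℕ → Carrier
    nat a = a M.× 1#

    val : ℕ × ℕ → Carrier
    val (a , b) = nat a - nat b

    reduce : ℕ → ℕ → ℕ × ℕ
    reduce (suc a) (suc b) = reduce a b
    reduce a       b       = a , b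

    coefficients : RawRing 0ℓ 0ℓ
    coefficients = record
      { Carrier = ℕ × ℕ
      ; _≈_ = _≡_
      ; _+_ = λ (a , b) (c , d) → reduce (a ℕ.+ c) (b ℕ.+ d)
      ; _*_ = λ (a , b) (c , d) → reduce (a ℕ.* c ℕ.+ b ℕ.* d) (a ℕ.* d ℕ.+ b ℕ.* c)
      ; -_ = λ (a , b) → b , a
      ; 0# = 0 , 0
      ; 1# = 1 , 0
      }

    sub-+ : ∀ x y z w → (x + z) - (y + w) ≈ (x - y) + (z - w)
    sub-+ x y z w = trans (+-congˡ (sym (-‿+-comm y w))) (interchange x z (- y) (- w))

    val-reduce : ∀ a b → val (reduce a b) ≈ val (a , b)
    val-reduce zero    b       = refl
    val-reduce (suc a) zero    = refl
    val-reduce (suc a) (suc b) = trans (val-reduce a b) (sym (trans (sub-+ 1# 1# (nat a) (nat b))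
      (trans (+-congʳ (-‿inverseʳ 1#)) (+-identityˡ _))))

    val-* : ∀ a b c d → val (a ℕ.* c ℕ.+ b ℕ.* d , a ℕ.* d ℕ.+ b ℕ.* c) ≈ val (a , b) * val (c , d)
    val-* a b c d = begin
      nat (a ℕ.* c ℕ.+ b ℕ.* d) - nat (a ℕ.* d ℕ.+ b ℕ.* c)
        ≈⟨ +-cong (nat-+* a c b d) (-‿cong (nat-+* a d b c)) ⟩
      (x * z + y * w) - (x * w + y * z)
        ≈⟨ sub-+ (x * z) (x * w) (y * w) (y * z) ⟩
      (x * z - x * w) + (y * w - y * z)
        ≈⟨ +-cong (sym (x[y-z]≈xy-xz x z w)) (sym (⁻¹-anti-homo‿- (y * z) (y * w))) ⟩
      x * (z - w) + - (y * z - y * w)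
        ≈⟨ +-congˡ (-‿cong (sym (x[y-z]≈xy-xz y z w))) ⟩
      x * (z - w) - y * (z - w)
        ≈⟨ [y-z]x≈yx-zx (z - w) x y ⟨
      (x - y) * (z - w) ∎
      where
      x = nat a
      y = nat b
      z = nat c
      w = nat d
      nat-+* : ∀ a b c d → nat (a ℕ.* b ℕ.+ c ℕ.* d) ≈ nat a * nat b + nat c * nat d
      nat-+* a b c d = trans (M.×-homo-+ 1# (a ℕ.* b) (c ℕ.* d)) (+-cong (M.×1-homo-* a b) (M.×1-homo-* c d))

    morphism : coefficients ACR.-Raw-AlmostCommutative⟶ ACR.fromCommutativeRing R
    morphism = record
      { ⟦_⟧ = val
      ; +-homo = λ (a , b) (c , d) → trans (val-reduce (a ℕ.+ c) (b ℕ.+ d)) (trans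
          (+-cong (M.×-homo-+ 1# a c) (-‿cong (M.×-homo-+ 1# b d)))
          (sub-+ (nat a) (nat b) (nat c) (nat d)))
      ; *-homo = λ (a , b) (c , d) → trans
          (val-reduce (a ℕ.* c ℕ.+ b ℕ.* d) (a ℕ.* d ℕ.+ b ℕ.* c)) (val-* a b c d)
      ; -‿homo = λ (a , b) → sym (⁻¹-anti-homo‿- (nat a) (nat b))
      ; 0-homo = -‿inverseʳ 0#
      ; 1-homo = trans (+-cong (+-identityʳ 1#) -0#≈0#) (+-identityʳ 1#)
      }

    decide : (p q : ℕ × ℕ) → Maybe (val p ≈ val q)
    decide (a , b) (c , d) with a ℕ.+ d ℕ.≟ c ℕ.+ b
    ... | no _ = nothing
    ... | yes e = just (x-y≈0⇒x≈y _ _ (begin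
      (nat a - nat b) - (nat c - nat d) ≈⟨ +-congˡ (⁻¹-anti-homo‿- (nat c) (nat d)) ⟩
      (nat a - nat b) + (nat d - nat c) ≈⟨ sub-+ (nat a) (nat b) (nat d) (nat c) ⟨
      (nat a + nat d) - (nat b + nat c) ≈⟨ +-cong (M.×-homo-+ 1# a d) (-‿cong (M.×-homo-+ 1# b c)) ⟨
      nat (a ℕ.+ d) - nat (b ℕ.+ c)     ≈⟨ +-cong (M.×-congˡ (≡.trans e (ℕP.+-comm c b))) refl ⟩
      nat (b ℕ.+ c) - nat (b ℕ.+ c)     ≈⟨ -‿inverseʳ _ ⟩
      0#                                ∎))

  open Solver coefficients (ACR.fromCommutativeRing R) morphism decide public
    using (solve; _:=_; _:+_; _:*_; _:-_; :-_; con)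

-- Finite sums and determinants by Laplace expansion

module Sums (R : CommutativeRing 0ℓ 0ℓ) where
  open CommutativeRing R
  open import Algebra.Properties.Ring ring using (-‿+-comm; -0#≈0#)
  open import Algebra.Properties.CommutativeSemigroup +-commutativeSemigroup using (interchange)

  ∑ : {A : Set} → List A → (A → Carrier) → Carrier
  ∑ []       g = 0#
  ∑ (a ∷ as) g = g a + ∑ as g

  ∑-cong : {A : Set} (as : List A) {g h : A → Carrier} → (∀ a → g a ≈ h a) → ∑ as g ≈ ∑ as h
  ∑-cong []       e = refl
  ∑-cong (a ∷ as) e = +-cong (e a) (∑-cong as e)

  ∑-zero : {A : Set} (as : List A) {g : A → Carrier} → (∀ a → g a ≈ 0#) → ∑ as g ≈ 0#
  ∑-zero []       e = refl
  ∑-zero (a ∷ as) e = trans (+-cong (e a) (∑-zero as e)) (+-identityˡ 0#)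

  ∑-+ : {A : Set} (as : List A) {g h : A → Carrier} → ∑ as (λ a → g a + h a) ≈ ∑ as g + ∑ as h
  ∑-+ []       = sym (+-identityˡ 0#)
  ∑-+ (a ∷ as) = trans (+-congˡ (∑-+ as)) (interchange _ _ _ _)

  ∑-neg : {A : Set} (as : List A) {g : A → Carrier} → ∑ as (λ a → - g a) ≈ - ∑ as g
  ∑-neg []       = sym -0#≈0#
  ∑-neg (a ∷ as) = trans (+-congˡ (∑-neg as)) (-‿+-comm _ _)

  ∑-*ˡ : {A : Set} (as : List A) {g : A → Carrier} (x : Carrier) → ∑ as (λ a → x * g a) ≈ x * ∑ as g
  ∑-*ˡ []       x = sym (zeroʳ x)
  ∑-*ˡ (a ∷ as) x = trans (+-congˡ (∑-*ˡ as x)) (sym (distribˡ x _ _))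

  ∑-*ʳ : {A : Set} (as : List A) {g : A → Carrier} (x : Carrier) → ∑ as (λ a → g a * x) ≈ ∑ as g * x
  ∑-*ʳ as x = trans (∑-cong as (λ a → *-comm _ x)) (trans (∑-*ˡ as x) (*-comm x _))

  ∑-++ : {A : Set} (as bs : List A) {g : A → Carrier} → ∑ (as ++ bs) g ≈ ∑ as g + ∑ bs g
  ∑-++ []       bs = sym (+-identityˡ _)
  ∑-++ (a ∷ as) bs = trans (+-congˡ (∑-++ as bs)) (sym (+-assoc _ _ _))

  ∑-map : {A B : Set} (f : A → B) (as : List A) {g : B → Carrier} → ∑ (L.map f as) g ≈ ∑ as (λ a → g (f a))
  ∑-map f []       = refl
  ∑-map f (a ∷ as) = +-congˡ (∑-map f as)

  ∑-concatMap : {A B : Set} (f : A → List B) (as : List A) {g : B → Carrier} →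
                ∑ (L.concatMap f as) g ≈ ∑ as (λ a → ∑ (f a) g)
  ∑-concatMap f []       = refl
  ∑-concatMap f (a ∷ as) = trans (∑-++ (f a) _) (+-congˡ (∑-concatMap f as))

  ∑-swap : {A B : Set} (as : List A) (bs : List B) {g : A → B → Carrier} →
           ∑ as (λ a → ∑ bs (g a)) ≈ ∑ bs (λ b → ∑ as (λ a → g a b))
  ∑-swap []       bs = sym (∑-zero bs (λ _ → refl))
  ∑-swap (a ∷ as) bs = trans (+-congˡ (∑-swap as bs)) (sym (∑-+ bs))

-- The pairs (column, remaining columns) at which `pick` evaluates its function. Congruence and
-- vanishing need be known for these pairs only, which matters when the columns are distinct or
-- bounded.
data Picked {A : Set} : List A → A → List A → Set where
  here  : ∀ {a as} → Picked (a ∷ as) a as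
  there : ∀ {a as c r} → Picked as c r → Picked (a ∷ as) c (a ∷ r)

module Determinants (R : CommutativeRing 0ℓ 0ℓ) where
  open CommutativeRing R
  open Sums R
  open import Algebra.Properties.Ring ring using (-0#≈0#; -‿distribʳ-*)
  open IntegerRingSolver R
  open import Relation.Binary.Reasoning.Setoid setoid

  -- For a determinant this is the Laplace expansion along a row.
  pick : {A : Set} → List A → (A → List A → Carrier) → Carrier
  pick []       g = 0#
  pick (a ∷ as) g = g a as - pick as (λ c r → g c (a ∷ r))

  det : {A : Set} → List (A → Carrier) → List A → Carrier
  det []         []      = 1#
  det []         (_ ∷ _) = 0#
  det (row ∷ rs) as      = pick as (λ c r → row c * det rs r)

  module _ {A : Set} where
    private variable
      g h : A → List A → Carrier

    pick-congᴾ : ∀ as → (∀ c r → Picked as c r → g c r ≈ h c r) → pick as g ≈ pick as h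
    pick-congᴾ []       e = refl
    pick-congᴾ (a ∷ as) e = +-cong (e a as here) (-‿cong (pick-congᴾ as (λ c r p → e c (a ∷ r) (there p))))

    pick-cong : ∀ as → (∀ c r → g c r ≈ h c r) → pick as g ≈ pick as h
    pick-cong as e = pick-congᴾ as (λ c r _ → e c r)

    pick-zeroᴾ : ∀ as → (∀ c r → Picked as c r → g c r ≈ 0#) → pick as g ≈ 0#
    pick-zeroᴾ []       e = refl
    pick-zeroᴾ (a ∷ as) e = trans
      (+-cong (e a as here) (trans (-‿cong (pick-zeroᴾ as (λ c r p → e c (a ∷ r) (there p)))) -0#≈0#))
      (+-identityˡ 0#)

    pick-zero : ∀ as → (∀ c r → g c r ≈ 0#) → pick as g ≈ 0#
    pick-zero as e = pick-zeroᴾ as (λ c r _ → e c r)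

    pick-+ : ∀ as → pick as (λ c r → g c r + h c r) ≈ pick as g + pick as h
    pick-+ []       = sym (+-identityˡ 0#)
    pick-+ {g} {h} (a ∷ as) = trans (+-congˡ (-‿cong (pick-+ as)))
      (solve 4 (λ x y z w → x :+ y :- (z :+ w) := (x :- z) :+ (y :- w)) refl _ _ _ _)

    pick-*ˡ : ∀ as x → pick as (λ c r → x * g c r) ≈ x * pick as g
    pick-*ˡ []       x = sym (zeroʳ x)
    pick-*ˡ (a ∷ as) x = trans (+-congˡ (-‿cong (pick-*ˡ as x)))
      (solve 3 (λ x y z → x :* y :- x :* z := x :* (y :- z)) refl _ _ _)

    pick-neg : ∀ as → pick as (λ c r → - g c r) ≈ - pick as g
    pick-neg []       = sym -0#≈0#
    pick-neg (a ∷ as) = trans (+-congˡ (-‿cong (pick-neg as)))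
      (solve 2 (λ x y → (:- x) :- (:- y) := :- (x :- y)) refl _ _)

    pick-∑ : {B : Set} (bs : List B) {k : B → A → List A → Carrier} → ∀ as →
             pick as (λ c r → ∑ bs (λ b → k b c r)) ≈ ∑ bs (λ b → pick as (k b))
    pick-∑ []       as = pick-zero as (λ _ _ → refl)
    pick-∑ (b ∷ bs) as = trans (pick-+ as) (+-congˡ (pick-∑ bs as))

    -- Choosing c first and then d carries the opposite sign to choosing d first and then c. This is
    -- the antisymmetry of a determinant in two adjacent rows, and later of an alternant in two
    -- adjacent variables.
    pick-pick-anti : (k : A → A → List A → Carrier) → ∀ as →
      pick as (λ c r → pick r (λ d r′ → k c d r′)) ≈ - pick as (λ c r → pick r (λ d r′ → k d c r′))
    pick-pick-anti k []       = sym -0#≈0#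
    pick-pick-anti k (a ∷ as) = begin
      pick as (λ d → k a d) - pick as (λ c r → k c a r - pick r (λ d r′ → k c d (a ∷ r′)))
        ≈⟨ +-congˡ (-‿cong (split _ _)) ⟩
      pick as (λ d → k a d) - (pick as (λ c → k c a) - pick as (λ c r → pick r (λ d r′ → k c d (a ∷ r′))))
        ≈⟨ +-congˡ (-‿cong (+-congˡ (-‿cong (pick-pick-anti (λ c d r → k c d (a ∷ r)) as)))) ⟩
      pick as (λ d → k a d) - (pick as (λ c → k c a) - (- pick as (λ c r → pick r (λ d r′ → k d c (a ∷ r′)))))
        ≈⟨ solve 3 (λ x y z → x :- (y :- (:- z)) := :- (y :- (x :- z))) refl _ _ _ ⟩
      - (pick as (λ c → k c a) - (pick as (λ d → k a d) - pick as (λ c r → pick r (λ d r′ → k d c (a ∷ r′)))))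
        ≈⟨ -‿cong (+-congˡ (-‿cong (split _ _))) ⟨
      - (pick as (λ c → k c a) - pick as (λ c r → k a c r - pick r (λ d r′ → k d c (a ∷ r′)))) ∎
      where
      split : ∀ g h → pick as (λ c r → g c r - h c r) ≈ pick as g - pick as h
      split g h = trans (pick-+ as) (+-congˡ (pick-neg as))

    Alternating Skew : (List A → Carrier) → Set
    Alternating k = ∀ as t bs → k (as ++ t ∷ t ∷ bs) ≈ 0#
    Skew k = ∀ as s t bs → k (as ++ s ∷ t ∷ bs) ≈ - k (as ++ t ∷ s ∷ bs)

    -- Picking either of the two equal neighbours leaves the same list, with opposite signs; every
    -- other term still contains both. This is proved apart from skewness, which over a general ring
    -- yields only twice the value being zero.
    pick-alternating : ∀ as t bs → (∀ c → Alternating (g c)) → pick (as ++ t ∷ t ∷ bs) g ≈ 0#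
    pick-alternating {g} [] t bs alt = begin
      g t (t ∷ bs) - (g t (t ∷ bs) - pick bs (λ c r → g c (t ∷ t ∷ r)))
        ≈⟨ solve 2 (λ x y → x :- (x :- y) := y) refl _ _ ⟩
      pick bs (λ c r → g c (t ∷ t ∷ r)) ≈⟨ pick-zero bs (λ c r → alt c [] t r) ⟩
      0# ∎
    pick-alternating {g} (a ∷ as) t bs alt = trans
      (+-cong (alt a as t bs)
              (trans (-‿cong (pick-alternating as t bs (λ c as′ → alt c (a ∷ as′)))) -0#≈0#))
      (+-identityˡ 0#)

    det-alternating : ∀ rs → Alternating (det rs)
    det-alternating []       []       t bs = refl
    det-alternating []       (a ∷ as) t bs = refl
    det-alternating (r ∷ rs) as t bs = pick-alternating as t bs
      (λ c as′ t′ bs′ → trans (*-congˡ (det-alternating rs as′ t′ bs′)) (zeroʳ _))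

    pick-skew : ∀ as s t bs → (∀ c → Skew (g c)) → pick (as ++ s ∷ t ∷ bs) g ≈ - pick (as ++ t ∷ s ∷ bs) g
    pick-skew {g} [] s t bs sk = begin
      g s (t ∷ bs) - (g t (s ∷ bs) - pick bs (λ c r → g c (s ∷ t ∷ r)))
        ≈⟨ +-congˡ (-‿cong (+-congˡ (-‿cong (trans (pick-cong bs (λ c r → sk c [] s t r)) (pick-neg bs))))) ⟩
      g s (t ∷ bs) - (g t (s ∷ bs) - (- pick bs (λ c r → g c (t ∷ s ∷ r))))
        ≈⟨ solve 3 (λ x y z → x :- (y :- (:- z)) := :- (y :- (x :- z))) refl _ _ _ ⟩
      - (g t (s ∷ bs) - (g s (t ∷ bs) - pick bs (λ c r → g c (t ∷ s ∷ r)))) ∎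
    pick-skew {g} (a ∷ as) s t bs sk = trans
      (+-cong (sk a as s t bs) (-‿cong (pick-skew as s t bs (λ c as′ → sk c (a ∷ as′)))))
      (solve 2 (λ x y → (:- x) :- (:- y) := :- (x :- y)) refl _ _)

    det-skew : ∀ rs → Skew (det rs)
    det-skew []       []       s t bs = sym -0#≈0#
    det-skew []       (a ∷ as) s t bs = sym -0#≈0#
    det-skew (r ∷ rs) as s t bs = pick-skew as s t bs
      (λ c as′ s′ t′ bs′ → trans (*-congˡ (det-skew rs as′ s′ t′ bs′)) (sym (-‿distribʳ-* _ _)))

-- Alternants, Schur polynomials by branching, and the bialternant formula

module Alternants (R : CommutativeRing 0ℓ 0ℓ) where
  open CommutativeRing R
  open Determinants R
  open import Algebra.Properties.Ring ring using (-0#≈0#)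
  open import Algebra.Properties.Semiring.Exp semiring public using (_^_)
  open import Algebra.Properties.Semiring.Exp semiring using (^-homo-*)
  open IntegerRingSolver R
  open import Relation.Binary.Reasoning.Setoid setoid

  power : Carrier → ℕ → Carrier
  power x l = x ^ l

  alternant : List Carrier → List ℕ → Carrier
  alternant xs = det (L.map power xs)

  differences : Carrier → List Carrier → Carrier
  differences x []       = 1#
  differences x (y ∷ ys) = (x - y) * differences x ys

  vandermonde : List Carrier → Carrier
  vandermonde []       = 1#
  vandermonde (x ∷ xs) = differences x xs * vandermonde xs

  -- The sum of x^(a + k - 1 - m) h m over a ≤ m < a + k. With a and a + k consecutive parts of l,
  -- the exponent is the number of entries x in one row: the difference of the old and new row
  -- lengths once both staircases are subtracted.
  window : Carrier → ℕ → ℕ → (ℕ → Carrier) → Carrier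
  window x a zero    h = 0#
  window x a (suc k) h = x ^ k * h a + window x (suc a) k h

  interlace : Carrier → List ℕ → (List ℕ → Carrier) → Carrier
  interlace x []             g = 0#
  interlace x (l ∷ [])       g = x ^ l * g []
  interlace x (l ∷ l′ ∷ ls) g =
    window x l′ (l ∸ l′) (λ m → interlace x (l′ ∷ ls) (λ ms → g (m ∷ ms)))

  -- The Schur polynomial of the partition λ, where l = λ + (n-1, …, 1, 0),
  -- by branching: the exponents m below l satisfy l₁ > m₁ ≥ l₂ > m₂ ≥ ⋯.
  schurStrict : List Carrier → List ℕ → Carrier
  schurStrict []       []      = 1#
  schurStrict []       (_ ∷ _) = 0#
  schurStrict (x ∷ xs) l       = interlace x l (schurStrict xs)

  window-cong : ∀ x a k {h h′ : ℕ → Carrier} → (∀ m → a ℕ.≤ m → m ℕ.< a ℕ.+ k → h m ≈ h′ m) →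
                window x a k h ≈ window x a k h′
  window-cong x a zero    e = refl
  window-cong x a (suc k) e = +-cong
    (*-congˡ (e a ℕP.≤-refl (ℕP.m<m+n a (ℕ.s≤s ℕ.z≤n))))
    (window-cong x (suc a) k (λ m a<m m< → e m (ℕP.<⇒≤ a<m) (≡.subst (m ℕ.<_) (≡.sym (ℕP.+-suc a k)) m<)))

  window-*ˡ : ∀ x a k {h : ℕ → Carrier} c → c * window x a k h ≈ window x a k (λ m → c * h m)
  window-*ˡ x a zero    c = zeroʳ c
  window-*ˡ x a (suc k) c = trans (distribˡ c _ _)
    (+-cong (solve 3 (λ c y z → c :* (y :* z) := y :* (c :* z)) refl _ _ _) (window-*ˡ x (suc a) k c))

  -- For h m = y^m this is (x - y) times a complete homogeneous sum in x and y, multiplied by a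
  -- power of y; the inner terms cancel in pairs.
  window-telescope : ∀ x a k (h : ℕ → Carrier) →
    window x a k (λ m → x * h m - h (suc m)) ≈ x ^ k * h a - h (a ℕ.+ k)
  window-telescope x a zero h = begin
    0#               ≈⟨ -‿inverseʳ (h a) ⟨
    h a - h a        ≈⟨ +-cong (sym (*-identityˡ _)) (-‿cong (reflexive (≡.cong h (≡.sym (ℕP.+-identityʳ a))))) ⟩
    1# * h a - h (a ℕ.+ 0) ∎
  window-telescope x a (suc k) h = begin
    x ^ k * (x * h a - h (suc a)) + window x (suc a) k (λ m → x * h m - h (suc m))
      ≈⟨ +-congˡ (window-telescope x (suc a) k h) ⟩
    x ^ k * (x * h a - h (suc a)) + (x ^ k * h (suc a) - h (suc a ℕ.+ k))
      ≈⟨ solve 5 (λ x y z u v → y :* (x :* z :- u) :+ (y :* u :- v) := (x :* y) :* z :- v) refl _ _ _ _ _ ⟩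
    x * x ^ k * h a - h (suc a ℕ.+ k)
      ≈⟨ +-congˡ (-‿cong (reflexive (≡.cong h (≡.sym (ℕP.+-suc a k))))) ⟩
    x * x ^ k * h a - h (a ℕ.+ suc k) ∎

  private
    between : ∀ {l l′ m ms} → l > m → m ℕ.≥ l′ → Linked _>_ (l′ ∷ ms) → Linked _>_ (l ∷ m ∷ ms)
    between l>m m≥l′ [-]        = l>m ∷ [-]
    between l>m m≥l′ (l′>h ∷ s) = l>m ∷ (ℕP.<-≤-trans l′>h m≥l′ ∷ s)

  interlace-cong : ∀ x {l ls} {g h : List ℕ → Carrier} → Linked _>_ (l ∷ ls) →
    (∀ ms → Linked _>_ (l ∷ ms) → g ms ≈ h ms) → interlace x (l ∷ ls) g ≈ interlace x (l ∷ ls) h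
  interlace-cong x [-]         e = *-congˡ (e [] [-])
  interlace-cong x {l} {l′ ∷ _} (l>l′ ∷ s) e = window-cong x l′ (l ∸ l′)
    (λ m l′≤m m< → interlace-cong x s
      (λ ms s′ → e (m ∷ ms) (between (≡.subst (m ℕ.<_) (ℕP.m+[n∸m]≡n (ℕP.<⇒≤ l>l′)) m<) l′≤m s′)))

  interlace-*ˡ : ∀ x l {g : List ℕ → Carrier} c → c * interlace x l g ≈ interlace x l (λ ms → c * g ms)
  interlace-*ˡ x []            c = zeroʳ c
  interlace-*ˡ x (l ∷ [])      c = solve 3 (λ c y z → c :* (y :* z) := y :* (c :* z)) refl _ _ _
  interlace-*ˡ x (l ∷ l′ ∷ ls) c = trans (window-*ˡ x l′ (l ∸ l′) c)
    (window-cong x l′ (l ∸ l′) (λ m _ _ → interlace-*ˡ x (l′ ∷ ls) c))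

  -- The effect of multiplying every column t ↦ y^t by x - y.
  shift : Carrier → (List ℕ → Carrier) → List ℕ → Carrier
  shift x g []       = g []
  shift x g (t ∷ ts) = x * shift x (λ r → g (t ∷ r)) ts - shift x (λ r → g (suc t ∷ r)) ts

  shift-zero : ∀ x {g : List ℕ → Carrier} → (∀ ts → g ts ≈ 0#) → ∀ ts → shift x g ts ≈ 0#
  shift-zero x e []       = e []
  shift-zero x e (t ∷ ts) = trans
    (+-cong (trans (*-congˡ (shift-zero x (λ r → e (t ∷ r)) ts)) (zeroʳ x))
            (trans (-‿cong (shift-zero x (λ r → e (suc t ∷ r)) ts)) -0#≈0#))
    (+-identityˡ 0#)

  shift-linear : ∀ x c (g h : List ℕ → Carrier) ts →
    shift x (λ r → c * g r - h r) ts ≈ c * shift x g ts - shift x h ts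
  shift-linear x c g h []       = refl
  shift-linear x c g h (t ∷ ts) = trans
    (+-cong (*-congˡ (shift-linear x c _ _ ts)) (-‿cong (shift-linear x c _ _ ts)))
    (solve 6 (λ x c a b a′ b′ → x :* (c :* a :- b) :- (c :* a′ :- b′) := c :* (x :* a :- a′) :- (x :* b :- b′))
             refl _ _ _ _ _ _)

  -- The operators that `shift` applies at different positions commute, so the one at the picked
  -- column can act on the row entry `h c` and the others on the remaining minor.
  shift-pick : ∀ x (h : ℕ → Carrier) (k : List ℕ → Carrier) ts →
    shift x (λ r → pick r (λ c r′ → h c * k r′)) ts ≈
    pick ts (λ c r → (x * h c - h (suc c)) * shift x k r)
  shift-pick x h k []       = refl
  shift-pick x h k (t ∷ ts) = begin
    x * shift x (λ r → h t * k r - pick r (λ c r′ → h c * k (t ∷ r′))) ts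
      - shift x (λ r → h (suc t) * k r - pick r (λ c r′ → h c * k (suc t ∷ r′))) ts
      ≈⟨ +-cong (*-congˡ (branch t)) (-‿cong (branch (suc t))) ⟩
    x * (h t * shift x k ts - rest t) - (h (suc t) * shift x k ts - rest (suc t))
      ≈⟨ solve 6 (λ x h h′ s r r′ → x :* (h :* s :- r) :- (h′ :* s :- r′)
                                   := (x :* h :- h′) :* s :- (x :* r :- r′)) refl _ _ _ _ _ _ ⟩
    (x * h t - h (suc t)) * shift x k ts - (x * rest t - rest (suc t))
      ≈⟨ +-congˡ (-‿cong merge) ⟩
    (x * h t - h (suc t)) * shift x k ts
      - pick ts (λ c r → (x * h c - h (suc c)) * shift x k (t ∷ r)) ∎
    where
    rest : ℕ → Carrier
    rest s = pick ts (λ c r → (x * h c - h (suc c)) * shift x (λ r′ → k (s ∷ r′)) r)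
    branch : ∀ s → shift x (λ r → h s * k r - pick r (λ c r′ → h c * k (s ∷ r′))) ts ≈
                   h s * shift x k ts - rest s
    branch s = trans (shift-linear x (h s) k _ ts)
                     (+-congˡ (-‿cong (shift-pick x h (λ r → k (s ∷ r)) ts)))
    merge : x * rest t - rest (suc t) ≈ pick ts (λ c r → (x * h c - h (suc c)) * shift x k (t ∷ r))
    merge = begin
      x * rest t - rest (suc t) ≈⟨ +-cong (pick-*ˡ ts x) (pick-neg ts) ⟨
      pick ts _ + pick ts _ ≈⟨ pick-+ ts ⟨
      pick ts _ ≈⟨ pick-cong ts (λ c r → solve 4 (λ x h s s′ → x :* (h :* s) :+ (:- (h :* s′))
                      := h :* (x :* s :- s′)) refl _ _ _ _) ⟩
      pick ts (λ c r → (x * h c - h (suc c)) * shift x k (t ∷ r)) ∎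

  -- The product of the x - y has one factor per row. In the row of y that factor turns y^c into x
  -- y^c - y^(c+1), which is the operation `shift` performs on the column c.
  differences-alternant : ∀ x ys ts → differences x ys * alternant ys ts ≈ shift x (alternant ys) ts
  differences-alternant x []       []       = *-identityˡ 1#
  differences-alternant x []       (t ∷ ts) = trans (zeroʳ 1#) (sym (trans
    (+-cong (trans (*-congˡ (shift-zero x (λ _ → refl) ts)) (zeroʳ x))
            (trans (-‿cong (shift-zero x (λ _ → refl) ts)) -0#≈0#))
    (+-identityˡ 0#)))
  differences-alternant x (y ∷ ys) ts = begin
    (x - y) * differences x ys * pick ts (λ c r → y ^ c * alternant ys r)
      ≈⟨ pick-*ˡ ts _ ⟨
    pick ts (λ c r → (x - y) * differences x ys * (y ^ c * alternant ys r))
      ≈⟨ pick-cong ts (λ c r → trans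
           (solve 5 (λ x y d p a → (x :- y) :* d :* (p :* a) := (x :* p :- y :* p) :* (d :* a)) refl _ _ _ _ _)
           (*-congˡ (differences-alternant x ys r))) ⟩
    pick ts (λ c r → (x * y ^ c - y ^ suc c) * shift x (alternant ys) r)
      ≈⟨ shift-pick x (y ^_) (alternant ys) ts ⟨
    shift x (alternant (y ∷ ys)) ts ∎

  private
    endpoints : Carrier → List ℕ → (List ℕ → Carrier) → Carrier
    endpoints x []            g = 0#
    endpoints x (l ∷ [])      g = x ^ l * g []
    endpoints x (l ∷ l′ ∷ ls) g = x ^ (l ∸ l′) * endpoints x (l′ ∷ ls) (λ r → g (l′ ∷ r))
                                  - endpoints x (l′ ∷ ls) (λ r → g (l ∷ r))

  window-sub : ∀ x a k (c : Carrier) (g h : ℕ → Carrier) →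
    window x a k (λ m → c * g m - h m) ≈ c * window x a k g - window x a k h
  window-sub x a zero    c g h = sym (trans (+-cong (zeroʳ c) -0#≈0#) (+-identityˡ 0#))
  window-sub x a (suc k) c g h = trans (+-congˡ (window-sub x (suc a) k c g h))
    (solve 6 (λ c p a b a′ b′ → p :* (c :* a :- b) :+ (c :* a′ :- b′)
              := c :* (p :* a :+ a′) :- (p :* b :+ b′)) refl _ _ _ _ _ _)

  interlace-sub : ∀ x l (c : Carrier) {g h : List ℕ → Carrier} →
    interlace x l (λ ms → c * g ms - h ms) ≈ c * interlace x l g - interlace x l h
  interlace-sub x []            c = sym (trans (+-cong (zeroʳ c) -0#≈0#) (+-identityˡ 0#))
  interlace-sub x (l ∷ [])      c = solve 4 (λ c p g h → p :* (c :* g :- h) := c :* (p :* g) :- p :* h) refl _ _ _ _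
  interlace-sub x (l ∷ l′ ∷ ls) c = trans
    (window-cong x l′ (l ∸ l′) (λ m _ _ → interlace-sub x (l′ ∷ ls) c)) (window-sub x l′ (l ∸ l′) c _ _)

  -- Each window telescopes, so of the range of an interlacing exponent only the lower end `l′` and
  -- the upper end `l` survive.
  interlace-shift : ∀ x {l ls} → Linked _>_ (l ∷ ls) → (g : List ℕ → Carrier) →
    interlace x (l ∷ ls) (shift x g) ≈ endpoints x (l ∷ ls) g
  interlace-shift x [-]                           g = refl
  interlace-shift x {l} {l′ ∷ ls} (l>l′ ∷ s) g = begin
    window x l′ (l ∸ l′) (λ m → interlace x (l′ ∷ ls) (λ ms →
      x * shift x (λ r → g (m ∷ r)) ms - shift x (λ r → g (suc m ∷ r)) ms))
      ≈⟨ window-cong x l′ (l ∸ l′) (λ m _ _ → interlace-sub x (l′ ∷ ls) x) ⟩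
    window x l′ (l ∸ l′) (λ m → x * J m - J (suc m))
      ≈⟨ window-telescope x l′ (l ∸ l′) J ⟩
    x ^ (l ∸ l′) * J l′ - J (l′ ℕ.+ (l ∸ l′))
      ≈⟨ +-cong (*-congˡ (interlace-shift x s _))
                (-‿cong (trans (reflexive (≡.cong J (ℕP.m+[n∸m]≡n (ℕP.<⇒≤ l>l′)))) (interlace-shift x s _))) ⟩
    endpoints x (l ∷ l′ ∷ ls) g ∎
    where
    J : ℕ → Carrier
    J m = interlace x (l′ ∷ ls) (shift x (λ r → g (m ∷ r)))

  -- A lower end followed by an upper end repeats an exponent, and an alternating g kills the term.
  -- What remains are upper ends followed by lower ends, that is, the list with one entry left out:
  -- a Laplace expansion.
  endpoints-pick : ∀ x {l ls} → Linked _>_ (l ∷ ls) → (g : List ℕ → Carrier) → Alternating g →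
    endpoints x (l ∷ ls) g ≈ pick (l ∷ ls) (λ c r → x ^ c * g r)
  endpoints-pick x {l} [-] g alt = sym (trans (+-congˡ -0#≈0#) (+-identityʳ _))
  endpoints-pick x {l} {l′ ∷ ls} (l>l′ ∷ s) g alt = begin
    x ^ (l ∸ l′) * endpoints x (l′ ∷ ls) (λ r → g (l′ ∷ r)) - endpoints x (l′ ∷ ls) (λ r → g (l ∷ r))
      ≈⟨ +-cong (*-congˡ (endpoints-pick x s _ (λ as → alt (l′ ∷ as))))
                (-‿cong (endpoints-pick x s _ (λ as → alt (l ∷ as)))) ⟩
    x ^ (l ∸ l′) * (x ^ l′ * g (l′ ∷ ls) - pick ls (λ c r → x ^ c * g (l′ ∷ l′ ∷ r))) - tail
      ≈⟨ +-congʳ (*-congˡ (trans (+-congˡ (trans (-‿cong (pick-zero ls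
           (λ c r → trans (*-congˡ (alt [] l′ r)) (zeroʳ _)))) -0#≈0#)) (+-identityʳ _))) ⟩
    x ^ (l ∸ l′) * (x ^ l′ * g (l′ ∷ ls)) - tail
      ≈⟨ +-congʳ (trans (sym (*-assoc _ _ _)) (*-congʳ (trans (sym (^-homo-* x (l ∸ l′) l′))
           (reflexive (≡.cong (x ^_) (ℕP.m∸n+n≡m (ℕP.<⇒≤ l>l′))))))) ⟩
    x ^ l * g (l′ ∷ ls) - tail ∎
    where
    tail = pick (l′ ∷ ls) (λ c r → x ^ c * g (l ∷ r))

  schurStrict-staircase : ∀ xs → schurStrict xs (L.downFrom (L.length xs)) ≈ 1#
  schurStrict-staircase []       = refl
  schurStrict-staircase (x ∷ xs) = trans (step (L.length xs)) (schurStrict-staircase xs)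
    where
    step : ∀ k {g : List ℕ → Carrier} → interlace x (L.downFrom (suc k)) g ≈ g (L.downFrom k)
    step zero    = *-identityˡ _
    step (suc k) {g} rewrite ℕP.m+n∸n≡m 1 k = begin
      1# * interlace x (L.downFrom (suc k)) (λ ms → g (k ∷ ms)) + 0# ≈⟨ +-identityʳ _ ⟩
      1# * interlace x (L.downFrom (suc k)) (λ ms → g (k ∷ ms))      ≈⟨ *-identityˡ _ ⟩
      interlace x (L.downFrom (suc k)) (λ ms → g (k ∷ ms))           ≈⟨ step k ⟩
      g (k ∷ L.downFrom k)                                           ∎

  -- Jacobi's bialternant formula.
  vandermonde-schur : ∀ xs {l} → Linked _>_ l → vandermonde xs * schurStrict xs l ≈ alternant xs l
  vandermonde-schur []       {[]}     s = *-identityˡ 1#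
  vandermonde-schur []       {l ∷ ls} s = zeroʳ 1#
  vandermonde-schur (x ∷ xs) {[]}     s = zeroʳ _
  vandermonde-schur (x ∷ xs) {l ∷ ls} s = begin
    differences x xs * vandermonde xs * interlace x (l ∷ ls) (schurStrict xs)
      ≈⟨ interlace-*ˡ x (l ∷ ls) _ ⟩
    interlace x (l ∷ ls) (λ ms → differences x xs * vandermonde xs * schurStrict xs ms)
      ≈⟨ interlace-cong x s (λ ms s′ → trans (*-assoc _ _ _)
           (trans (*-congˡ (vandermonde-schur xs (Linked.tail s′))) (differences-alternant x xs ms))) ⟩
    interlace x (l ∷ ls) (shift x (alternant xs)) ≈⟨ interlace-shift x s (alternant xs) ⟩
    endpoints x (l ∷ ls) (alternant xs)
      ≈⟨ endpoints-pick x s (alternant xs) (det-alternating (L.map power xs)) ⟩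
    alternant (x ∷ xs) (l ∷ ls) ∎

-- Division-free identities for the radial part

module PairIdentities (R : CommutativeRing 0ℓ 0ℓ) where
  open CommutativeRing R
  open IntegerRingSolver R
  open import Relation.Binary.Reasoning.Setoid setoid

  -- The hypotheses give (x - y) Y = x (A - B) and (x - y) Y′ = y (A - B). Adding these to (x - y)(A
  -- + B) leaves 2 (x A - y B), without ever dividing by x - y.
  pair-identity : ∀ x y Y Y′ A B → y * Y ≈ x * Y′ → Y ≈ Y′ + (A - B) →
    (x - y) * ((Y + A) + (Y′ + B)) ≈ (x * A - y * B) + (x * A - y * B)
  pair-identity x y Y Y′ A B r₁ r₂ = begin
    (x - y) * ((Y + A) + (Y′ + B))
      ≈⟨ solve 6 (λ x y Y Y′ A B → (x :- y) :* ((Y :+ A) :+ (Y′ :+ B))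
           := x :* Y :- y :* Y′ :+ x :* Y′ :- y :* Y :+ (x :- y) :* (A :+ B)) refl x y Y Y′ A B ⟩
    x * Y - y * Y′ + x * Y′ - y * Y + (x - y) * (A + B)
      ≈⟨ +-congʳ (+-cong (+-congʳ (+-congʳ (*-congˡ r₂))) (-‿cong r₁)) ⟩
    x * (Y′ + (A - B)) - y * Y′ + x * Y′ - x * Y′ + (x - y) * (A + B)
      ≈⟨ solve 5 (λ x y Y′ A B → x :* (Y′ :+ (A :- B)) :- y :* Y′ :+ x :* Y′ :- x :* Y′ :+ (x :- y) :* (A :+ B)
           := x :* Y′ :- y :* (Y′ :+ (A :- B)) :+ ((x :* A :- y :* B) :+ (x :* A :- y :* B))) refl x y Y′ A B ⟩
    x * Y′ - y * (Y′ + (A - B)) + ((x * A - y * B) + (x * A - y * B))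
      ≈⟨ +-congʳ (+-cong (sym r₁) (-‿cong (*-congˡ (sym r₂)))) ⟩
    y * Y - y * Y + ((x * A - y * B) + (x * A - y * B))
      ≈⟨ solve 2 (λ p q → p :- p :+ q := q) refl (y * Y) _ ⟩
    (x * A - y * B) + (x * A - y * B) ∎

  -- Logarithmic derivatives of a product add. The quantities are carried doubled, since
  -- `pair-identity` yields twice the derivative and the ring need not contain 1/2.
  leibniz-step : ∀ d D γ Γ s t → γ + γ ≈ d * s → Γ + Γ ≈ D * t →
    (d * Γ + D * γ) + (d * Γ + D * γ) ≈ (d * D) * (s + t)
  leibniz-step d D γ Γ s t e f = begin
    (d * Γ + D * γ) + (d * Γ + D * γ)
      ≈⟨ solve 4 (λ d D γ Γ → (d :* Γ :+ D :* γ) :+ (d :* Γ :+ D :* γ) := d :* (Γ :+ Γ) :+ D :* (γ :+ γ)) refl d D γ Γ ⟩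
    d * (Γ + Γ) + D * (γ + γ) ≈⟨ +-cong (*-congˡ f) (*-congˡ e) ⟩
    d * (D * t) + D * (d * s)
      ≈⟨ solve 4 (λ d D s t → d :* (D :* t) :+ D :* (d :* s) := (d :* D) :* (s :+ t)) refl d D s t ⟩
    (d * D) * (s + t) ∎

  module _ {A : Set} where
    open Sums R using () renaming (∑ to sum; ∑-cong to sum-cong; ∑-+ to sum-+)

    pairs : List A → (A → A → Carrier) → Carrier
    pairs []       g = 0#
    pairs (i ∷ is) g = sum is (g i) + pairs is g

    pairs-symmetrised : ∀ is (g : A → A → Carrier) →
      pairs is (λ i j → g i j + g j i) + sum is (λ i → g i i) ≈ sum is (λ i → sum is (g i))
    pairs-symmetrised []       g = +-identityˡ 0#
    pairs-symmetrised (i ∷ is) g = begin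
      (sum is (λ j → g i j + g j i) + P) + (g i i + D)
        ≈⟨ +-congʳ (+-congʳ (sum-+ is)) ⟩
      ((sum is (g i) + sum is (λ j → g j i)) + P) + (g i i + D)
        ≈⟨ solve 5 (λ a b p g d → ((a :+ b) :+ p) :+ (g :+ d) := (g :+ a) :+ (b :+ (p :+ d))) refl _ _ _ _ _ ⟩
      (g i i + sum is (g i)) + (sum is (λ j → g j i) + (P + D))
        ≈⟨ +-congˡ (+-congˡ (pairs-symmetrised is g)) ⟩
      (g i i + sum is (g i)) + (sum is (λ j → g j i) + sum is (λ j → sum is (g j)))
        ≈⟨ +-congˡ (sym (sum-+ is)) ⟩
      (g i i + sum is (g i)) + sum is (λ j → g j i + sum is (g j)) ∎
      where
      P = pairs is (λ i j → g i j + g j i)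
      D = sum is (λ i → g i i)

import Data.Bool as Bool
open import Data.Bool using (Bool; true; false; _∧_; if_then_else_)
open import Data.Bool.ListAction using (and)
open import Data.Unit using (tt)
open import Data.Nat.ListAction using () renaming (sum to sumℕ)
open import Data.Integer as ℤ using (ℤ; -[1+_]; +≤+; Positive; -_; _+_; _*_; _-_; 0ℤ; 1ℤ; _≤_; ∣_∣) renaming (+_ to ⁺_)
import Data.Integer.Properties as ℤP
open import Data.Integer.Tactic.RingSolver using (solve-∀)
open import Data.Fin using (Fin; zero; suc; toℕ; inject₁; fromℕ)
import Data.Fin.Properties as FP
import Data.List.Properties as LP
open import Data.Vec as V using (Vec; []; _∷_; lookup; toList; zipWith; replicate; updateAt; _∷ʳ_)
import Data.Vec.Properties as VP
open import Data.Sum using (_⊎_; inj₁; inj₂)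
open import Data.Empty using (⊥-elim)
open import Data.List.Membership.Propositional using (_∈_; _∉_)
import Data.List.Membership.Propositional.Properties as ∈P
import Data.List.Membership.Propositional.Properties.WithK as ∈K
import Data.List.Membership.DecPropositional as DecMembership
open import Data.List.Relation.Unary.Any using (here; there)
open import Data.List.Relation.Unary.All as All using (All; []; _∷_)
import Data.List.Relation.Unary.All.Properties as AllP
open import Data.List.Relation.Unary.Unique.Propositional using (Unique; _∷_; [])
import Data.List.Relation.Unary.Unique.Propositional.Properties as UP
import Data.List.Relation.Unary.Unique.DecPropositional.Properties as UDP
open import Data.List.Relation.Binary.Permutation.Propositional as Perm using (_↭_)
open import Data.List.Relation.Binary.BagAndSetEquality using (∼bag⇒↭)
open import Function using (_∘_; id; mk⇔)
open import Relation.Nullary.Decidable using (⌊_⌋)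
open import Relation.Binary.PropositionalEquality hiding (J)

open Sums ℤP.+-*-commutativeRing
open Determinants ℤP.+-*-commutativeRing

private variable
  n : ℕ

∑-allFin : (g : Fin (suc n) → ℤ) → ∑ (L.allFin (suc n)) g ≡ g zero + ∑ (L.allFin n) (g ∘ suc)
∑-allFin {n} g = cong (g zero +_) (trans (cong (λ is → ∑ is g) (sym (LP.map-tabulate id suc))) (∑-map suc (L.allFin n)))

-- Integer polynomials, tested against functions of the exponent

infixl 6 _⊕_
_⊕_ : Vec ℕ n → Vec ℕ n → Vec ℕ n
_⊕_ = zipWith ℕ._+_

⊕-comm : (u w : Vec ℕ n) → u ⊕ w ≡ w ⊕ u
⊕-comm = VP.zipWith-comm ℕP.+-comm

⊕-assoc : (u v w : Vec ℕ n) → (u ⊕ v) ⊕ w ≡ u ⊕ (v ⊕ w)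
⊕-assoc = VP.zipWith-assoc ℕP.+-assoc

𝟘 : Vec ℕ n
𝟘 = replicate _ 0

⊕-identityˡ : (u : Vec ℕ n) → 𝟘 ⊕ u ≡ u
⊕-identityˡ = VP.zipWith-identityˡ ℕP.+-identityˡ

inc : Fin n → Vec ℕ n → Vec ℕ n
inc a u = updateAt u a suc

inc-⊕ : (a : Fin n) (u w : Vec ℕ n) → inc a u ⊕ w ≡ inc a (u ⊕ w)
inc-⊕ zero    (x ∷ u) (y ∷ w) = refl
inc-⊕ (suc a) (x ∷ u) (y ∷ w) = cong (x ℕ.+ y ∷_) (inc-⊕ a u w)

inc-comm : (a b : Fin n) (u : Vec ℕ n) → inc a (inc b u) ≡ inc b (inc a u)
inc-comm zero    zero    (x ∷ u) = refl
inc-comm zero    (suc b) (x ∷ u) = refl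
inc-comm (suc a) zero    (x ∷ u) = refl
inc-comm (suc a) (suc b) (x ∷ u) = cong (x ∷_) (inc-comm a b u)

Pol : ℕ → Set
Pol n = List (ℤ × Vec ℕ n)

Test : ℕ → Set
Test n = Vec ℕ n → ℤ

opaque
  -- A polynomial is used through its pairing with arbitrary functions of the exponent.
  -- Multiplication by a variable becomes precomposition with `inc`, Euler operators become weights
  -- on the test function, and coefficients are the values at `δ`.
  ⟦_⟧ : Pol n → Test n → ℤ
  ⟦ p ⟧ φ = ∑ p (λ (c , u) → c * φ u)

  ⟦⟧-term : (c : ℤ) (u : Vec ℕ n) (p : Pol n) (φ : Test n) → ⟦ (c , u) ∷ p ⟧ φ ≡ c * φ u + ⟦ p ⟧ φ
  ⟦⟧-term c u p φ = refl

  ⟦[]⟧ : (φ : Test n) → ⟦ [] ⟧ φ ≡ 0ℤ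
  ⟦[]⟧ φ = refl

  ⟦⟧-cong : (p : Pol n) {φ ψ : Test n} → (∀ u → φ u ≡ ψ u) → ⟦ p ⟧ φ ≡ ⟦ p ⟧ ψ
  ⟦⟧-cong p e = ∑-cong p (λ (c , u) → cong (c *_) (e u))

  ⟦⟧-+ : (p : Pol n) (φ ψ : Test n) → ⟦ p ⟧ (λ u → φ u + ψ u) ≡ ⟦ p ⟧ φ + ⟦ p ⟧ ψ
  ⟦⟧-+ p φ ψ = trans (∑-cong p (λ (c , u) → ℤP.*-distribˡ-+ c (φ u) (ψ u))) (∑-+ p)

  ⟦⟧-*ˡ : (p : Pol n) (k : ℤ) (φ : Test n) → ⟦ p ⟧ (λ u → k * φ u) ≡ k * ⟦ p ⟧ φ
  ⟦⟧-*ˡ p k φ = trans (∑-cong p (λ (c , u) → move c k (φ u))) (∑-*ˡ p k)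
    where
    move : ∀ c k x → c * (k * x) ≡ k * (c * x)
    move = solve-∀

  ⟦⟧-zero : (p : Pol n) {φ : Test n} → (∀ u → φ u ≡ 0ℤ) → ⟦ p ⟧ φ ≡ 0ℤ
  ⟦⟧-zero p e = ∑-zero p (λ (c , u) → trans (cong (c *_) (e u)) (ℤP.*-zeroʳ c))

  ⟦⟧-∑ : {A : Set} (p : Pol n) (as : List A) (φ : A → Test n) →
         ⟦ p ⟧ (λ u → ∑ as (λ a → φ a u)) ≡ ∑ as (λ a → ⟦ p ⟧ (φ a))
  ⟦⟧-∑ p []       φ = ⟦⟧-zero p (λ _ → refl)
  ⟦⟧-∑ p (a ∷ as) φ = trans (⟦⟧-+ p (φ a) (λ u → ∑ as (λ a → φ a u))) (cong (⟦ p ⟧ (φ a) +_) (⟦⟧-∑ p as φ))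

  ⟦⟧-swap : {m : ℕ} (p : Pol n) (q : Pol m) (φ : Vec ℕ n → Vec ℕ m → ℤ) →
            ⟦ p ⟧ (λ u → ⟦ q ⟧ (φ u)) ≡ ⟦ q ⟧ (λ w → ⟦ p ⟧ (λ u → φ u w))
  ⟦⟧-swap p q φ = trans (⟦⟧-∑ p q (λ (d , w) u → d * φ u w))
    (∑-cong q (λ (d , w) → ⟦⟧-*ˡ p d (λ u → φ u w)))

  infixl 6 _⊞_
  _⊞_ : Pol n → Pol n → Pol n
  _⊞_ = _++_

  ⟦⊞⟧ : (p q : Pol n) (φ : Test n) → ⟦ p ⊞ q ⟧ φ ≡ ⟦ p ⟧ φ + ⟦ q ⟧ φ
  ⟦⊞⟧ p q φ = ∑-++ p q

  -- The weight k 1 gives the ordinary product; the weight `dot` gives the polarised second-order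
  -- operator `gamma`. One construction serves both.
  product : (Vec ℕ n → Vec ℕ n → ℤ) → Pol n → Pol n → Pol n
  product k p q = L.concatMap (λ (c , u) → L.map (λ (d , w) → c * d * k u w , u ⊕ w) q) p

  ⟦product⟧ : ∀ k (p q : Pol n) (φ : Test n) →
              ⟦ product k p q ⟧ φ ≡ ⟦ p ⟧ (λ u → ⟦ q ⟧ (λ w → k u w * φ (u ⊕ w)))
  ⟦product⟧ k p q φ = trans (∑-concatMap _ p) (∑-cong p (λ (c , u) →
    trans (∑-map _ q) (trans (∑-cong q (λ (d , w) → assoc c d (k u w) (φ (u ⊕ w)))) (∑-*ˡ q c))))
    where
    assoc : ∀ a b c d → a * b * c * d ≡ a * (b * (c * d))
    assoc = solve-∀

  reweight : Test n → Pol n → Pol n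
  reweight k = L.map (λ (c , u) → c * k u , u)

  ⟦reweight⟧ : ∀ k (p : Pol n) (φ : Test n) → ⟦ reweight k p ⟧ φ ≡ ⟦ p ⟧ (λ u → k u * φ u)
  ⟦reweight⟧ k p φ = trans (∑-map _ p) (∑-cong p (λ (c , u) → ℤP.*-assoc c (k u) (φ u)))

monomial : ℤ → Vec ℕ n → Pol n
monomial c u = (c , u) ∷ []

⟦monomial⟧ : (c : ℤ) (u : Vec ℕ n) (φ : Test n) → ⟦ monomial c u ⟧ φ ≡ c * φ u
⟦monomial⟧ c u φ = trans (⟦⟧-term c u [] φ) (trans (cong (c * φ u +_) (⟦[]⟧ φ)) (ℤP.+-identityʳ _))

infix 4 _≋_
record _≋_ (p q : Pol n) : Set where
  constructor ev
  field at : ∀ φ → ⟦ p ⟧ φ ≡ ⟦ q ⟧ φ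
open _≋_ public

infixl 7 _⊛_
_⊛_ : Pol n → Pol n → Pol n
_⊛_ = product (λ _ _ → 1ℤ)

⟦⊛⟧ : (p q : Pol n) (φ : Test n) → ⟦ p ⊛ q ⟧ φ ≡ ⟦ p ⟧ (λ u → ⟦ q ⟧ (λ w → φ (u ⊕ w)))
⟦⊛⟧ p q φ = trans (⟦product⟧ (λ _ _ → 1ℤ) p q φ)
  (⟦⟧-cong p (λ u → ⟦⟧-cong q (λ w → ℤP.*-identityˡ (φ (u ⊕ w)))))

constant : ℤ → Pol n
constant c = monomial c 𝟘

negate : Pol n → Pol n
negate = reweight (λ _ → - 1ℤ)

⟦negate⟧ : (p : Pol n) (φ : Test n) → ⟦ negate p ⟧ φ ≡ - ⟦ p ⟧ φ
⟦negate⟧ p φ = trans (⟦reweight⟧ (λ _ → - 1ℤ) p φ) (trans (⟦⟧-*ˡ p (- 1ℤ) φ) (ℤP.-1*i≡-i _))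

polynomialRing : ℕ → CommutativeRing 0ℓ 0ℓ
polynomialRing n = record
  { Carrier = Pol n
  ; _≈_ = _≋_
  ; _+_ = _⊞_
  ; _*_ = _⊛_
  ; -_ = negate
  ; 0# = []
  ; 1# = constant 1ℤ
  ; isCommutativeRing = record
    { isRing = record
      { +-isAbelianGroup = record
        { isGroup = record
          { isMonoid = record
            { isSemigroup = record
              { isMagma = record
                { isEquivalence = record
                  { refl = ev (λ _ → refl)
                  ; sym = λ e → ev (λ φ → sym (at e φ))
                  ; trans = λ e f → ev (λ φ → trans (at e φ) (at f φ)) }
                ; ∙-cong = λ {p} {p′} {q} {q′} e f → ev (λ φ →
                    trans (⟦⊞⟧ p q φ) (trans (cong₂ _+_ (at e φ) (at f φ)) (sym (⟦⊞⟧ p′ q′ φ)))) }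
              ; assoc = assoc }
            ; identity = (λ p → ev (λ φ → trans (⟦⊞⟧ [] p φ) (trans (cong (_+ ⟦ p ⟧ φ) (⟦[]⟧ φ)) (ℤP.+-identityˡ _))))
                       , (λ p → ev (λ φ → trans (⟦⊞⟧ p [] φ) (trans (cong (⟦ p ⟧ φ +_) (⟦[]⟧ φ)) (ℤP.+-identityʳ _)))) }
          ; inverse = (λ p → ev (λ φ → trans (⟦⊞⟧ (negate p) p φ)
                          (trans (cong (_+ ⟦ p ⟧ φ) (⟦negate⟧ p φ)) (trans (ℤP.+-inverseˡ (⟦ p ⟧ φ)) (sym (⟦[]⟧ φ))))))
                    , (λ p → ev (λ φ → trans (⟦⊞⟧ p (negate p) φ)
                          (trans (cong (⟦ p ⟧ φ +_) (⟦negate⟧ p φ)) (trans (ℤP.+-inverseʳ (⟦ p ⟧ φ)) (sym (⟦[]⟧ φ))))))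
          ; ⁻¹-cong = λ {p} {q} e → ev (λ φ → trans (⟦negate⟧ p φ)
                          (trans (cong -_ (at e φ)) (sym (⟦negate⟧ q φ)))) }
        ; comm = λ p q → ev (λ φ → trans (⟦⊞⟧ p q φ) (trans (ℤP.+-comm (⟦ p ⟧ φ) _) (sym (⟦⊞⟧ q p φ)))) }
      ; *-cong = λ {p} {p′} {q} {q′} e f → ev (λ φ → trans (⟦⊛⟧ p q φ)
          (trans (⟦⟧-cong p (λ u → at f _)) (trans (at e _) (sym (⟦⊛⟧ p′ q′ φ)))))
      ; *-assoc = λ p q r → ev (λ φ → trans (⟦⊛⟧ (p ⊛ q) r φ) (trans (⟦⊛⟧ p q _)
          (trans (⟦⟧-cong p (λ u → trans
              (⟦⟧-cong q (λ v → ⟦⟧-cong r (λ w → cong φ (⊕-assoc u v w)))) (sym (⟦⊛⟧ q r _))))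
            (sym (⟦⊛⟧ p (q ⊛ r) φ)))))
      ; *-identity = identityˡ , (λ p → ev (λ φ → trans (at (comm p (constant 1ℤ)) φ) (at (identityˡ p) φ)))
      ; distrib = distribˡ , (λ p q r → ev (λ φ → trans (⟦⊛⟧ (q ⊞ r) p φ) (trans (⟦⊞⟧ q r _)
          (sym (trans (⟦⊞⟧ (q ⊛ p) (r ⊛ p) φ) (cong₂ _+_ (⟦⊛⟧ q p φ) (⟦⊛⟧ r p φ)))))))
      }
    ; *-comm = comm } }
  where
  assoc : ∀ (p q r : Pol n) → (p ⊞ q) ⊞ r ≋ p ⊞ (q ⊞ r)
  assoc p q r = ev (λ φ → trans (⟦⊞⟧ (p ⊞ q) r φ) (trans (cong (_+ ⟦ r ⟧ φ) (⟦⊞⟧ p q φ))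
    (trans (ℤP.+-assoc (⟦ p ⟧ φ) (⟦ q ⟧ φ) (⟦ r ⟧ φ))
      (sym (trans (⟦⊞⟧ p (q ⊞ r) φ) (cong (⟦ p ⟧ φ +_) (⟦⊞⟧ q r φ)))))))
  comm : ∀ (p q : Pol n) → p ⊛ q ≋ q ⊛ p
  comm p q = ev (λ φ → trans (⟦⊛⟧ p q φ) (trans (⟦⟧-swap p q _)
    (trans (⟦⟧-cong q (λ w → ⟦⟧-cong p (λ u → cong φ (⊕-comm u w)))) (sym (⟦⊛⟧ q p φ)))))
  identityˡ : ∀ p → constant 1ℤ ⊛ p ≋ p
  identityˡ p = ev (λ φ → trans (⟦⊛⟧ (constant 1ℤ) p φ) (trans (⟦monomial⟧ 1ℤ 𝟘 _)
    (trans (ℤP.*-identityˡ _) (⟦⟧-cong p (λ u → cong φ (⊕-identityˡ u))))))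
  distribˡ : ∀ (p q r : Pol n) → p ⊛ (q ⊞ r) ≋ p ⊛ q ⊞ p ⊛ r
  distribˡ p q r = ev (λ φ → trans (⟦⊛⟧ p (q ⊞ r) φ)
    (trans (⟦⟧-cong p (λ u → ⟦⊞⟧ q r _)) (trans (⟦⟧-+ p _ _)
      (sym (trans (⟦⊞⟧ (p ⊛ q) (p ⊛ r) φ) (cong₂ _+_ (⟦⊛⟧ p q φ) (⟦⊛⟧ p r φ)))))))

module PR {n : ℕ} = CommutativeRing (polynomialRing n)

variable′ : Fin n → Pol n
variable′ a = monomial 1ℤ (inc a 𝟘)

⟦variable⟧ : (a : Fin n) (p : Pol n) (φ : Test n) → ⟦ variable′ a ⊛ p ⟧ φ ≡ ⟦ p ⟧ (φ ∘ inc a)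
⟦variable⟧ a p φ = trans (⟦⊛⟧ (variable′ a) p φ) (trans (⟦monomial⟧ 1ℤ (inc a 𝟘) _) (trans (ℤP.*-identityˡ _)
  (⟦⟧-cong p (λ u → cong φ (trans (inc-⊕ a 𝟘 u) (cong (inc a) (⊕-identityˡ u)))))))

δ₁ : ℕ → ℕ → ℤ
δ₁ zero    zero    = 1ℤ
δ₁ zero    (suc t) = 0ℤ
δ₁ (suc s) zero    = 0ℤ
δ₁ (suc s) (suc t) = δ₁ s t

δ : Vec ℕ n → Test n
δ []      []      = 1ℤ
δ (s ∷ α) (t ∷ u) = δ₁ s t * δ α u

coefficient : Vec ℕ n → Pol n → ℤ
coefficient α p = ⟦ p ⟧ (δ α)

δ₁-refl : ∀ s → δ₁ s s ≡ 1ℤ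
δ₁-refl zero    = refl
δ₁-refl (suc s) = δ₁-refl s

δ₁-≢ : ∀ s t → s ≢ t → δ₁ s t ≡ 0ℤ
δ₁-≢ zero    zero    ne = ⊥-elim (ne refl)
δ₁-≢ zero    (suc t) ne = refl
δ₁-≢ (suc s) zero    ne = refl
δ₁-≢ (suc s) (suc t) ne = δ₁-≢ s t (ne ∘ cong suc)

δ₁-comm : ∀ s t → δ₁ s t ≡ δ₁ t s
δ₁-comm zero    zero    = refl
δ₁-comm zero    (suc t) = refl
δ₁-comm (suc s) zero    = refl
δ₁-comm (suc s) (suc t) = δ₁-comm s t

δ-refl : (u : Vec ℕ n) → δ u u ≡ 1ℤ
δ-refl []      = refl
δ-refl (t ∷ u) = cong₂ _*_ (δ₁-refl t) (δ-refl u)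

δ-inc-inc : (a : Fin n) (α u : Vec ℕ n) → δ (inc a α) (inc a u) ≡ δ α u
δ-inc-inc zero    (s ∷ α) (t ∷ u) = refl
δ-inc-inc (suc a) (s ∷ α) (t ∷ u) = cong (δ₁ s t *_) (δ-inc-inc a α u)

δ-inc-zero : (a : Fin n) (α u : Vec ℕ n) → lookup α a ≡ 0 → δ α (inc a u) ≡ 0ℤ
δ-inc-zero zero    (s ∷ α) (t ∷ u) refl = refl
δ-inc-zero (suc a) (s ∷ α) (t ∷ u) e    = trans (cong (δ₁ s t *_) (δ-inc-zero a α u e)) (ℤP.*-zeroʳ (δ₁ s t))

Vanishing : Pol n → Set
Vanishing p = ∀ α → coefficient α p ≡ 0ℤ

module _ {n : ℕ} where
  open Alternants (polynomialRing n)

  private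
    ⟦x-y⟧ : (a b : Fin n) (p : Pol n) (φ : Test n) →
      ⟦ (variable′ a PR.- variable′ b) ⊛ p ⟧ φ ≡ ⟦ p ⟧ (φ ∘ inc a) - ⟦ p ⟧ (φ ∘ inc b)
    ⟦x-y⟧ a b p φ = begin
      ⟦ (variable′ a PR.- variable′ b) ⊛ p ⟧ φ
        ≡⟨ ⟦⊛⟧ (variable′ a ⊞ negate (variable′ b)) p φ ⟩
      ⟦ variable′ a ⊞ negate (variable′ b) ⟧ ψ
        ≡⟨ ⟦⊞⟧ (variable′ a) (negate (variable′ b)) ψ ⟩
      ⟦ variable′ a ⟧ ψ + ⟦ negate (variable′ b) ⟧ ψ
        ≡⟨ cong (⟦ variable′ a ⟧ ψ +_) (⟦negate⟧ (variable′ b) ψ) ⟩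
      ⟦ variable′ a ⟧ ψ - ⟦ variable′ b ⟧ ψ
        ≡⟨ cong₂ _-_ (trans (sym (⟦⊛⟧ (variable′ a) p φ)) (⟦variable⟧ a p φ))
                     (trans (sym (⟦⊛⟧ (variable′ b) p φ)) (⟦variable⟧ b p φ)) ⟩
      ⟦ p ⟧ (φ ∘ inc a) - ⟦ p ⟧ (φ ∘ inc b) ∎
      where
      open ≡-Reasoning
      ψ : Test n
      ψ u = ⟦ p ⟧ (λ w → φ (u ⊕ w))

    -- The coefficient at α equals the one at α + ε_a - ε_b, hence by iteration
    -- one outside the support.
    cancel-difference : (a b : Fin n) → a ≢ b → (p : Pol n) →
      Vanishing ((variable′ a PR.- variable′ b) ⊛ p) → Vanishing p
    cancel-difference a b a≢b p z α = go (lookup α b) α refl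
      where
      shifted : ∀ α → ⟦ p ⟧ (δ α) ≡ ⟦ p ⟧ (δ (inc a α) ∘ inc b)
      shifted α = ℤP.i-j≡0⇒i≡j _ _ (trans
        (cong (_- ⟦ p ⟧ (δ (inc a α) ∘ inc b)) (⟦⟧-cong p (λ u → sym (δ-inc-inc a α u))))
        (trans (sym (⟦x-y⟧ a b p (δ (inc a α)))) (z (inc a α))))
      go : ∀ k α → lookup α b ≡ k → ⟦ p ⟧ (δ α) ≡ 0ℤ
      go zero α e = trans (shifted α) (⟦⟧-zero p (λ u →
        δ-inc-zero b (inc a α) u (trans (VP.lookup∘updateAt′ b a (a≢b ∘ sym) α) e)))
      go (suc k) α e = begin
        ⟦ p ⟧ (δ α)                               ≡⟨ shifted α ⟩
        ⟦ p ⟧ (δ (inc a α) ∘ inc b)               ≡⟨ ⟦⟧-cong p (λ u → cong (λ β → δ β (inc b u))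
                                                     (trans (cong (inc a) (sym inc-dec)) (inc-comm a b dec))) ⟩
        ⟦ p ⟧ (δ (inc b (inc a dec)) ∘ inc b)     ≡⟨ ⟦⟧-cong p (λ u → δ-inc-inc b (inc a dec) u) ⟩
        ⟦ p ⟧ (δ (inc a dec))                     ≡⟨ go k (inc a dec)
              (trans (VP.lookup∘updateAt′ b a (a≢b ∘ sym) dec)
                     (trans (VP.lookup∘updateAt b α) (cong ℕ.pred e))) ⟩
        0ℤ ∎
        where
        open ≡-Reasoning
        dec : Vec ℕ n
        dec = updateAt α b ℕ.pred
        inc-dec : inc b dec ≡ α
        inc-dec = trans (VP.updateAt-updateAt b α) (VP.updateAt-id-local b α
                    (trans (cong (λ t → suc (ℕ.pred t)) e) (sym e)))

    cancel-differences : (a : Fin n) (bs : List (Fin n)) → (∀ {b} → b ∈ bs → a ≢ b) → (p : Pol n) →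
      Vanishing (differences (variable′ a) (L.map variable′ bs) ⊛ p) → Vanishing p
    cancel-differences a [] ne p z α = trans (sym (at (PR.*-identityˡ p) (δ α))) (z α)
    cancel-differences a (b ∷ bs) ne p z = cancel-differences a bs (ne ∘ there) p
      (cancel-difference a b (ne (here refl)) _
        (λ α → trans (sym (at (PR.*-assoc (variable′ a PR.- variable′ b) (differences (variable′ a) (L.map variable′ bs)) p) (δ α))) (z α)))

  -- Lets an identity between symmetric polynomials be verified after multiplication by V, where
  -- Schur polynomials become alternants.
  cancel-vandermonde : (is : List (Fin n)) → Unique is → (p : Pol n) →
    Vanishing (vandermonde (L.map variable′ is) ⊛ p) → Vanishing p
  cancel-vandermonde [] un p z α = trans (sym (at (PR.*-identityˡ p) (δ α))) (z α)
  cancel-vandermonde (a ∷ is) (ne ∷ un) p z = cancel-vandermonde is un p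
    (cancel-differences a is (All.lookup ne) _
      (λ α → trans (sym (at (PR.*-assoc (differences (variable′ a) (L.map variable′ is)) (vandermonde (L.map variable′ is)) p) (δ α))) (z α)))

-- Euler operators and the second-order product rule

dot : Vec ℕ n → Vec ℕ n → ℤ
dot []      []      = 0ℤ
dot (s ∷ u) (t ∷ w) = ⁺ s * ⁺ t + dot u w

sq : Vec ℕ n → ℤ
sq u = dot u u

dot-comm : (u w : Vec ℕ n) → dot u w ≡ dot w u
dot-comm []      []      = refl
dot-comm (s ∷ u) (t ∷ w) = cong₂ _+_ (ℤP.*-comm (⁺ s) (⁺ t)) (dot-comm u w)

dot-⊕ˡ : (u v w : Vec ℕ n) → dot (u ⊕ v) w ≡ dot u w + dot v w
dot-⊕ˡ []      []      []      = refl
dot-⊕ˡ (s ∷ u) (t ∷ v) (r ∷ w) = trans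
  (cong₂ _+_ (cong (_* ⁺ r) (ℤP.pos-+ s t)) (dot-⊕ˡ u v w))
  (expand (⁺ s) (⁺ t) (⁺ r) (dot u w) (dot v w))
  where
  expand : ∀ s t r x y → (s + t) * r + (x + y) ≡ (s * r + x) + (t * r + y)
  expand = solve-∀

dot-𝟘ˡ : (w : Vec ℕ n) → dot 𝟘 w ≡ 0ℤ
dot-𝟘ˡ []      = refl
dot-𝟘ˡ (t ∷ w) = trans (ℤP.+-identityˡ _) (dot-𝟘ˡ w)

dot-incˡ : (a : Fin n) (u w : Vec ℕ n) → dot (inc a u) w ≡ ⁺ lookup w a + dot u w
dot-incˡ zero    (s ∷ u) (t ∷ w) = trans (cong (λ x → x * ⁺ t + dot u w) (ℤP.pos-+ 1 s)) (expand (⁺ s) (⁺ t) (dot u w))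
  where
  expand : ∀ s t x → (1ℤ + s) * t + x ≡ t + (s * t + x)
  expand = solve-∀
dot-incˡ (suc a) (s ∷ u) (t ∷ w) = trans (cong (⁺ s * ⁺ t +_) (dot-incˡ a u w)) (swap (⁺ s * ⁺ t) (⁺ lookup w a) (dot u w))
  where
  swap : ∀ x y z → x + (y + z) ≡ y + (x + z)
  swap = solve-∀

sq-⊕ : (u w : Vec ℕ n) → sq (u ⊕ w) ≡ sq w + sq u + (dot u w + dot u w)
sq-⊕ u w = begin
  dot (u ⊕ w) (u ⊕ w)                         ≡⟨ dot-⊕ˡ u w (u ⊕ w) ⟩
  dot u (u ⊕ w) + dot w (u ⊕ w)               ≡⟨ cong₂ _+_ (right u) (right w) ⟩
  (sq u + dot w u) + (dot u w + sq w)         ≡⟨ cong (λ x → (sq u + x) + (dot u w + sq w)) (dot-comm w u) ⟩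
  (sq u + dot u w) + (dot u w + sq w)         ≡⟨ regroup (sq u) (dot u w) (sq w) ⟩
  sq w + sq u + (dot u w + dot u w)           ∎
  where
  open ≡-Reasoning
  right : ∀ v → dot v (u ⊕ w) ≡ dot u v + dot w v
  right v = trans (dot-comm v (u ⊕ w)) (dot-⊕ˡ u w v)
  regroup : ∀ x y z → (x + y) + (y + z) ≡ z + x + (y + y)
  regroup = solve-∀

euler : Fin n → Pol n → Pol n
euler a = reweight (λ u → ⁺ lookup u a)

-- The sum of the squares of the Euler operators, and its polarisation
-- p, q ↦ ∑ₐ euler a p · euler a q.
laplace : Pol n → Pol n
laplace = reweight sq

gamma : Pol n → Pol n → Pol n
gamma = product dot

⟦constant⊛⟧ : (c : ℤ) (p : Pol n) (φ : Test n) → ⟦ constant c ⊛ p ⟧ φ ≡ c * ⟦ p ⟧ φ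
⟦constant⊛⟧ c p φ = trans (⟦⊛⟧ (constant c) p φ) (trans (⟦monomial⟧ c 𝟘 _)
  (cong (c *_) (⟦⟧-cong p (λ u → cong φ (⊕-identityˡ u)))))

gamma-⊛ : (p q r : Pol n) → gamma (p ⊛ q) r ≋ p ⊛ gamma q r ⊞ q ⊛ gamma p r
gamma-⊛ p q r = ev λ φ → begin
  ⟦ gamma (p ⊛ q) r ⟧ φ
    ≡⟨ ⟦product⟧ dot (p ⊛ q) r φ ⟩
  ⟦ p ⊛ q ⟧ (λ u → ⟦ r ⟧ (λ w → dot u w * φ (u ⊕ w)))
    ≡⟨ ⟦⊛⟧ p q _ ⟩
  ⟦ p ⟧ (λ u → ⟦ q ⟧ (λ v → ⟦ r ⟧ (λ w → dot (u ⊕ v) w * φ (u ⊕ v ⊕ w))))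
    ≡⟨ ⟦⟧-cong p (λ u → trans (⟦⟧-cong q (λ v → trans
         (⟦⟧-cong r (λ w → expand φ u v w)) (⟦⟧-+ r _ _))) (⟦⟧-+ q _ _)) ⟩
  ⟦ p ⟧ (λ u → ⟦ q ⟧ (λ v → ⟦ r ⟧ (λ w → dot v w * φ (u ⊕ (v ⊕ w))))
             + ⟦ q ⟧ (λ v → ⟦ r ⟧ (λ w → dot u w * φ (v ⊕ (u ⊕ w)))))
    ≡⟨ ⟦⟧-+ p _ _ ⟩
  ⟦ p ⟧ (λ u → ⟦ q ⟧ (λ v → ⟦ r ⟧ (λ w → dot v w * φ (u ⊕ (v ⊕ w)))))
  + ⟦ p ⟧ (λ u → ⟦ q ⟧ (λ v → ⟦ r ⟧ (λ w → dot u w * φ (v ⊕ (u ⊕ w)))))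
    ≡⟨ cong₂ _+_ (side p q φ) (trans (side q p φ) (⟦⟧-swap q p _)) ⟨
  ⟦ p ⊛ gamma q r ⟧ φ + ⟦ q ⊛ gamma p r ⟧ φ
    ≡⟨ ⟦⊞⟧ (p ⊛ gamma q r) (q ⊛ gamma p r) φ ⟨
  ⟦ p ⊛ gamma q r ⊞ q ⊛ gamma p r ⟧ φ ∎
  where
  open ≡-Reasoning
  distribute : ∀ x y z → (x + y) * z ≡ y * z + x * z
  distribute = solve-∀
  expand : ∀ φ u v w → dot (u ⊕ v) w * φ (u ⊕ v ⊕ w) ≡ dot v w * φ (u ⊕ (v ⊕ w)) + dot u w * φ (v ⊕ (u ⊕ w))
  expand φ u v w = trans (cong (_* φ (u ⊕ v ⊕ w)) (dot-⊕ˡ u v w)) (trans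
    (distribute (dot u w) (dot v w) (φ (u ⊕ v ⊕ w)))
    (cong₂ (λ x y → dot v w * φ x + dot u w * φ y) (⊕-assoc u v w)
      (trans (cong (_⊕ w) (⊕-comm u v)) (⊕-assoc v u w))))
  side : ∀ p q φ → ⟦ p ⊛ gamma q r ⟧ φ ≡ ⟦ p ⟧ (λ u → ⟦ q ⟧ (λ v → ⟦ r ⟧ (λ w → dot v w * φ (u ⊕ (v ⊕ w)))))
  side p q φ = trans (⟦⊛⟧ p (gamma q r) φ) (⟦⟧-cong p (λ u → ⟦product⟧ dot q r _))

gamma-sub : (p q r : Pol n) → gamma (p PR.- q) r ≋ gamma p r PR.- gamma q r
gamma-sub p q r = ev λ φ → trans (⟦product⟧ dot (p ⊞ negate q) r φ) (trans (⟦⊞⟧ p (negate q) _)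
  (trans (cong₂ _+_ (sym (⟦product⟧ dot p r φ)) (trans (⟦negate⟧ q _) (cong -_ (sym (⟦product⟧ dot q r φ)))))
    (sym (trans (⟦⊞⟧ (gamma p r) (negate (gamma q r)) φ) (cong (⟦ gamma p r ⟧ φ +_) (⟦negate⟧ (gamma q r) φ))))))

gamma-variable : (a : Fin n) (r : Pol n) → gamma (variable′ a) r ≋ variable′ a ⊛ euler a r
gamma-variable a r = ev λ φ → trans (⟦product⟧ dot (variable′ a) r φ) (trans (⟦monomial⟧ 1ℤ (inc a 𝟘) _)
  (trans (ℤP.*-identityˡ _) (trans
    (⟦⟧-cong r (λ w → cong₂ (λ (x : ℤ) y → x * φ y)
      (trans (dot-incˡ a 𝟘 w) (trans (cong (⁺ lookup w a +_) (dot-𝟘ˡ w)) (ℤP.+-identityʳ (⁺ lookup w a))))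
      (trans (inc-⊕ a 𝟘 w) (cong (inc a) (⊕-identityˡ w)))))
    (sym (trans (⟦variable⟧ a (euler a r) φ) (⟦reweight⟧ (λ u → ⁺ lookup u a) r _))))))

gamma-one : (r : Pol n) → gamma (constant 1ℤ) r ≋ []
gamma-one r = ev λ φ → trans (⟦product⟧ dot (constant 1ℤ) r φ) (trans (⟦monomial⟧ 1ℤ 𝟘 _)
  (trans (ℤP.*-identityˡ _) (trans
    (⟦⟧-zero r (λ w → cong (_* φ (𝟘 ⊕ w)) (dot-𝟘ˡ w))) (sym (⟦[]⟧ φ)))))

laplace-⊛ : (p q : Pol n) → laplace (p ⊛ q) ≋ (p ⊛ laplace q ⊞ laplace p ⊛ q) ⊞ (gamma p q ⊞ gamma p q)
laplace-⊛ p q = ev λ φ → begin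
  ⟦ laplace (p ⊛ q) ⟧ φ
    ≡⟨ trans (⟦reweight⟧ sq (p ⊛ q) φ) (⟦⊛⟧ p q _) ⟩
  ⟦ p ⟧ (λ u → ⟦ q ⟧ (λ w → sq (u ⊕ w) * φ (u ⊕ w)))
    ≡⟨ ⟦⟧-cong p (λ u → trans (⟦⟧-cong q (λ w → trans (cong (_* φ (u ⊕ w)) (sq-⊕ u w))
         (distribute (sq w) (sq u) (dot u w) (φ (u ⊕ w)))))
       (trans (⟦⟧-+ q (λ w → sq w * φ (u ⊕ w) + sq u * φ (u ⊕ w)) (λ w → dot u w * φ (u ⊕ w) + dot u w * φ (u ⊕ w)))
         (cong₂ _+_ (trans (⟦⟧-+ q (λ w → sq w * φ (u ⊕ w)) (λ w → sq u * φ (u ⊕ w)))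
           (cong (A φ u +_) (⟦⟧-*ˡ q (sq u) _))) (⟦⟧-+ q (λ w → dot u w * φ (u ⊕ w)) (λ w → dot u w * φ (u ⊕ w)))))) ⟩
  ⟦ p ⟧ (λ u → (A φ u + sq u * D φ u) + (C φ u + C φ u))
    ≡⟨ trans (⟦⟧-+ p _ _) (cong₂ _+_ (⟦⟧-+ p _ _) (⟦⟧-+ p _ _)) ⟩
  (⟦ p ⟧ (A φ) + ⟦ p ⟧ (λ u → sq u * D φ u)) + (⟦ p ⟧ (C φ) + ⟦ p ⟧ (C φ))
    ≡⟨ cong₂ _+_ (cong₂ _+_
         (trans (⟦⊛⟧ p (laplace q) φ) (⟦⟧-cong p (λ u → ⟦reweight⟧ sq q _)))
         (trans (⟦⊛⟧ (laplace p) q φ) (⟦reweight⟧ sq p _)))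
         (cong₂ _+_ (⟦product⟧ dot p q φ) (⟦product⟧ dot p q φ)) ⟨
  (⟦ p ⊛ laplace q ⟧ φ + ⟦ laplace p ⊛ q ⟧ φ) + (⟦ gamma p q ⟧ φ + ⟦ gamma p q ⟧ φ)
    ≡⟨ cong₂ _+_ (⟦⊞⟧ (p ⊛ laplace q) (laplace p ⊛ q) φ) (⟦⊞⟧ (gamma p q) (gamma p q) φ) ⟨
  ⟦ p ⊛ laplace q ⊞ laplace p ⊛ q ⟧ φ + ⟦ gamma p q ⊞ gamma p q ⟧ φ
    ≡⟨ ⟦⊞⟧ (p ⊛ laplace q ⊞ laplace p ⊛ q) (gamma p q ⊞ gamma p q) φ ⟨
  ⟦ (p ⊛ laplace q ⊞ laplace p ⊛ q) ⊞ (gamma p q ⊞ gamma p q) ⟧ φ ∎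
  where
  open ≡-Reasoning
  A C D : Test _ → Test _
  A φ u = ⟦ q ⟧ (λ w → sq w * φ (u ⊕ w))
  D φ u = ⟦ q ⟧ (λ w → φ (u ⊕ w))
  C φ u = ⟦ q ⟧ (λ w → dot u w * φ (u ⊕ w))
  distribute : ∀ a b c x → (a + b + (c + c)) * x ≡ (a * x + b * x) + (c * x + c * x)
  distribute = solve-∀

-- The Casimir operator conjugated by the Vandermonde product

module Casimir {n : ℕ} where
  open Alternants (polynomialRing n)
  open PairIdentities (polynomialRing n)
  open IntegerRingSolver (polynomialRing n)
  open Sums (polynomialRing n) using () renaming (∑ to sum; ∑-cong to sum-cong; ∑-+ to sum-+; ∑-swap to sum-swap) public
  open import Relation.Binary.Reasoning.Setoid (PR.setoid {n})

  variables : List (Fin n) → List (Pol n)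
  variables = L.map variable′

  sum-const : {A : Set} (as : List A) (p : Pol n) → sum as (λ _ → p) ≋ constant (⁺ L.length as) ⊛ p
  sum-const []       p = ev λ φ → trans (⟦[]⟧ φ) (sym (⟦constant⊛⟧ 0ℤ p φ))
  sum-const (a ∷ as) p = ev λ φ → trans (⟦⊞⟧ p (sum as (λ _ → p)) φ) (trans
    (cong (⟦ p ⟧ φ +_) (trans (at (sum-const as p) φ) (⟦constant⊛⟧ (⁺ L.length as) p φ)))
    (trans (sym (ℤP.suc-* (⁺ L.length as) (⟦ p ⟧ φ))) (sym (⟦constant⊛⟧ (⁺ suc (L.length as)) p φ))))

  -- The two hypotheses amount to (x_a - x_b) Y a b = x_a (euler a d - euler b d), the off-diagonal
  -- terms of a radial Laplacian with the denominators cleared. Keeping them as hypotheses separates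
  -- this computation from the representation that provides Y.
  module _ (d : Pol n) (Y : Fin n → Fin n → Pol n)
           (exchange : ∀ a b → a ≢ b → variable′ b ⊛ Y a b ≋ variable′ a ⊛ Y b a)
           (commutator : ∀ a b → a ≢ b → Y a b ≋ Y b a ⊞ (euler a d PR.- euler b d)) where

    private
      g : Fin n → Fin n → Pol n
      g a b = Y a b ⊞ euler a d

    gamma-difference : ∀ a b → a ≢ b →
      gamma (variable′ a PR.- variable′ b) d ⊞ gamma (variable′ a PR.- variable′ b) d ≋
      (variable′ a PR.- variable′ b) ⊛ (g a b ⊞ g b a)
    gamma-difference a b a≢b = PR.trans (PR.+-cong step step)
      (PR.sym (pair-identity (variable′ a) (variable′ b) (Y a b) (Y b a) (euler a d) (euler b d)
        (exchange a b a≢b) (commutator a b a≢b)))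
      where
      step : gamma (variable′ a PR.- variable′ b) d ≋ variable′ a ⊛ euler a d PR.- variable′ b ⊛ euler b d
      step = PR.trans (gamma-sub (variable′ a) (variable′ b) d)
        (PR.+-cong (gamma-variable a d) (PR.-‿cong (gamma-variable b d)))

    private
      gamma-unit : gamma (constant 1ℤ) d ⊞ gamma (constant 1ℤ) d ≋ constant 1ℤ ⊛ []
      gamma-unit = PR.trans (PR.+-cong (gamma-one d) (gamma-one d)) (PR.trans (PR.+-identityˡ []) (PR.sym (PR.zeroʳ (constant 1ℤ))))

    gamma-differences : ∀ a bs → (∀ {b} → b ∈ bs → a ≢ b) →
      gamma (differences (variable′ a) (variables bs)) d ⊞ gamma (differences (variable′ a) (variables bs)) d ≋
      differences (variable′ a) (variables bs) ⊛ sum bs (λ b → g a b ⊞ g b a)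
    gamma-differences a []       ne = gamma-unit
    gamma-differences a (b ∷ bs) ne = PR.trans
      (PR.+-cong (gamma-⊛ x D d) (gamma-⊛ x D d))
      (leibniz-step x D (gamma x d) (gamma D d) _ _
        (gamma-difference a b (ne (here refl))) (gamma-differences a bs (ne ∘ there)))
      where
      x = variable′ a PR.- variable′ b
      D = differences (variable′ a) (variables bs)

    -- Each factor x_a - x_b of V contributes its logarithmic derivative, which by
    -- `gamma-difference` is a polynomial and not a fraction, so V can be factored out.
    gamma-vandermonde : ∀ is → Unique is →
      gamma (vandermonde (variables is)) d ⊞ gamma (vandermonde (variables is)) d ≋
      vandermonde (variables is) ⊛ pairs is (λ a b → g a b ⊞ g b a)
    gamma-vandermonde []       un        = gamma-unit
    gamma-vandermonde (a ∷ is) (ne ∷ un) = PR.trans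
      (PR.+-cong (gamma-⊛ D V d) (gamma-⊛ D V d))
      (leibniz-step D V (gamma D d) (gamma V d) _ _
        (gamma-differences a is (All.lookup ne)) (gamma-vandermonde is un))
      where
      D = differences (variable′ a) (variables is)
      V = vandermonde (variables is)

    module _ (is : List (Fin n)) (un : Unique is) (deg κ : ℤ)
             (diagonal : sum is (λ a → Y a a) ≋ laplace d)
             (homogeneous : sum is (λ a → euler a d) ≋ constant deg ⊛ d)
             (eigen : laplace (vandermonde (variables is)) ≋ constant κ ⊛ vandermonde (variables is)) where

      private
        V = vandermonde (variables is)
        C = sum is (λ a → sum is (Y a))
        E = constant deg ⊛ d
        N = constant (⁺ L.length is) ⊛ E

        total : sum is (λ a → sum is (g a)) ≋ C ⊞ N
        total = PR.trans (sum-cong is (λ a → sum-+ is)) (PR.trans (sum-+ is) (PR.+-congˡ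
          (PR.trans (sum-swap is is) (PR.trans (sum-cong is (λ _ → homogeneous)) (sum-const is E)))))

        pairs-total : pairs is (λ a b → g a b ⊞ g b a) ⊞ (laplace d ⊞ E) ≋ C ⊞ N
        pairs-total = PR.trans (PR.+-congˡ (PR.sym (PR.trans (sum-+ is) (PR.+-cong diagonal homogeneous))))
          (PR.trans (pairs-symmetrised is g) total)

      -- In the product rule for `laplace (V ⊛ d)` the mixed term 2 `gamma V d` is V times the sum
      -- over pairs, the term `laplace V` is a multiple of V, and the diagonal terms of C make up
      -- `laplace d`. The term `N` collects the `euler a d` over all ordered pairs, `E` those on the
      -- diagonal.
      casimir-vandermonde : V ⊛ C ⊞ (V ⊛ N ⊞ constant κ ⊛ V ⊛ d) ≋ laplace (V ⊛ d) ⊞ V ⊛ E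
      casimir-vandermonde = begin
        V ⊛ C ⊞ (V ⊛ N ⊞ constant κ ⊛ V ⊛ d)
          ≈⟨ PR.+-congˡ (PR.+-congˡ (PR.*-congʳ (PR.sym eigen))) ⟩
        V ⊛ C ⊞ (V ⊛ N ⊞ laplace V ⊛ d)
          ≈⟨ solve 4 (λ V C N L → V :* C :+ (V :* N :+ L) := V :* (C :+ N) :+ L) PR.refl V C N (laplace V ⊛ d) ⟩
        V ⊛ (C ⊞ N) ⊞ laplace V ⊛ d
          ≈⟨ PR.+-congʳ (PR.*-congˡ (PR.sym pairs-total)) ⟩
        V ⊛ (P ⊞ (laplace d ⊞ E)) ⊞ laplace V ⊛ d
          ≈⟨ solve 5 (λ V P L E M → V :* (P :+ (L :+ E)) :+ M := ((V :* L :+ M) :+ V :* P) :+ V :* E)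
                     PR.refl V P (laplace d) E (laplace V ⊛ d) ⟩
        ((V ⊛ laplace d ⊞ laplace V ⊛ d) ⊞ V ⊛ P) ⊞ V ⊛ E
          ≈⟨ PR.+-congʳ (PR.+-congˡ (PR.sym (gamma-vandermonde is un))) ⟩
        ((V ⊛ laplace d ⊞ laplace V ⊛ d) ⊞ (gamma V d ⊞ gamma V d)) ⊞ V ⊛ E
          ≈⟨ PR.+-congʳ (PR.sym (laplace-⊛ V d)) ⟩
        laplace (V ⊛ d) ⊞ V ⊛ E ∎
        where
        P = pairs is (λ a b → g a b ⊞ g b a)

      ⟦casimir⟧ : (φ : Test n) → ⟦ V ⊛ C ⟧ φ ≡
        ⟦ V ⊛ d ⟧ (λ u → sq u * φ u) - (⁺ L.length is * deg + κ - deg) * ⟦ V ⊛ d ⟧ φ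
      ⟦casimir⟧ φ = isolate (⟦ V ⊛ C ⟧ φ) (⟦ V ⊛ d ⟧ (λ u → sq u * φ u)) (⁺ L.length is) deg κ (⟦ V ⊛ d ⟧ φ)
        (trans (sym (trans (⟦⊞⟧ (V ⊛ C) _ φ) (cong (⟦ V ⊛ C ⟧ φ +_) (trans (⟦⊞⟧ (V ⊛ N) _ φ) (cong₂ _+_
            (trans (scale (⁺ L.length is) E) (cong (⁺ L.length is *_) (scale deg d)))
            (trans (at (PR.*-assoc (constant κ) V d) φ) (⟦constant⊛⟧ κ (V ⊛ d) φ)))))))
          (trans (at casimir-vandermonde φ) (trans (⟦⊞⟧ (laplace (V ⊛ d)) (V ⊛ E) φ)
            (cong₂ _+_ (⟦reweight⟧ sq (V ⊛ d) φ) (scale deg d)))))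
        where
        scale : ∀ c p → ⟦ V ⊛ (constant c ⊛ p) ⟧ φ ≡ c * ⟦ V ⊛ p ⟧ φ
        scale c p = trans (at (solve 3 (λ v c p → v :* (c :* p) := c :* (v :* p)) PR.refl V (constant c) p) φ)
                          (⟦constant⊛⟧ c (V ⊛ p) φ)
        isolate : ∀ x s l e k y → x + (l * (e * y) + k * y) ≡ s + e * y → x ≡ s - (l * e + k - e) * y
        isolate x s l e k y h = trans (add x (l * (e * y) + k * y)) (trans (cong (_- (l * (e * y) + k * y)) h)
          (regroup s l e k y))
          where
          add : ∀ x z → x ≡ x + z - z
          add = solve-∀
          regroup : ∀ s l e k y → s + e * y - (l * (e * y) + k * y) ≡ s - (l * e + k - e) * y
          regroup = solve-∀

-- Alternants as explicit sums of monomials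

inc^ : ℕ → Fin n → Vec ℕ n → Vec ℕ n
inc^ zero    a u = u
inc^ (suc c) a u = inc^ c a (inc a u)

inc^-zero : ∀ c t (u : Vec ℕ n) → inc^ c zero (t ∷ u) ≡ c ℕ.+ t ∷ u
inc^-zero zero    t u = refl
inc^-zero (suc c) t u = trans (inc^-zero c (suc t) u) (cong (_∷ u) (ℕP.+-suc c t))

inc^-suc : ∀ c a t (u : Vec ℕ n) → inc^ c (suc a) (t ∷ u) ≡ t ∷ inc^ c a u
inc^-suc zero    a t u = refl
inc^-suc (suc c) a t u = inc^-suc c a t (inc a u)

altEval : ∀ n → List ℕ → Test n → ℤ
altEval zero    []      φ = φ []
altEval zero    (_ ∷ _) φ = 0ℤ
altEval (suc n) l       φ = pick l (λ c r → altEval n r (λ u → φ (c ∷ u)))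

module _ {n : ℕ} where
  open Alternants (polynomialRing n)
  open Casimir {n} using (variables)
  private module DP = Determinants (polynomialRing n)

  ⟦pick⟧ : {A : Set} (as : List A) (g : A → List A → Pol n) (φ : Test n) →
           ⟦ DP.pick as g ⟧ φ ≡ pick as (λ c r → ⟦ g c r ⟧ φ)
  ⟦pick⟧ []       g φ = ⟦[]⟧ φ
  ⟦pick⟧ (a ∷ as) g φ = trans (⟦⊞⟧ (g a as) _ φ) (cong (⟦ g a as ⟧ φ +_)
    (trans (⟦negate⟧ (DP.pick as (λ c r → g c (a ∷ r))) φ) (cong -_ (⟦pick⟧ as (λ c r → g c (a ∷ r)) φ))))

  ⟦power⟧ : ∀ (a : Fin n) c (p : Pol n) (φ : Test n) → ⟦ (variable′ a ^ c) ⊛ p ⟧ φ ≡ ⟦ p ⟧ (φ ∘ inc^ c a)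
  ⟦power⟧ a zero    p φ = at (PR.*-identityˡ p) φ
  ⟦power⟧ a (suc c) p φ = trans (at (PR.*-assoc (variable′ a) (variable′ a ^ c) p) φ)
    (trans (⟦variable⟧ a ((variable′ a ^ c) ⊛ p) φ) (trans (⟦power⟧ a c p (φ ∘ inc a))
      (⟦⟧-cong p (λ u → cong φ (commute c u)))))
    where
    commute : ∀ c u → inc a (inc^ c a u) ≡ inc^ c a (inc a u)
    commute zero    u = refl
    commute (suc c) u = commute c (inc a u)

  ⟦alternant⟧ : ∀ (a : Fin n) is l (φ : Test n) → ⟦ alternant (variables (a ∷ is)) l ⟧ φ ≡
    pick l (λ c r → ⟦ alternant (variables is) r ⟧ (φ ∘ inc^ c a))
  ⟦alternant⟧ a is l φ = trans (⟦pick⟧ l _ φ) (pick-cong l (λ c r → ⟦power⟧ a c _ φ))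

⟦alternant⟧-lift : ∀ (is : List (Fin n)) l (φ : Test (suc n)) →
  ⟦ Alternants.alternant (polynomialRing (suc n)) (L.map variable′ (L.map suc is)) l ⟧ φ ≡
  ⟦ Alternants.alternant (polynomialRing n) (L.map variable′ is) l ⟧ (φ ∘ (0 ∷_))
⟦alternant⟧-lift []       []      φ = trans (⟦monomial⟧ 1ℤ 𝟘 φ) (sym (⟦monomial⟧ 1ℤ 𝟘 _))
⟦alternant⟧-lift []       (_ ∷ _) φ = trans (⟦[]⟧ φ) (sym (⟦[]⟧ _))
⟦alternant⟧-lift (i ∷ is) l       φ = trans (⟦alternant⟧ (suc i) (L.map suc is) l φ) (trans
  (pick-cong l (λ c r → trans (⟦alternant⟧-lift is r (φ ∘ inc^ c (suc i)))
    (⟦⟧-cong _ (λ u → cong φ (inc^-suc c i 0 u)))))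
  (sym (⟦alternant⟧ i is l (φ ∘ (0 ∷_)))))

allVariables : ∀ n → List (Pol n)
allVariables n = L.map variable′ (L.allFin n)

⟦alternant⟧-altEval : ∀ n l (φ : Test n) →
  ⟦ Alternants.alternant (polynomialRing n) (allVariables n) l ⟧ φ ≡ altEval n l φ
⟦alternant⟧-altEval zero    []      φ = trans (⟦monomial⟧ 1ℤ 𝟘 φ) (ℤP.*-identityˡ (φ []))
⟦alternant⟧-altEval zero    (_ ∷ _) φ = ⟦[]⟧ φ
⟦alternant⟧-altEval (suc n) l       φ = trans (⟦alternant⟧ zero (L.tabulate suc) l φ)
  (pick-cong l (λ c r → trans
    (cong (λ is → ⟦ Alternants.alternant (polynomialRing (suc n)) (L.map variable′ is) r ⟧ (φ ∘ inc^ c zero))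
          (sym (LP.map-tabulate id suc)))
    (trans (⟦alternant⟧-lift (L.allFin n) r (φ ∘ inc^ c zero))
      (trans (⟦alternant⟧-altEval n r _) (altEval-cong n r (λ u → cong φ
        (trans (inc^-zero c 0 u) (cong (_∷ u) (ℕP.+-identityʳ c)))))))))
  where
  altEval-cong : ∀ n l {φ ψ : Test n} → (∀ u → φ u ≡ ψ u) → altEval n l φ ≡ altEval n l ψ
  altEval-cong zero    []      e = e []
  altEval-cong zero    (_ ∷ _) e = refl
  altEval-cong (suc n) l       e = pick-cong l (λ c r → altEval-cong n r (λ u → e (c ∷ u)))

swapAt : {A : Set} → Fin n → Vec A (suc n) → Vec A (suc n)
swapAt zero    (x ∷ y ∷ u) = y ∷ x ∷ u
swapAt (suc i) (x ∷ u)     = x ∷ swapAt i u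

altEval-swap : ∀ {n} l (i : Fin n) (φ : Test (suc n)) → altEval (suc n) l (φ ∘ swapAt i) ≡ - altEval (suc n) l φ
altEval-swap {suc n} l zero    φ = pick-pick-anti (λ c d r → altEval n r (λ u → φ (d ∷ c ∷ u))) l
altEval-swap {suc n} l (suc i) φ = trans (pick-cong l (λ c r → altEval-swap r i (λ u → φ (c ∷ u)))) (pick-neg l)

sumOf : (ℕ → ℤ) → List ℕ → ℤ
sumOf w l = ∑ l w

sumOf-picked : ∀ w {l c r} → Picked l c r → sumOf w l ≡ w c + sumOf w r
sumOf-picked w here          = refl
sumOf-picked w (there {a} {c = c} {r = r} p) = trans (cong (w a +_) (sumOf-picked w p)) (swap (w a) (w c) (sumOf w r))
  where
  swap : ∀ x y z → x + (y + z) ≡ y + (x + z)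
  swap = solve-∀

-- Every monomial of an alternant has as exponents a rearrangement of l.
altEval-weight : ∀ w n l (φ : Test n) →
  altEval n l (λ u → sumOf w (toList u) * φ u) ≡ sumOf w l * altEval n l φ
altEval-weight w zero    []      φ = refl
altEval-weight w zero    (c ∷ l) φ = sym (ℤP.*-zeroʳ (sumOf w (c ∷ l)))
altEval-weight w (suc n) l       φ = trans
  (pick-congᴾ l (λ c r p → trans (add n r c φ)
     (trans (cong (_+ w c * altEval n r (λ u → φ (c ∷ u))) (altEval-weight w n r (λ u → φ (c ∷ u))))
       (trans (factor (w c) (sumOf w r) (altEval n r (λ u → φ (c ∷ u))))
         (cong (_* altEval n r (λ u → φ (c ∷ u))) (sym (sumOf-picked w p)))))))
  (pick-*ˡ l (sumOf w l))
  where
  linear : ∀ n r k (φ ψ : Test n) → altEval n r (λ u → φ u + k * ψ u) ≡ altEval n r φ + k * altEval n r ψ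
  linear n r k φ ψ = begin
    altEval n r (λ u → φ u + k * ψ u)                ≡⟨ ⟦alternant⟧-altEval n r _ ⟨
    ⟦ A ⟧ (λ u → φ u + k * ψ u)                      ≡⟨ ⟦⟧-+ A φ (λ u → k * ψ u) ⟩
    ⟦ A ⟧ φ + ⟦ A ⟧ (λ u → k * ψ u)                  ≡⟨ cong (⟦ A ⟧ φ +_) (⟦⟧-*ˡ A k ψ) ⟩
    ⟦ A ⟧ φ + k * ⟦ A ⟧ ψ                            ≡⟨ cong₂ (λ x y → x + k * y) (⟦alternant⟧-altEval n r φ) (⟦alternant⟧-altEval n r ψ) ⟩
    altEval n r φ + k * altEval n r ψ                ∎
    where
    open ≡-Reasoning
    A = Alternants.alternant (polynomialRing n) (allVariables n) r
  congruent : ∀ n r {φ ψ : Test n} → (∀ u → φ u ≡ ψ u) → altEval n r φ ≡ altEval n r ψ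
  congruent n r e = trans (sym (⟦alternant⟧-altEval n r _)) (trans (⟦⟧-cong _ e) (⟦alternant⟧-altEval n r _))
  expand : ∀ x s y → (x + s) * y ≡ s * y + x * y
  expand = solve-∀
  factor : ∀ x s y → s * y + x * y ≡ (x + s) * y
  factor = solve-∀
  add : ∀ n r c (φ : Test (suc n)) → altEval n r (λ u → sumOf w (toList (c ∷ u)) * φ (c ∷ u)) ≡
        altEval n r (λ u → sumOf w (toList u) * φ (c ∷ u)) + w c * altEval n r (λ u → φ (c ∷ u))
  add n r c φ = trans (congruent n r (λ u → expand (w c) (sumOf w (toList u)) (φ (c ∷ u))))
                      (linear n r (w c) (λ u → sumOf w (toList u) * φ (c ∷ u)) (λ u → φ (c ∷ u)))

Strict : Vec ℕ n → Set
Strict u = Linked _>_ (toList u)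

head-max : ∀ {l ls} → Linked _>_ (l ∷ ls) → All (l >_) ls
head-max [-]     = []
head-max (g ∷ s) = g ∷ All.map (λ lt → ℕP.<-trans lt g) (head-max s)

-- Every monomial of the alternant uses the exponent `l` somewhere, and no entry of `β` is that
-- large.
altEval-small : ∀ n l ls (β : Vec ℕ n) → All (l >_) (toList β) → altEval n (l ∷ ls) (δ β) ≡ 0ℤ
altEval-small zero    l ls []      small = refl
altEval-small (suc n) l ls (b ∷ β) (l>b ∷ small) = trans
  (cong₂ _-_
    (zeroed n ls b l β (ℕP.<⇒≢ l>b))
    (pick-zero ls (λ c r → trans (scaled n (l ∷ r) b c β)
      (trans (cong (δ₁ b c *_) (altEval-small n l r β small)) (ℤP.*-zeroʳ (δ₁ b c))))))
  refl
  where
  scaled : ∀ n r b c (β : Vec ℕ n) → altEval n r (λ u → δ (b ∷ β) (c ∷ u)) ≡ δ₁ b c * altEval n r (δ β)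
  scaled n r b c β = trans (sym (⟦alternant⟧-altEval n r _))
    (trans (⟦⟧-*ˡ _ (δ₁ b c) (δ β)) (cong (δ₁ b c *_) (⟦alternant⟧-altEval n r (δ β))))
  zeroed : ∀ n r b c (β : Vec ℕ n) → b ≢ c → altEval n r (λ u → δ (b ∷ β) (c ∷ u)) ≡ 0ℤ
  zeroed n r b c β ne = trans (scaled n r b c β) (cong (_* altEval n r (δ β)) (δ₁-≢ b c ne))

-- A decreasing arrangement must begin with the largest exponent: after any smaller beginning, `l`
-- would still have to be placed among smaller entries. Hence coefficients at strict exponents
-- separate the alternants.
altEval-strict : ∀ n (l β : Vec ℕ n) → Strict l → Strict β → altEval n (toList l) (δ β) ≡ δ l β
altEval-strict zero    []      []      s t = refl
altEval-strict (suc n) (l ∷ ls) (b ∷ β) s t = trans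
  (cong₂ _-_ (scaled (toList ls) l) (pick-zeroᴾ (toList ls) (λ c r p → trans (scaled (l ∷ r) c) (tail c r p))))
  (trans (ℤP.+-identityʳ _) (trans (cong (δ₁ b l *_) (altEval-strict n ls β (Linked.tail s) (Linked.tail t)))
    (cong (_* δ ls β) (δ₁-comm b l))))
  where
  scaled : ∀ r c → altEval n r (λ u → δ (b ∷ β) (c ∷ u)) ≡ δ₁ b c * altEval n r (δ β)
  scaled r c = trans (sym (⟦alternant⟧-altEval n r _))
    (trans (⟦⟧-*ˡ _ (δ₁ b c) (δ β)) (cong (δ₁ b c *_) (⟦alternant⟧-altEval n r (δ β))))
  picked-∈ : ∀ {l : List ℕ} {c r} → Picked l c r → c ∈ l
  picked-∈ here      = here refl
  picked-∈ (there p) = there (picked-∈ p)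
  tail : ∀ c r → Picked (toList ls) c r → δ₁ b c * altEval n (l ∷ r) (δ β) ≡ 0ℤ
  tail c r p with b ℕ.≟ c
  ... | no b≢c   = cong (_* altEval n (l ∷ r) (δ β)) (δ₁-≢ b c b≢c)
  ... | yes refl = trans (cong (δ₁ b c *_) (altEval-small n l r β
    (All.map (λ lt → ℕP.<-trans lt (All.lookup (head-max s) (picked-∈ p))) (head-max t)))) (ℤP.*-zeroʳ (δ₁ b c))

open Casimir using (variables)

vander : ∀ n → Pol n
vander n = Alternants.vandermonde (polynomialRing n) (allVariables n)

schurPol : Vec ℕ n → Pol n
schurPol {n} l = Alternants.schurStrict (polynomialRing n) (allVariables n) (toList l)

vander-schur : (l : Vec ℕ n) → Strict l → (φ : Test n) → ⟦ vander n ⊛ schurPol l ⟧ φ ≡ altEval n (toList l) φ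
vander-schur {n} l s φ = trans
  (at (Alternants.vandermonde-schur (polynomialRing n) (allVariables n) s) φ) (⟦alternant⟧-altEval n (toList l) φ)

downFrom-strict : ∀ n → Linked _>_ (L.downFrom n)
downFrom-strict zero          = []
downFrom-strict (suc zero)    = [-]
downFrom-strict (suc (suc n)) = ℕP.≤-refl ∷ downFrom-strict (suc n)

-- The staircase belongs to the empty partition, whose Schur polynomial is 1, so Vandermonde's
-- determinant is a case of the bialternant formula. The antisymmetry and the weights of V are then
-- those of an alternant.
⟦vander⟧ : ∀ n (φ : Test n) → ⟦ vander n ⟧ φ ≡ altEval n (L.downFrom n) φ
⟦vander⟧ n φ = begin
  ⟦ vander n ⟧ φ                                       ≡⟨ at (PR.*-identityʳ (vander n)) φ ⟨
  ⟦ vander n ⊛ constant 1ℤ ⟧ φ                         ≡⟨ at (PR.*-congˡ {x = vander n} (PR.sym staircase)) φ ⟩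
  ⟦ vander n ⊛ schurStrict (allVariables n) (L.downFrom n) ⟧ φ ≡⟨ at (vandermonde-schur (allVariables n) (downFrom-strict n)) φ ⟩
  ⟦ alternant (allVariables n) (L.downFrom n) ⟧ φ      ≡⟨ ⟦alternant⟧-altEval n (L.downFrom n) φ ⟩
  altEval n (L.downFrom n) φ                           ∎
  where
  open ≡-Reasoning
  open Alternants (polynomialRing n)
  staircase : schurStrict (allVariables n) (L.downFrom n) ≋ constant 1ℤ
  staircase = subst (λ k → schurStrict (allVariables n) (L.downFrom k) ≋ constant 1ℤ)
    (trans (LP.length-map variable′ (L.allFin n)) (LP.length-tabulate id))
    (schurStrict-staircase (allVariables n))

vander-weight : ∀ w (φ : Test n) →
  ⟦ vander n ⟧ (λ u → sumOf w (toList u) * φ u) ≡ sumOf w (L.downFrom n) * ⟦ vander n ⟧ φ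
vander-weight {n} w φ = trans (⟦vander⟧ n _)
  (trans (altEval-weight w n (L.downFrom n) φ) (cong (sumOf w (L.downFrom n) *_) (sym (⟦vander⟧ n φ))))

sq-sumOf : (u : Vec ℕ n) → sq u ≡ sumOf (λ t → ⁺ t * ⁺ t) (toList u)
sq-sumOf []      = refl
sq-sumOf (t ∷ u) = cong (⁺ t * ⁺ t +_) (sq-sumOf u)

vanderEigenvalue : ℕ → ℤ
vanderEigenvalue n = sumOf (λ t → ⁺ t * ⁺ t) (L.downFrom n)

vander-laplace : ∀ n → laplace (vander n) ≋ constant (vanderEigenvalue n) ⊛ vander n
vander-laplace n = ev λ φ → begin
  ⟦ laplace (vander n) ⟧ φ                    ≡⟨ ⟦reweight⟧ sq (vander n) φ ⟩
  ⟦ vander n ⟧ (λ u → sq u * φ u)             ≡⟨ ⟦⟧-cong (vander n) (λ u → cong (_* φ u) (sq-sumOf u)) ⟩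
  ⟦ vander n ⟧ (λ u → sumOf (λ t → ⁺ t * ⁺ t) (toList u) * φ u) ≡⟨ vander-weight (λ t → ⁺ t * ⁺ t) φ ⟩
  vanderEigenvalue n * ⟦ vander n ⟧ φ         ≡⟨ ⟦constant⊛⟧ (vanderEigenvalue n) (vander n) φ ⟨
  ⟦ constant (vanderEigenvalue n) ⊛ vander n ⟧ φ ∎
  where open ≡-Reasoning

-- The operator ∑ₐ ∂/∂xₐ

∇ : Test n → Test n
∇ φ []      = 0ℤ
-- The operator is transposed: pairing p with `∇ φ` pairs the derivative of p with φ. At t = 0 the
-- truncated predecessor is harmless, because its factor is 0.
∇ φ (t ∷ u) = ⁺ t * φ (ℕ.pred t ∷ u) + ∇ (λ w → φ (t ∷ w)) u

∇-𝟘 : ∀ n (φ : Test n) → ∇ φ 𝟘 ≡ 0ℤ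
∇-𝟘 zero    φ = refl
∇-𝟘 (suc n) φ = trans (ℤP.+-identityˡ _) (∇-𝟘 n (λ w → φ (0 ∷ w)))

∇-inc : (φ : Test n) (a : Fin n) (u : Vec ℕ n) → ∇ φ (inc a u) ≡ φ u + ∇ (φ ∘ inc a) u
∇-inc φ zero (t ∷ u) = begin
  ⁺ suc t * φ (t ∷ u) + ∇ (λ w → φ (suc t ∷ w)) u
    ≡⟨ cong (_+ ∇ (λ w → φ (suc t ∷ w)) u) (trans (ℤP.suc-* (⁺ t) (φ (t ∷ u))) (cong (φ (t ∷ u) +_) (positive t))) ⟩
  (φ (t ∷ u) + ⁺ t * φ (suc (ℕ.pred t) ∷ u)) + ∇ (λ w → φ (suc t ∷ w)) u
    ≡⟨ ℤP.+-assoc (φ (t ∷ u)) _ _ ⟩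
  φ (t ∷ u) + (⁺ t * φ (suc (ℕ.pred t) ∷ u) + ∇ (λ w → φ (suc t ∷ w)) u) ∎
  where
  open ≡-Reasoning
  positive : ∀ t → ⁺ t * φ (t ∷ u) ≡ ⁺ t * φ (suc (ℕ.pred t) ∷ u)
  positive zero    = refl
  positive (suc t) = refl
∇-inc φ (suc a) (t ∷ u) = trans (cong (⁺ t * φ (ℕ.pred t ∷ inc a u) +_) (∇-inc (λ w → φ (t ∷ w)) a u))
  (swap (⁺ t * φ (ℕ.pred t ∷ inc a u)) (φ (t ∷ u)) (∇ (λ w → φ (t ∷ inc a w)) u))
  where
  swap : ∀ x y z → x + (y + z) ≡ y + (x + z)
  swap = solve-∀

∇-⊕ : (φ : Test n) (u w : Vec ℕ n) → ∇ φ (u ⊕ w) ≡ ∇ (λ v → φ (v ⊕ w)) u + ∇ (λ v → φ (u ⊕ v)) w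
∇-⊕ φ []      []      = refl
∇-⊕ φ (s ∷ u) (t ∷ w) = trans
  (cong₂ _+_ (trans (cong (_* φ (ℕ.pred (s ℕ.+ t) ∷ u ⊕ w)) (ℤP.pos-+ s t)) (leibniz s t))
             (∇-⊕ (λ v → φ (s ℕ.+ t ∷ v)) u w))
  (interchange (⁺ s * φ (ℕ.pred s ℕ.+ t ∷ u ⊕ w)) (⁺ t * φ (s ℕ.+ ℕ.pred t ∷ u ⊕ w)) _ _)
  where
  interchange : ∀ a b c d → (a + b) + (c + d) ≡ (a + c) + (b + d)
  interchange = solve-∀
  leibniz : ∀ s t → (⁺ s + ⁺ t) * φ (ℕ.pred (s ℕ.+ t) ∷ u ⊕ w) ≡
    ⁺ s * φ (ℕ.pred s ℕ.+ t ∷ u ⊕ w) + ⁺ t * φ (s ℕ.+ ℕ.pred t ∷ u ⊕ w)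
  leibniz zero    t       = trans (cong (_* φ (ℕ.pred t ∷ u ⊕ w)) (ℤP.+-identityˡ (⁺ t))) (sym (ℤP.+-identityˡ _))
  leibniz (suc s) zero    = trans (cong (_* φ (s ℕ.+ 0 ∷ u ⊕ w)) (ℤP.+-identityʳ (⁺ suc s))) (sym (ℤP.+-identityʳ _))
  leibniz (suc s) (suc t) = trans (ℤP.*-distribʳ-+ (φ (s ℕ.+ suc t ∷ u ⊕ w)) (⁺ suc s) (⁺ suc t))
    (cong (λ r → ⁺ suc s * φ (s ℕ.+ suc t ∷ u ⊕ w) + ⁺ suc t * φ (r ∷ u ⊕ w)) (ℕP.+-suc s t))

Killed : Pol n → Set
Killed p = ∀ φ → ⟦ p ⟧ (∇ φ) ≡ 0ℤ

killed-⊛ : (p q : Pol n) → Killed p → Killed q → Killed (p ⊛ q)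
killed-⊛ p q kp kq φ = begin
  ⟦ p ⊛ q ⟧ (∇ φ) ≡⟨ ⟦⊛⟧ p q (∇ φ) ⟩
  ⟦ p ⟧ (λ u → ⟦ q ⟧ (λ w → ∇ φ (u ⊕ w)))
    ≡⟨ ⟦⟧-cong p (λ u → trans (⟦⟧-cong q (λ w → ∇-⊕ φ u w)) (trans
         (⟦⟧-+ q (λ w → ∇ (λ v → φ (v ⊕ w)) u) (λ w → ∇ (λ v → φ (u ⊕ v)) w))
         (trans (cong (⟦ q ⟧ (λ w → ∇ (λ v → φ (v ⊕ w)) u) +_) (kq (λ v → φ (u ⊕ v)))) (ℤP.+-identityʳ _)))) ⟩
  ⟦ p ⟧ (λ u → ⟦ q ⟧ (λ w → ∇ (λ v → φ (v ⊕ w)) u))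
    ≡⟨ ⟦⟧-swap p q _ ⟩
  ⟦ q ⟧ (λ w → ⟦ p ⟧ (∇ (λ v → φ (v ⊕ w))))
    ≡⟨ ⟦⟧-zero q (λ w → kp (λ v → φ (v ⊕ w))) ⟩
  0ℤ ∎
  where open ≡-Reasoning

killed-one : Killed (constant {n} 1ℤ)
killed-one {n} φ = trans (⟦monomial⟧ 1ℤ 𝟘 (∇ φ)) (cong (1ℤ *_) (∇-𝟘 n φ))

killed-difference : (a b : Fin n) → Killed (variable′ a PR.- variable′ b)
killed-difference {n} a b φ = trans (⟦⊞⟧ (variable′ a) _ (∇ φ)) (trans
  (cong (⟦ variable′ a ⟧ (∇ φ) +_) (⟦negate⟧ (variable′ b) (∇ φ)))
  (trans (cong₂ _-_ (one a) (one b)) (ℤP.+-inverseʳ (φ 𝟘))))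
  where
  one : ∀ a → ⟦ variable′ a ⟧ (∇ φ) ≡ φ 𝟘
  one a = trans (⟦monomial⟧ 1ℤ (inc a 𝟘) (∇ φ)) (trans (ℤP.*-identityˡ _)
    (trans (∇-inc φ a 𝟘) (trans (cong (φ 𝟘 +_) (∇-𝟘 n (φ ∘ inc a))) (ℤP.+-identityʳ _))))

killed-vandermonde : (is : List (Fin n)) → Killed (Alternants.vandermonde (polynomialRing n) (variables is))
killed-vandermonde []       = killed-one
killed-vandermonde {n} (a ∷ is) = killed-⊛ (differences (variable′ a) (variables is)) (vandermonde (variables is))
  (go is) (killed-vandermonde is)
  where
  open Alternants (polynomialRing n)
  go : ∀ bs → Killed (differences (variable′ a) (variables bs))
  go []       = killed-one
  go (b ∷ bs) = killed-⊛ (variable′ a PR.- variable′ b) (differences (variable′ a) (variables bs))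
    (killed-difference a b) (go bs)

-- Only the monomials x^(m + ε_a) have x^m in their derivative, with the factor m_a + 1.
∇-δ : (m u : Vec ℕ n) → ∇ (δ m) u ≡ ∑ (L.allFin n) (λ a → ⁺ suc (lookup m a) * δ (inc a m) u)
∇-δ []      []      = refl
∇-δ {suc n} (s ∷ m) (t ∷ u) = begin
  ⁺ t * (δ₁ s (ℕ.pred t) * δ m u) + ∇ (λ w → δ₁ s t * δ m w) u
    ≡⟨ cong₂ _+_ (trans (sym (ℤP.*-assoc (⁺ t) (δ₁ s (ℕ.pred t)) (δ m u))) (cong (_* δ m u) (head s t)))
         (trans (scale (δ₁ s t) (δ m) u)
           (trans (cong (δ₁ s t *_) (∇-δ m u)) (sym (∑-*ˡ (L.allFin n) (δ₁ s t))))) ⟩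
  ⁺ suc s * δ₁ (suc s) t * δ m u + ∑ (L.allFin n) (λ a → δ₁ s t * (⁺ suc (lookup m a) * δ (inc a m) u))
    ≡⟨ cong₂ _+_ (ℤP.*-assoc (⁺ suc s) (δ₁ (suc s) t) (δ m u))
         (∑-cong (L.allFin n) (λ a → swap (δ₁ s t) (⁺ suc (lookup m a)) (δ (inc a m) u))) ⟩
  ⁺ suc s * (δ₁ (suc s) t * δ m u) + ∑ (L.allFin n) (λ a → ⁺ suc (lookup m a) * (δ₁ s t * δ (inc a m) u))
    ≡⟨ ∑-allFin (λ a → ⁺ suc (lookup (s ∷ m) a) * δ (inc a (s ∷ m)) (t ∷ u)) ⟨
  ∑ (L.allFin (suc n)) (λ a → ⁺ suc (lookup (s ∷ m) a) * δ (inc a (s ∷ m)) (t ∷ u)) ∎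
  where
  open ≡-Reasoning
  swap : ∀ x y z → x * (y * z) ≡ y * (x * z)
  swap = solve-∀
  scale : ∀ {n} k (φ : Test n) u → ∇ (λ w → k * φ w) u ≡ k * ∇ φ u
  scale k φ []      = sym (ℤP.*-zeroʳ k)
  scale k φ (t ∷ u) = trans (cong (⁺ t * (k * φ (ℕ.pred t ∷ u)) +_) (scale k (λ w → φ (t ∷ w)) u))
    (factor (⁺ t) k (φ (ℕ.pred t ∷ u)) (∇ (λ w → φ (t ∷ w)) u))
    where
    factor : ∀ t k x y → t * (k * x) + k * y ≡ k * (t * x + y)
    factor = solve-∀
  head : ∀ s t → ⁺ t * δ₁ s (ℕ.pred t) ≡ ⁺ suc s * δ₁ (suc s) t
  head s zero    = sym (ℤP.*-zeroʳ (⁺ suc s))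
  head s (suc t) with s ℕ.≟ t
  ... | yes refl = refl
  ... | no s≢t   = trans (cong (⁺ suc t *_) (δ₁-≢ s t s≢t)) (trans (ℤP.*-zeroʳ (⁺ suc t))
                     (sym (trans (cong (⁺ suc s *_) (δ₁-≢ s t s≢t)) (ℤP.*-zeroʳ (⁺ suc s)))))

-- If g = ∑ₐ ∂f/∂xₐ then the coefficients of V g are read off from those of V f,
-- because V itself is translation invariant.
vander-∇ : (f g : Pol n) → (∀ φ → ⟦ g ⟧ φ ≡ ⟦ f ⟧ (∇ φ)) → ∀ m →
  coefficient m (vander n ⊛ g) ≡
  ∑ (L.allFin n) (λ a → ⁺ suc (lookup m a) * coefficient (inc a m) (vander n ⊛ f))
vander-∇ {n} f g e m = begin
  ⟦ V ⊛ g ⟧ (δ m) ≡⟨ ⟦⊛⟧ V g (δ m) ⟩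
  ⟦ V ⟧ (λ u → ⟦ g ⟧ (λ w → δ m (u ⊕ w))) ≡⟨ ⟦⟧-cong V (λ u → e (λ w → δ m (u ⊕ w))) ⟩
  ⟦ V ⟧ (λ u → ⟦ f ⟧ (∇ (λ w → δ m (u ⊕ w)))) ≡⟨ ℤP.+-identityˡ _ ⟨
  0ℤ + ⟦ V ⟧ (λ u → ⟦ f ⟧ (∇ (λ w → δ m (u ⊕ w)))) ≡⟨ cong (_+ ⟦ V ⟧ (λ u → ⟦ f ⟧ (∇ (λ w → δ m (u ⊕ w))))) (trans (⟦⟧-swap V f _)
     (⟦⟧-zero f (λ w → killed-vandermonde (L.allFin n) (λ v → δ m (v ⊕ w))))) ⟨
  ⟦ V ⟧ (λ u → ⟦ f ⟧ (λ w → ∇ (λ v → δ m (v ⊕ w)) u)) + ⟦ V ⟧ (λ u → ⟦ f ⟧ (∇ (λ w → δ m (u ⊕ w))))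
    ≡⟨ ⟦⟧-+ V (λ u → ⟦ f ⟧ (λ w → ∇ (λ v → δ m (v ⊕ w)) u)) (λ u → ⟦ f ⟧ (∇ (λ w → δ m (u ⊕ w)))) ⟨
  ⟦ V ⟧ (λ u → ⟦ f ⟧ (λ w → ∇ (λ v → δ m (v ⊕ w)) u) + ⟦ f ⟧ (∇ (λ w → δ m (u ⊕ w))))
    ≡⟨ ⟦⟧-cong V (λ u → trans (sym (⟦⟧-+ f (λ w → ∇ (λ v → δ m (v ⊕ w)) u) (∇ (λ w → δ m (u ⊕ w)))))
         (⟦⟧-cong f (λ w → sym (∇-⊕ (δ m) u w)))) ⟩
  ⟦ V ⟧ (λ u → ⟦ f ⟧ (λ w → ∇ (δ m) (u ⊕ w))) ≡⟨ ⟦⊛⟧ V f (∇ (δ m)) ⟨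
  ⟦ V ⊛ f ⟧ (∇ (δ m)) ≡⟨ ⟦⟧-cong (V ⊛ f) (∇-δ m) ⟩
  ⟦ V ⊛ f ⟧ (λ u → ∑ (L.allFin n) (λ a → ⁺ suc (lookup m a) * δ (inc a m) u))
    ≡⟨ ⟦⟧-∑ (V ⊛ f) (L.allFin n) (λ a u → ⁺ suc (lookup m a) * δ (inc a m) u) ⟩
  ∑ (L.allFin n) (λ a → ⟦ V ⊛ f ⟧ (λ u → ⁺ suc (lookup m a) * δ (inc a m) u))
    ≡⟨ ∑-cong (L.allFin n) (λ a → ⟦⟧-*ˡ (V ⊛ f) (⁺ suc (lookup m a)) (δ (inc a m))) ⟩
  ∑ (L.allFin n) (λ a → ⁺ suc (lookup m a) * coefficient (inc a m) (V ⊛ f)) ∎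
  where
  open ≡-Reasoning
  V = vander n

-- Expansion of symmetric polynomials in Schur polynomials

private
  -- One step of insertion sort by adjacent swaps. The bound `b` records that everything still to be
  -- placed is at most the entry in front, so the result stays sorted behind it.
  insertion : ∀ {n} (Z : Vec ℕ (suc n) → Set) → (∀ i β → Z (swapAt i β) → Z β) → ∀ b →
    (∀ β → Linked _≥_ (b ∷ toList β) → Z β) →
    ∀ x u → b ≥ x → Linked _≥_ (b ∷ toList u) → Z (x ∷ u)
  insertion Z closed b sorted x []      b≥x s = sorted (x ∷ []) (b≥x ∷ [-])
  insertion Z closed b sorted x (y ∷ u) b≥x (b≥y ∷ s) with y ℕ.≤? x
  ... | yes x≥y = sorted (x ∷ y ∷ u) (b≥x ∷ (x≥y ∷ s))
  ... | no  x≱y = closed zero (x ∷ y ∷ u)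
    (insertion (λ w → Z (y ∷ w)) (λ i β → closed (suc i) (y ∷ β)) y
      (λ β s′ → sorted (y ∷ β) (b≥y ∷ s′)) x u (ℕP.<⇒≤ (ℕP.≰⇒> x≱y)) s)

sort-closure : (Z : Vec ℕ (suc n) → Set) → (∀ i β → Z (swapAt i β) → Z β) →
  (∀ β → Linked _≥_ (toList β) → Z β) → ∀ β → Z β
sort-closure Z closed sorted (x ∷ [])     = sorted (x ∷ []) [-]
sort-closure Z closed sorted (x ∷ y ∷ u) =
  sort-closure (λ w → Z (x ∷ w)) (λ i β → closed (suc i) (x ∷ β)) place (y ∷ u)
  where
  place : ∀ w → Linked _≥_ (toList w) → Z (x ∷ w)
  place (y ∷ w) s = insertion Z closed (x ℕ.⊔ y) (λ β s′ → sorted β (Linked.tail s′)) x (y ∷ w)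
    (ℕP.m≤m⊔n x y) (ℕP.m≤n⊔m x y ∷ s)

strict-or-repeated : (β : Vec ℕ (suc n)) → Linked _≥_ (toList β) → Strict β ⊎ ∃ λ i → swapAt i β ≡ β
strict-or-repeated (x ∷ [])     s         = inj₁ [-]
strict-or-repeated (x ∷ y ∷ u) (x≥y ∷ s) with strict-or-repeated (y ∷ u) s
... | inj₂ (i , e) = inj₂ (suc i , cong (x ∷_) e)
... | inj₁ s′ with ℕP.m≤n⇒m<n∨m≡n x≥y
...   | inj₁ x>y  = inj₁ (x>y ∷ s′)
...   | inj₂ refl = inj₂ (zero , refl)

self-negative : ∀ x → x ≡ - x → x ≡ 0ℤ
self-negative (⁺ zero) e = refl

-- Sorting by adjacent swaps changes only the sign, and a repeated entry makes the value its own
-- negative.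
antisymmetric-zero : (K : Vec ℕ (suc n) → ℤ) → (∀ i β → K (swapAt i β) ≡ - K β) →
  (∀ β → Strict β → K β ≡ 0ℤ) → ∀ β → K β ≡ 0ℤ
antisymmetric-zero K anti strict = sort-closure (λ β → K β ≡ 0ℤ)
  (λ i β z → ℤP.neg-injective (trans (sym (anti i β)) z))
  sorted
  where
  sorted : ∀ β → Linked _≥_ (toList β) → K β ≡ 0ℤ
  sorted β s with strict-or-repeated β s
  ... | inj₁ s′      = strict β s′
  ... | inj₂ (i , e) = self-negative (K β) (trans (cong K (sym e)) (anti i β))

δ-≢ : (α u : Vec ℕ n) → α ≢ u → δ α u ≡ 0ℤ
δ-≢ []      []      ne = ⊥-elim (ne refl)
δ-≢ (s ∷ α) (t ∷ u) ne with s ℕ.≟ t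
... | no s≢t   = cong (_* δ α u) (δ₁-≢ s t s≢t)
... | yes refl = trans (cong (δ₁ s s *_) (δ-≢ α u (ne ∘ cong (s ∷_)))) (ℤP.*-zeroʳ (δ₁ s s))

δ-swap : ∀ (i : Fin n) (β u : Vec ℕ (suc n)) → δ (swapAt i β) u ≡ δ β (swapAt i u)
δ-swap zero    (x ∷ y ∷ β) (s ∷ t ∷ u) = exchange (δ₁ y s) (δ₁ x t) (δ β u)
  where
  exchange : ∀ a b c → a * (b * c) ≡ b * (a * c)
  exchange = solve-∀
δ-swap (suc i) (x ∷ β)      (s ∷ u)      = cong (δ₁ x s *_) (δ-swap i β u)

coefficient-outside : (β : Vec ℕ n) (p : Pol n) → β ∉ L.map proj₂ p → coefficient β p ≡ 0ℤ
coefficient-outside β []            out = ⟦[]⟧ (δ β)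
coefficient-outside β ((c , u) ∷ p) out = trans (⟦⟧-term c u p (δ β)) (cong₂ _+_
  (trans (cong (c *_) (δ-≢ β u (λ e → out (here e)))) (ℤP.*-zeroʳ c))
  (coefficient-outside β p (out ∘ there)))

∑-δ-outside : (c : Vec ℕ n → ℤ) (β : Vec ℕ n) (Λ : List (Vec ℕ n)) → β ∉ Λ → ∑ Λ (λ l → c l * δ l β) ≡ 0ℤ
∑-δ-outside c β []      out = refl
∑-δ-outside c β (l ∷ Λ) out = cong₂ _+_
  (trans (cong (c l *_) (δ-≢ l β (λ e → out (here (sym e))))) (ℤP.*-zeroʳ (c l)))
  (∑-δ-outside c β Λ (out ∘ there))

∑-δ-inside : (c : Vec ℕ n → ℤ) (β : Vec ℕ n) (Λ : List (Vec ℕ n)) → Unique Λ → β ∈ Λ →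
  ∑ Λ (λ l → c l * δ l β) ≡ c β
∑-δ-inside c β (l ∷ Λ) (new ∷ un) (here refl) = trans
  (cong₂ _+_ (trans (cong (c l *_) (δ-refl l)) (ℤP.*-identityʳ (c l)))
             (∑-δ-outside c l Λ (λ l∈ → All.lookup new l∈ refl)))
  (ℤP.+-identityʳ (c l))
∑-δ-inside c β (l ∷ Λ) (new ∷ un) (there β∈) = trans
  (cong₂ _+_ (trans (cong (c l *_) (δ-≢ l β (All.lookup new β∈))) (ℤP.*-zeroʳ (c l)))
             (∑-δ-inside c β Λ un β∈))
  (ℤP.+-identityˡ (c β))

Symmetric : Pol (suc n) → Set
Symmetric f = ∀ i φ → ⟦ f ⟧ (φ ∘ swapAt i) ≡ ⟦ f ⟧ φ

⊕-swap : ∀ (i : Fin n) (u w : Vec ℕ (suc n)) → swapAt i (u ⊕ w) ≡ swapAt i u ⊕ swapAt i w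
⊕-swap zero    (x ∷ y ∷ u) (s ∷ t ∷ w) = refl
⊕-swap (suc i) (x ∷ u)      (s ∷ w)      = cong (x ℕ.+ s ∷_) (⊕-swap i u w)

vander-antisymmetric : (f : Pol (suc n)) → Symmetric f → ∀ i φ →
  ⟦ vander (suc n) ⊛ f ⟧ (φ ∘ swapAt i) ≡ - ⟦ vander (suc n) ⊛ f ⟧ φ
vander-antisymmetric {n} f sym-f i φ = begin
  ⟦ V ⊛ f ⟧ (φ ∘ swapAt i)                               ≡⟨ ⟦⊛⟧ V f _ ⟩
  ⟦ V ⟧ (λ u → ⟦ f ⟧ (λ w → φ (swapAt i (u ⊕ w))))       ≡⟨ ⟦⟧-cong V (λ u → trans
    (⟦⟧-cong f (λ w → cong φ (⊕-swap i u w))) (sym-f i (λ w → φ (swapAt i u ⊕ w)))) ⟩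
  ⟦ V ⟧ ((λ u → ⟦ f ⟧ (λ w → φ (u ⊕ w))) ∘ swapAt i)     ≡⟨ ⟦vander⟧ (suc n) _ ⟩
  altEval (suc n) (L.downFrom (suc n)) ((λ u → ⟦ f ⟧ (λ w → φ (u ⊕ w))) ∘ swapAt i)
    ≡⟨ altEval-swap (L.downFrom (suc n)) i (λ u → ⟦ f ⟧ (λ w → φ (u ⊕ w))) ⟩
  - altEval (suc n) (L.downFrom (suc n)) (λ u → ⟦ f ⟧ (λ w → φ (u ⊕ w)))
    ≡⟨ cong -_ (⟦vander⟧ (suc n) _) ⟨
  - ⟦ V ⟧ (λ u → ⟦ f ⟧ (λ w → φ (u ⊕ w)))                ≡⟨ cong -_ (⟦⊛⟧ V f φ) ⟨
  - ⟦ V ⊛ f ⟧ φ                                          ∎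
  where
  open ≡-Reasoning
  V = vander (suc n)

⟦sum⟧ : {A : Set} (as : List A) (g : A → Pol n) (φ : Test n) → ⟦ Casimir.sum as g ⟧ φ ≡ ∑ as (λ a → ⟦ g a ⟧ φ)
⟦sum⟧ []       g φ = ⟦[]⟧ φ
⟦sum⟧ (a ∷ as) g φ = trans (⟦⊞⟧ (g a) (Casimir.sum as g) φ) (cong (⟦ g a ⟧ φ +_) (⟦sum⟧ as g φ))

⊛-sum : {A : Set} (q : Pol n) (as : List A) (g : A → Pol n) (φ : Test n) →
  ⟦ q ⊛ Casimir.sum as g ⟧ φ ≡ ∑ as (λ a → ⟦ q ⊛ g a ⟧ φ)
⊛-sum q as g φ = trans (⟦⊛⟧ q (Casimir.sum as g) φ) (trans
  (⟦⟧-cong q (λ u → ⟦sum⟧ as g (λ w → φ (u ⊕ w))))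
  (trans (⟦⟧-∑ q as (λ a u → ⟦ g a ⟧ (λ w → φ (u ⊕ w)))) (∑-cong as (λ a → sym (⟦⊛⟧ q (g a) φ)))))

schurCoefficient : Pol n → Vec ℕ n → ℤ
schurCoefficient {n} f l = coefficient l (vander n ⊛ f)

-- Let `h` be f minus the candidate sum. The coefficients of V h are antisymmetric, and at strict
-- exponents they vanish because each alternant has a single strict exponent; so V h vanishes, and V
-- can be cancelled. It is enough that `Λ` contain the strict exponents listed in V f, as the
-- coefficient is 0 at all others.
schur-expansion : (f : Pol (suc n)) → Symmetric f →
  ∃ λ (Λ : List (Vec ℕ (suc n))) → All Strict Λ ×
  (∀ α → coefficient α f ≡ ∑ Λ (λ l → schurCoefficient f l * coefficient α (schurPol l)))
schur-expansion {n} f sym-f = Λ , Λ-strict , λ α → ℤP.i-j≡0⇒i≡j _ _ (trans (sym (⟦h⟧ (δ α))) (h-vanishes α))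
  where
  V = vander (suc n)
  c = schurCoefficient f
  _≟V_ = VP.≡-dec {A = ℕ} {n = suc n} ℕP._≟_

  strict? : (u : Vec ℕ (suc n)) → Dec (Strict u)
  strict? u = Linked.linked? (λ x y → y ℕ.<? x) (toList u)

  exponents Λ : List (Vec ℕ (suc n))
  exponents = L.filter strict? (L.map proj₂ (V ⊛ f))
  Λ = L.deduplicate _≟V_ exponents

  Λ-strict : All Strict Λ
  Λ-strict = AllP.deduplicate⁺ _≟V_ (AllP.all-filter strict? (L.map proj₂ (V ⊛ f)))

  ∑-Λ : ∀ β → Strict β → ∑ Λ (λ l → c l * δ l β) ≡ c β
  ∑-Λ β s with DecMembership._∈?_ _≟V_ β Λ
  ... | yes β∈ = ∑-δ-inside c β Λ (UDP.deduplicate-! _≟V_ exponents) β∈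
  ... | no  β∉ = trans (∑-δ-outside c β Λ β∉) (sym (coefficient-outside β (V ⊛ f)
    (λ β∈ → β∉ (∈P.∈-deduplicate⁺ _≟V_ (∈P.∈-filter⁺ strict? β∈ s)))))

  open Casimir {suc n} using (sum)

  q h : Pol (suc n)
  q = sum Λ (λ l → constant (c l) ⊛ schurPol l)
  h = f PR.- q

  ⟦q⟧ : ∀ φ → ⟦ q ⟧ φ ≡ ∑ Λ (λ l → c l * ⟦ schurPol l ⟧ φ)
  ⟦q⟧ φ = trans (⟦sum⟧ Λ _ φ) (∑-cong Λ (λ l → ⟦constant⊛⟧ (c l) (schurPol l) φ))

  ⟦h⟧ : ∀ φ → ⟦ h ⟧ φ ≡ ⟦ f ⟧ φ - ∑ Λ (λ l → c l * ⟦ schurPol l ⟧ φ)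
  ⟦h⟧ φ = trans (⟦⊞⟧ f (negate q) φ) (cong (⟦ f ⟧ φ +_) (trans (⟦negate⟧ q φ) (cong -_ (⟦q⟧ φ))))

  ∑-cong-strict : ∀ {Λ} → All Strict Λ → {g k : Vec ℕ (suc n) → ℤ} → (∀ l → Strict l → g l ≡ k l) → ∑ Λ g ≡ ∑ Λ k
  ∑-cong-strict []       e = refl
  ∑-cong-strict (s ∷ ss) e = cong₂ _+_ (e _ s) (∑-cong-strict ss e)

  ⟦V⊛h⟧ : ∀ φ → ⟦ V ⊛ h ⟧ φ ≡ ⟦ V ⊛ f ⟧ φ - ∑ Λ (λ l → c l * altEval (suc n) (toList l) φ)
  ⟦V⊛h⟧ φ = begin
    ⟦ V ⊛ h ⟧ φ ≡⟨ ⟦⊛⟧ V h φ ⟩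
    ⟦ V ⟧ (λ u → ⟦ h ⟧ (λ w → φ (u ⊕ w)))
      ≡⟨ ⟦⟧-cong V (λ u → trans (⟦h⟧ (λ w → φ (u ⊕ w))) (cong (⟦ f ⟧ (λ w → φ (u ⊕ w)) +_)
           (sym (ℤP.-1*i≡-i (∑ Λ (λ l → c l * ⟦ schurPol l ⟧ (λ w → φ (u ⊕ w)))))))) ⟩
    ⟦ V ⟧ (λ u → ⟦ f ⟧ (λ w → φ (u ⊕ w)) + - 1ℤ * ∑ Λ (λ l → c l * ⟦ schurPol l ⟧ (λ w → φ (u ⊕ w))))
      ≡⟨ ⟦⟧-+ V (λ u → ⟦ f ⟧ (λ w → φ (u ⊕ w))) (λ u → - 1ℤ * ∑ Λ (λ l → c l * ⟦ schurPol l ⟧ (λ w → φ (u ⊕ w)))) ⟩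
    ⟦ V ⟧ (λ u → ⟦ f ⟧ (λ w → φ (u ⊕ w))) + ⟦ V ⟧ (λ u → - 1ℤ * ∑ Λ (λ l → c l * ⟦ schurPol l ⟧ (λ w → φ (u ⊕ w))))
      ≡⟨ cong₂ _+_ (sym (⟦⊛⟧ V f φ)) (trans (⟦⟧-*ˡ V (- 1ℤ) _) (trans (ℤP.-1*i≡-i _) (cong -_ inner))) ⟩
    ⟦ V ⊛ f ⟧ φ - ∑ Λ (λ l → c l * altEval (suc n) (toList l) φ) ∎
    where
    open ≡-Reasoning
    inner : ⟦ V ⟧ (λ u → ∑ Λ (λ l → c l * ⟦ schurPol l ⟧ (λ w → φ (u ⊕ w)))) ≡
            ∑ Λ (λ l → c l * altEval (suc n) (toList l) φ)
    inner = trans (⟦⟧-∑ V Λ (λ l u → c l * ⟦ schurPol l ⟧ (λ w → φ (u ⊕ w)))) (∑-cong-strict Λ-strict (λ l s →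
      trans (⟦⟧-*ˡ V (c l) _) (cong (c l *_) (trans (sym (⟦⊛⟧ V (schurPol l) φ)) (vander-schur l s φ)))))

  K : Vec ℕ (suc n) → ℤ
  K β = coefficient β (V ⊛ h)

  K-antisymmetric : ∀ i β → K (swapAt i β) ≡ - K β
  K-antisymmetric i β = begin
    ⟦ V ⊛ h ⟧ (δ (swapAt i β))   ≡⟨ ⟦⟧-cong (V ⊛ h) (δ-swap i β) ⟩
    ⟦ V ⊛ h ⟧ (δ β ∘ swapAt i)   ≡⟨ ⟦V⊛h⟧ (δ β ∘ swapAt i) ⟩
    ⟦ V ⊛ f ⟧ (δ β ∘ swapAt i) - ∑ Λ (λ l → c l * altEval (suc n) (toList l) (δ β ∘ swapAt i))
      ≡⟨ cong₂ _-_ (vander-antisymmetric f sym-f i (δ β)) (trans (∑-cong Λ (λ l → trans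
           (cong (c l *_) (altEval-swap (toList l) i (δ β))) (sym (ℤP.neg-distribʳ-* (c l) _)))) (∑-neg Λ)) ⟩
    - ⟦ V ⊛ f ⟧ (δ β) - - ∑ Λ (λ l → c l * altEval (suc n) (toList l) (δ β))
      ≡⟨ negated (⟦ V ⊛ f ⟧ (δ β)) _ ⟩
    - (⟦ V ⊛ f ⟧ (δ β) - ∑ Λ (λ l → c l * altEval (suc n) (toList l) (δ β)))
      ≡⟨ cong -_ (⟦V⊛h⟧ (δ β)) ⟨
    - K β ∎
    where
    open ≡-Reasoning
    negated : ∀ x y → - x - - y ≡ - (x - y)
    negated = solve-∀

  K-strict : ∀ β → Strict β → K β ≡ 0ℤ
  K-strict β s = trans (⟦V⊛h⟧ (δ β)) (ℤP.i≡j⇒i-j≡0 (trans (sym (∑-Λ β s))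
    (∑-cong-strict Λ-strict (λ l t → cong (c l *_) (sym (altEval-strict (suc n) l β t s))))))

  h-vanishes : Vanishing h
  h-vanishes = cancel-vandermonde (L.allFin (suc n)) (UP.allFin⁺ (suc n)) h
    (antisymmetric-zero K K-antisymmetric K-strict)

-- The action of gl_n on words

eqF : ∀ {n} → Fin n → Fin n → ℤ
eqF zero    zero    = 1ℤ
eqF zero    (suc b) = 0ℤ
eqF (suc a) zero    = 0ℤ
eqF (suc a) (suc b) = eqF a b

eqF-refl : ∀ {n} (a : Fin n) → eqF a a ≡ 1ℤ
eqF-refl zero    = refl
eqF-refl (suc a) = eqF-refl a

eqF-subst : ∀ {n} (v a : Fin n) (g : Fin n → ℤ) → eqF v a * g a ≡ eqF v a * g v
eqF-subst zero    zero    g = refl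
eqF-subst zero    (suc a) g = refl
eqF-subst (suc v) zero    g = refl
eqF-subst (suc v) (suc a) g = eqF-subst v a (g ∘ suc)

∑-eqF : ∀ {n} (a : Fin n) (g : Fin n → ℤ) → ∑ (L.allFin n) (λ v → eqF v a * g v) ≡ g a
∑-eqF {suc n} zero    g = trans (∑-allFin (λ v → eqF v zero * g v)) (trans
  (cong₂ _+_ (ℤP.*-identityˡ (g zero)) (∑-zero (L.allFin n) (λ v → refl))) (ℤP.+-identityʳ (g zero)))
∑-eqF {suc n} (suc a) g = trans (∑-allFin (λ v → eqF v (suc a) * g v))
  (trans (ℤP.+-identityˡ _) (∑-eqF a (g ∘ suc)))

marked unmarked : Bool → ℤ
marked true    = 1ℤ
marked false   = 0ℤ
unmarked true  = 0ℤ
unmarked false = 1ℤ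

count : ∀ {p} → Vec Bool p → ℕ
count []          = 0
count (true ∷ m)  = suc (count m)
count (false ∷ m) = count m

-- Words in the letters (v , y), where v is a basis vector of V = ℤⁿ and y a basis
-- vector of a second space on which matrices q a b with q a bᵀ = q b a act.  A mask
-- selects the positions whose V-factor carries a variable.
module Words (n : ℕ) (Y : Set) (ys : List Y) (q : Fin n → Fin n → Y → Y → ℤ)
             (q-transpose : ∀ a b y z → q a b y z ≡ q b a z y) where

  Letter : Set
  Letter = Fin n × Y

  letters : List Letter
  letters = L.concatMap (λ v → L.map (v ,_) ys) (L.allFin n)

  Word : ℕ → Set
  Word p = Vec Letter p

  words : ∀ p → List (Word p)
  words zero    = [] ∷ []
  words (suc p) = L.concatMap (λ k → L.map (k ∷_) (words p)) letters

  State : ℕ → Set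
  State p = Word p → ℤ

  private variable
    p : ℕ

  ∑-words : (g : State (suc p)) →
    ∑ (words (suc p)) g ≡ ∑ (L.allFin n) (λ v → ∑ ys (λ y → ∑ (words p) (λ ks → g ((v , y) ∷ ks))))
  ∑-words {p} g = trans (∑-concatMap _ letters) (trans (∑-concatMap _ (L.allFin n))
    (∑-cong (L.allFin n) (λ v → trans (∑-map _ ys) (∑-cong ys (λ y → ∑-map _ (words p))))))

  wt : Vec Bool p → Word p → Vec ℕ n
  wt []          []             = 𝟘
  wt (true ∷ m)  ((v , y) ∷ ks) = inc v (wt m ks)
  wt (false ∷ m) (k ∷ ks)       = wt m ks

  -- The elementary matrix a b acting on the marked V-factors, …
  E : Vec Bool p → Fin n → Fin n → State p → State p
  E []      a b ω []             = 0ℤ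
  E (x ∷ m) a b ω ((v , y) ∷ ks) =
    marked x * (eqF v a * ω ((b , y) ∷ ks)) + E m a b (λ r → ω ((v , y) ∷ r)) ks

  -- … on all the other factors, …
  F : Vec Bool p → Fin n → Fin n → State p → State p
  F []      a b ω []             = 0ℤ
  F (x ∷ m) a b ω ((v , y) ∷ ks) =
    unmarked x * (eqF v a * ω ((b , y) ∷ ks)) +
    (∑ ys (λ z → q a b y z * ω ((v , z) ∷ ks)) + F m a b (λ r → ω ((v , y) ∷ r)) ks)

  -- … and on all factors.
  T : Fin n → Fin n → State p → State p
  T a b ω []             = 0ℤ
  T a b ω ((v , y) ∷ ks) =
    (eqF v a * ω ((b , y) ∷ ks) + ∑ ys (λ z → q a b y z * ω ((v , z) ∷ ks))) + T a b (λ r → ω ((v , y) ∷ r)) ks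

  E+F : (m : Vec Bool p) → ∀ a b ω ks → E m a b ω ks + F m a b ω ks ≡ T a b ω ks
  E+F []      a b ω []             = refl
  E+F (x ∷ m) a b ω ((v , y) ∷ ks) = trans
    (regroup (marked x) (unmarked x) (eqF v a * ω ((b , y) ∷ ks)) (E m a b (λ r → ω ((v , y) ∷ r)) ks)
      (∑ ys (λ z → q a b y z * ω ((v , z) ∷ ks))) (F m a b (λ r → ω ((v , y) ∷ r)) ks))
    (cong₂ (λ s t → (s * (eqF v a * ω ((b , y) ∷ ks)) + ∑ ys (λ z → q a b y z * ω ((v , z) ∷ ks))) + t)
      (partition x) (E+F m a b (λ r → ω ((v , y) ∷ r)) ks)
     ∙ cong (λ s → (s + ∑ ys (λ z → q a b y z * ω ((v , z) ∷ ks))) + T a b (λ r → ω ((v , y) ∷ r)) ks)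
         (ℤP.*-identityˡ (eqF v a * ω ((b , y) ∷ ks))))
    where
    _∙_ : {A : Set} {x y z : A} → x ≡ y → y ≡ z → x ≡ z
    _∙_ = trans
    regroup : ∀ h k e r s t → (h * e + r) + (k * e + (s + t)) ≡ ((h + k) * e + s) + (r + t)
    regroup = solve-∀
    partition : ∀ x → marked x + unmarked x ≡ 1ℤ
    partition true  = refl
    partition false = refl

  E-cong : (m : Vec Bool p) → ∀ a b {ω η : State p} → (∀ ks → ω ks ≡ η ks) → ∀ ks → E m a b ω ks ≡ E m a b η ks
  E-cong []      a b e []             = refl
  E-cong (x ∷ m) a b e ((v , y) ∷ ks) = cong₂ (λ s t → marked x * (eqF v a * s) + t)
    (e ((b , y) ∷ ks)) (E-cong m a b (λ r → e ((v , y) ∷ r)) ks)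

  E-linear : (m : Vec Bool p) → ∀ a b k l (ω η : State p) ks →
    E m a b (λ r → k * ω r + l * η r) ks ≡ k * E m a b ω ks + l * E m a b η ks
  E-linear []      a b k l ω η []             = sym (zeros k l)
    where
    zeros : ∀ k l → k * 0ℤ + l * 0ℤ ≡ 0ℤ
    zeros = solve-∀
  E-linear (x ∷ m) a b k l ω η ((v , y) ∷ ks) = trans
    (cong (marked x * (eqF v a * (k * ω ((b , y) ∷ ks) + l * η ((b , y) ∷ ks))) +_)
      (E-linear m a b k l (λ r → ω ((v , y) ∷ r)) (λ r → η ((v , y) ∷ r)) ks))
    (expand (marked x) (eqF v a) k l (ω ((b , y) ∷ ks)) (η ((b , y) ∷ ks)) _ _)
    where
    expand : ∀ h e k l s t u w → h * (e * (k * s + l * t)) + (k * u + l * w) ≡ k * (h * (e * s) + u) + l * (h * (e * t) + w)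
    expand = solve-∀

  E-+ : (m : Vec Bool p) → ∀ a b (ω η : State p) ks → E m a b (λ r → ω r + η r) ks ≡ E m a b ω ks + E m a b η ks
  E-+ m a b ω η ks = trans (E-cong m a b (λ r → sym (units (ω r) (η r))) ks)
    (trans (E-linear m a b 1ℤ 1ℤ ω η ks) (units (E m a b ω ks) (E m a b η ks)))
    where
    units : ∀ x y → 1ℤ * x + 1ℤ * y ≡ x + y
    units = solve-∀

  E-zero : (m : Vec Bool p) → ∀ a b {ω : State p} → (∀ ks → ω ks ≡ 0ℤ) → ∀ ks → E m a b ω ks ≡ 0ℤ
  E-zero m a b {ω} e ks = trans (E-cong m a b (λ r → trans (e r) (sym (zeros (ω r)))) ks)
    (trans (E-linear m a b 0ℤ 0ℤ ω ω ks) (zeros (E m a b ω ks)))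
    where
    zeros : ∀ x → 0ℤ * x + 0ℤ * x ≡ 0ℤ
    zeros = solve-∀

  E-*ˡ : (m : Vec Bool p) → ∀ a b k (ω : State p) ks → E m a b (λ r → k * ω r) ks ≡ k * E m a b ω ks
  E-*ˡ m a b k ω ks = trans (E-cong m a b (λ r → sym (one k (ω r))) ks)
    (trans (E-linear m a b k 0ℤ ω ω ks) (one k (E m a b ω ks)))
    where
    one : ∀ k x → k * x + 0ℤ * x ≡ k * x
    one = solve-∀

  E-∑ : {A : Set} (m : Vec Bool p) → ∀ a b (as : List A) (ω : A → State p) ks →
    E m a b (λ r → ∑ as (λ i → ω i r)) ks ≡ ∑ as (λ i → E m a b (ω i) ks)
  E-∑ m a b []       ω ks = E-zero m a b (λ _ → refl) ks
  E-∑ m a b (i ∷ as) ω ks = trans (E-+ m a b (ω i) (λ r → ∑ as (λ i → ω i r)) ks)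
    (cong (E m a b (ω i) ks +_) (E-∑ m a b as ω ks))

  F-cong : (m : Vec Bool p) → ∀ a b {ω η : State p} → (∀ ks → ω ks ≡ η ks) → ∀ ks → F m a b ω ks ≡ F m a b η ks
  F-cong []      a b e []             = refl
  F-cong (x ∷ m) a b e ((v , y) ∷ ks) = cong₂ _+_ (cong (λ s → unmarked x * (eqF v a * s)) (e ((b , y) ∷ ks)))
    (cong₂ _+_ (∑-cong ys (λ z → cong (q a b y z *_) (e ((v , z) ∷ ks)))) (F-cong m a b (λ r → e ((v , y) ∷ r)) ks))

  F-linear : (m : Vec Bool p) → ∀ a b k (ω η : State p) ks →
    F m a b (λ r → k * ω r + η r) ks ≡ k * F m a b ω ks + F m a b η ks
  F-linear []      a b k ω η []             = sym (trans (ℤP.+-identityʳ _) (ℤP.*-zeroʳ k))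
  F-linear (x ∷ m) a b k ω η ((v , y) ∷ ks) = trans
    (cong (unmarked x * (eqF v a * (k * ω ((b , y) ∷ ks) + η ((b , y) ∷ ks))) +_) (cong₂ _+_
      (trans (∑-cong ys (λ z → split (q a b y z) k (ω ((v , z) ∷ ks)) (η ((v , z) ∷ ks))))
        (trans (∑-+ ys) (cong (_+ ∑ ys (λ z → q a b y z * η ((v , z) ∷ ks))) (∑-*ˡ ys k))))
      (F-linear m a b k (λ r → ω ((v , y) ∷ r)) (λ r → η ((v , y) ∷ r)) ks)))
    (expand (unmarked x) (eqF v a) k (ω ((b , y) ∷ ks)) (η ((b , y) ∷ ks)) _ _ _ _)
    where
    split : ∀ q k s t → q * (k * s + t) ≡ k * (q * s) + q * t
    split = solve-∀
    expand : ∀ h e k s t u u′ w w′ → h * (e * (k * s + t)) + ((k * u + u′) + (k * w + w′)) ≡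
      k * (h * (e * s) + (u + w)) + (h * (e * t) + (u′ + w′))
    expand = solve-∀

  -- The relation of matrix units, position by position: contributions of two different positions
  -- cancel, and at a single position the mask enters squared, where it is idempotent.
  commutator : (m : Vec Bool p) → ∀ a b c d (ω : State p) ks →
    E m a b (E m c d ω) ks - E m c d (E m a b ω) ks ≡ eqF b c * E m a d ω ks - eqF d a * E m c b ω ks
  commutator []      a b c d ω []             = sym (zeros (eqF b c) (eqF d a))
    where
    zeros : ∀ k l → k * 0ℤ - l * 0ℤ ≡ 0ℤ
    zeros = solve-∀
  commutator (x ∷ m) a b c d ω ((v , y) ∷ ks) = trans
    (cong₂ (λ s t → (h * (eqF v a * (h * (eqF b c * ω ((d , y) ∷ ks)) + E m c d (slot b) ks)) + s)
                  - (h * (eqF v c * (h * (eqF d a * ω ((b , y) ∷ ks)) + E m a b (slot d) ks)) + t))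
      (inner a b c d) (inner c d a b))
    (trans (regroup h (eqF v a) (eqF v c) (eqF b c) (eqF d a) (ω ((d , y) ∷ ks)) (ω ((b , y) ∷ ks))
             (E m c d (slot b) ks) (E m a b (slot d) ks)
             (E m a b (E m c d (slot v)) ks) (E m c d (E m a b (slot v)) ks))
      (trans (cong₂ (λ s t → s * (eqF b c * (eqF v a * ω ((d , y) ∷ ks)) - eqF d a * (eqF v c * ω ((b , y) ∷ ks))) + t)
               (idempotent x) (commutator m a b c d (slot v) ks))
        (collect h (eqF b c) (eqF d a) (eqF v a * ω ((d , y) ∷ ks)) (eqF v c * ω ((b , y) ∷ ks))
          (E m a d (slot v) ks) (E m c b (slot v) ks))))
    where
    h = marked x
    slot : Fin n → State _
    slot b r = ω ((b , y) ∷ r)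
    idempotent : ∀ x → marked x * marked x ≡ marked x
    idempotent true  = refl
    idempotent false = refl
    inner : ∀ a b c d → E m a b (λ r → h * (eqF v c * slot d r) + E m c d (slot v) r) ks ≡
      h * (eqF v c * E m a b (slot d) ks) + E m a b (E m c d (slot v)) ks
    inner a b c d = trans (E-+ m a b (λ r → h * (eqF v c * slot d r)) (E m c d (slot v)) ks)
      (cong (_+ E m a b (E m c d (slot v)) ks)
        (trans (E-*ˡ m a b h (λ r → eqF v c * slot d r) ks) (cong (h *_) (E-*ˡ m a b (eqF v c) (slot d) ks))))
    regroup : ∀ h va vc bc da d b B D X X′ →
      (h * (va * (h * (bc * d) + B)) + (h * (vc * D) + X)) - (h * (vc * (h * (da * b) + D)) + (h * (va * B) + X′)) ≡
      (h * h) * (bc * (va * d) - da * (vc * b)) + (X - X′)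
    regroup = solve-∀
    collect : ∀ h k l s t u w → h * (k * s - l * t) + (k * u - l * w) ≡ k * (h * s + u) - l * (h * t + w)
    collect = solve-∀

  -- The operators act on disjoint tensor factors. At one position they could meet only in the first
  -- component of the letter, and there the product of `marked` and `unmarked` is 0.
  E-F-commute : (m : Vec Bool p) → ∀ a b c d (ω : State p) ks → E m a b (F m c d ω) ks ≡ F m c d (E m a b ω) ks
  E-F-commute []      a b c d ω []             = refl
  E-F-commute (x ∷ m) a b c d ω ((v , y) ∷ ks) = begin
    h * (eqF v a * (k * (eqF b c * ω ((d , y) ∷ ks)) + (Q b ks + F m c d (slot b) ks)))
      + E m a b (λ r → k * (eqF v c * slot d r) + (Q v r + F m c d (slot v) r)) ks
      ≡⟨ cong (h * (eqF v a * (k * (eqF b c * ω ((d , y) ∷ ks)) + (Q b ks + F m c d (slot b) ks))) +_) inner ⟩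
    h * (eqF v a * (k * (eqF b c * ω ((d , y) ∷ ks)) + (Q b ks + F m c d (slot b) ks)))
      + (k * (eqF v c * E m a b (slot d) ks)
         + (∑ ys (λ z → q c d y z * E m a b (λ r → ω ((v , z) ∷ r)) ks) + F m c d (E m a b (slot v)) ks))
      ≡⟨ regroup h k (eqF v a) (eqF v c) (eqF b c) (ω ((d , y) ∷ ks)) (eqF d a) (ω ((b , y) ∷ ks)) (Q b ks) (F m c d (slot b) ks) (E m a b (slot d) ks) _ _ (exclusive x) ⟩
    k * (eqF v c * (h * (eqF d a * ω ((b , y) ∷ ks)) + E m a b (slot d) ks))
      + ((h * (eqF v a * Q b ks) + ∑ ys (λ z → q c d y z * E m a b (λ r → ω ((v , z) ∷ r)) ks))
         + (h * (eqF v a * F m c d (slot b) ks) + F m c d (E m a b (slot v)) ks))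
      ≡⟨ cong₂ (λ s t → k * (eqF v c * (h * (eqF d a * ω ((b , y) ∷ ks)) + E m a b (slot d) ks)) + (s + t)) outerQ outerF ⟨
    k * (eqF v c * (h * (eqF d a * ω ((b , y) ∷ ks)) + E m a b (slot d) ks))
      + (∑ ys (λ z → q c d y z * (h * (eqF v a * ω ((b , z) ∷ ks)) + E m a b (λ r → ω ((v , z) ∷ r)) ks))
         + F m c d (λ r → h * (eqF v a * slot b r) + E m a b (slot v) r) ks) ∎
    where
    open ≡-Reasoning
    h = marked x
    k = unmarked x
    slot : Fin n → State _
    slot b r = ω ((b , y) ∷ r)
    Q : Fin n → State _
    Q w r = ∑ ys (λ z → q c d y z * ω ((w , z) ∷ r))
    exclusive : ∀ x → marked x * unmarked x ≡ 0ℤ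
    exclusive true  = refl
    exclusive false = refl
    inner : E m a b (λ r → k * (eqF v c * slot d r) + (Q v r + F m c d (slot v) r)) ks ≡
      k * (eqF v c * E m a b (slot d) ks)
        + (∑ ys (λ z → q c d y z * E m a b (λ r → ω ((v , z) ∷ r)) ks) + F m c d (E m a b (slot v)) ks)
    inner = trans (E-+ m a b (λ r → k * (eqF v c * slot d r)) (λ r → Q v r + F m c d (slot v) r) ks) (cong₂ _+_
      (trans (E-*ˡ m a b k (λ r → eqF v c * slot d r) ks) (cong (k *_) (E-*ˡ m a b (eqF v c) (slot d) ks)))
      (trans (E-+ m a b (Q v) (F m c d (slot v)) ks) (cong₂ _+_
        (trans (E-∑ m a b ys (λ z r → q c d y z * ω ((v , z) ∷ r)) ks)
               (∑-cong ys (λ z → E-*ˡ m a b (q c d y z) (λ r → ω ((v , z) ∷ r)) ks)))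
        (E-F-commute m a b c d (slot v) ks))))
    outerQ : ∑ ys (λ z → q c d y z * (h * (eqF v a * ω ((b , z) ∷ ks)) + E m a b (λ r → ω ((v , z) ∷ r)) ks)) ≡
      h * (eqF v a * Q b ks) + ∑ ys (λ z → q c d y z * E m a b (λ r → ω ((v , z) ∷ r)) ks)
    outerQ = trans (∑-cong ys (λ z → move (q c d y z) h (eqF v a) (ω ((b , z) ∷ ks)) (E m a b (λ r → ω ((v , z) ∷ r)) ks)))
      (trans (∑-+ ys) (cong (_+ ∑ ys (λ z → q c d y z * E m a b (λ r → ω ((v , z) ∷ r)) ks))
        (trans (∑-*ˡ ys h) (cong (h *_) (∑-*ˡ ys (eqF v a))))))
      where
      move : ∀ q h e s t → q * (h * (e * s) + t) ≡ h * (e * (q * s)) + q * t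
      move = solve-∀
    outerF : F m c d (λ r → h * (eqF v a * slot b r) + E m a b (slot v) r) ks ≡
      h * (eqF v a * F m c d (slot b) ks) + F m c d (E m a b (slot v)) ks
    outerF = trans (F-cong m c d (λ r → cong (_+ E m a b (slot v) r) (sym (ℤP.*-assoc h (eqF v a) (slot b r)))) ks)
      (trans (F-linear m c d (h * eqF v a) (slot b) (E m a b (slot v)) ks)
        (cong (_+ F m c d (E m a b (slot v)) ks) (ℤP.*-assoc h (eqF v a) _)))
    regroup : ∀ h k va vc bc od da ob Qb Fb Ed S X → h * k ≡ 0ℤ →
      h * (va * (k * (bc * od) + (Qb + Fb))) + (k * (vc * Ed) + (S + X)) ≡
      k * (vc * (h * (da * ob) + Ed)) + ((h * (va * Qb) + S) + (h * (va * Fb) + X))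
    regroup h k va vc bc od da ob Qb Fb Ed S X z = trans
      (left h k va vc bc od Qb Fb Ed S X) (trans (cong (λ s → s * (va * (bc * od)) + R) z)
        (trans (cong (λ s → s * (vc * (da * ob)) + R) (sym z)) (sym (right h k va vc da ob Qb Fb Ed S X))))
      where
      R = k * (vc * Ed) + ((h * (va * Qb) + S) + (h * (va * Fb) + X))
      left : ∀ h k va vc bc od Qb Fb Ed S X →
        h * (va * (k * (bc * od) + (Qb + Fb))) + (k * (vc * Ed) + (S + X)) ≡
        (h * k) * (va * (bc * od)) + (k * (vc * Ed) + ((h * (va * Qb) + S) + (h * (va * Fb) + X)))
      left = solve-∀
      right : ∀ h k va vc da ob Qb Fb Ed S X →
        k * (vc * (h * (da * ob) + Ed)) + ((h * (va * Qb) + S) + (h * (va * Fb) + X)) ≡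
        (h * k) * (vc * (da * ob)) + (k * (vc * Ed) + ((h * (va * Qb) + S) + (h * (va * Fb) + X)))
      right = solve-∀

-- Weighted bilinear forms, adjoints and invariance

module Forms (n : ℕ) (Y : Set) (ys : List Y) (q : Fin n → Fin n → Y → Y → ℤ)
             (q-transpose : ∀ a b y z → q a b y z ≡ q b a z y) where
  open Words n Y ys q q-transpose public

  private variable
    p : ℕ

  pairing : Vec Bool p → State p → State p → Test n → ℤ
  pairing {p} m ω η φ = ∑ (words p) (λ ks → ω ks * η ks * φ (wt m ks))

  pairing-test : (m : Vec Bool p) (ω η : State p) {φ ψ : Test n} → (∀ u → φ u ≡ ψ u) → pairing m ω η φ ≡ pairing m ω η ψ
  pairing-test {p} m ω η e = ∑-cong (words p) (λ ks → cong (ω ks * η ks *_) (e (wt m ks)))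

  pairing-congʳ : (m : Vec Bool p) (ω : State p) {η η′ : State p} (φ : Test n) → (∀ ks → η ks ≡ η′ ks) →
    pairing m ω η φ ≡ pairing m ω η′ φ
  pairing-congʳ {p} m ω φ e = ∑-cong (words p) (λ ks → cong (λ s → ω ks * s * φ (wt m ks)) (e ks))

  pairing-comm : (m : Vec Bool p) (ω η : State p) (φ : Test n) → pairing m ω η φ ≡ pairing m η ω φ
  pairing-comm {p} m ω η φ = ∑-cong (words p) (λ ks → cong (_* φ (wt m ks)) (ℤP.*-comm (ω ks) (η ks)))

  pairing-linear : (m : Vec Bool p) (ω η ζ : State p) (k : ℤ) (φ : Test n) →
    pairing m ω (λ ks → η ks + k * ζ ks) φ ≡ pairing m ω η φ + k * pairing m ω ζ φ
  pairing-linear {p} m ω η ζ k φ = trans (∑-cong (words p) (λ ks → expand (ω ks) (η ks) k (ζ ks) (φ (wt m ks))))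
    (trans (∑-+ (words p)) (cong (pairing m ω η φ +_) (∑-*ˡ (words p) k)))
    where
    expand : ∀ a b k c d → a * (b + k * c) * d ≡ a * b * d + k * (a * c * d)
    expand = solve-∀

  pairing-∑ : {A : Set} (m : Vec Bool p) (ω : State p) (as : List A) (η : A → State p) (φ : Test n) →
    pairing m ω (λ ks → ∑ as (λ i → η i ks)) φ ≡ ∑ as (λ i → pairing m ω (η i) φ)
  pairing-∑ {p} m ω as η φ = trans (∑-cong (words p) (λ ks → trans
      (cong (_* φ (wt m ks)) (sym (∑-*ˡ as (ω ks)))) (sym (∑-*ʳ as (φ (wt m ks))))))
    (∑-swap (words p) as)

  ∑-separate : {G : Fin n → Y → Word p → ℤ} (e : Fin n → ℤ) (H K : Fin n → Y → Word p → ℤ) →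
    (∀ v y ks → G v y ks ≡ e v * H v y ks + K v y ks) →
    ∑ (L.allFin n) (λ v → ∑ ys (λ y → ∑ (words p) (G v y))) ≡
    ∑ (L.allFin n) (λ v → e v * ∑ ys (λ y → ∑ (words p) (H v y))) + ∑ (L.allFin n) (λ v → ∑ ys (λ y → ∑ (words p) (K v y)))
  ∑-separate {p} e H K eq = trans (∑-cong (L.allFin n) (λ v → trans
    (∑-cong ys (λ y → trans (∑-cong (words p) (eq v y)) (trans (∑-+ (words p))
      (cong (_+ ∑ (words p) (K v y)) (∑-*ˡ (words p) (e v))))))
    (trans (∑-+ ys) (cong (_+ ∑ ys (λ y → ∑ (words p) (K v y))) (∑-*ˡ ys (e v)))))) (∑-+ (L.allFin n))

  -- A matrix unit links a word with a at a marked position to the word with b there, and the two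
  -- sides read the weight off different ones of these words. The extra `inc b` and `inc a` supply
  -- the missing variable, so both sides carry x_a x_b.
  adjoint-E : (m : Vec Bool p) → ∀ a b (ω η : State p) (φ : Test n) →
    pairing m ω (E m a b η) (φ ∘ inc b) ≡ pairing m (E m b a ω) η (φ ∘ inc a)
  adjoint-E []          a b ω η φ = cong (_+ 0ℤ) (trans (cong (_* φ (inc b 𝟘)) (ℤP.*-zeroʳ (ω []))) refl)
  adjoint-E {suc p} (false ∷ m) a b ω η φ = trans (∑-words {p} _) (trans
    (∑-cong (L.allFin n) (λ v → ∑-cong ys (λ y → trans
      (∑-cong (words p) (λ ks → cong (λ s → ω ((v , y) ∷ ks) * s * φ (inc b (wt m ks))) (ℤP.+-identityˡ (E m a b (λ r → η ((v , y) ∷ r)) ks))))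
      (trans (adjoint-E m a b (λ r → ω ((v , y) ∷ r)) (λ r → η ((v , y) ∷ r)) φ)
        (∑-cong (words p) (λ ks → cong (λ s → s * η ((v , y) ∷ ks) * φ (inc a (wt m ks))) (sym (ℤP.+-identityˡ (E m b a (λ r → ω ((v , y) ∷ r)) ks)))))))))
    (sym (∑-words {p} _)))
  adjoint-E {suc p} (true ∷ m) a b ω η φ = begin
    pairing (true ∷ m) ω (E (true ∷ m) a b η) (φ ∘ inc b)
      ≡⟨ ∑-words {p} _ ⟩
    ∑ (L.allFin n) (λ v → ∑ ys (λ y → ∑ (words p) (λ ks → ω ((v , y) ∷ ks) *
      (1ℤ * (eqF v a * η ((b , y) ∷ ks)) + E m a b (λ r → η ((v , y) ∷ r)) ks) * φ (inc b (inc v (wt m ks))))))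
      ≡⟨ ∑-separate (λ v → eqF v a) (λ v y ks → ω ((v , y) ∷ ks) * η ((b , y) ∷ ks) * φ (inc b (inc v (wt m ks))))
           (λ v y ks → ω ((v , y) ∷ ks) * E m a b (λ r → η ((v , y) ∷ r)) ks * φ (inc b (inc v (wt m ks))))
           (λ v y ks → expandˡ (ω ((v , y) ∷ ks)) (eqF v a) (η ((b , y) ∷ ks))
                   (E m a b (λ r → η ((v , y) ∷ r)) ks) (φ (inc b (inc v (wt m ks))))) ⟩
    ∑ (L.allFin n) (λ v → eqF v a * X v) + ∑ (L.allFin n) (λ v → ∑ ys (λ y →
      pairing m (λ r → ω ((v , y) ∷ r)) (E m a b (λ r → η ((v , y) ∷ r))) (φ ∘ inc b ∘ inc v)))
      ≡⟨ cong₂ _+_ (trans (∑-eqF a X) (trans exchanged (sym (∑-eqF b X′)))) (∑-cong (L.allFin n) (λ v → ∑-cong ys (λ y → tail v y))) ⟩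
    ∑ (L.allFin n) (λ v → eqF v b * X′ v) + ∑ (L.allFin n) (λ v → ∑ ys (λ y →
      pairing m (E m b a (λ r → ω ((v , y) ∷ r))) (λ r → η ((v , y) ∷ r)) (φ ∘ inc a ∘ inc v)))
      ≡⟨ ∑-separate (λ v → eqF v b) (λ v y ks → ω ((a , y) ∷ ks) * η ((v , y) ∷ ks) * φ (inc a (inc v (wt m ks))))
           (λ v y ks → E m b a (λ r → ω ((v , y) ∷ r)) ks * η ((v , y) ∷ ks) * φ (inc a (inc v (wt m ks))))
           (λ v y ks → expandʳ (ω ((a , y) ∷ ks)) (eqF v b) (η ((v , y) ∷ ks))
                   (E m b a (λ r → ω ((v , y) ∷ r)) ks) (φ (inc a (inc v (wt m ks))))) ⟨
    ∑ (L.allFin n) (λ v → ∑ ys (λ y → ∑ (words p) (λ ks →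
      (1ℤ * (eqF v b * ω ((a , y) ∷ ks)) + E m b a (λ r → ω ((v , y) ∷ r)) ks) * η ((v , y) ∷ ks) * φ (inc a (inc v (wt m ks))))))
      ≡⟨ ∑-words {p} _ ⟨
    pairing (true ∷ m) (E (true ∷ m) b a ω) η (φ ∘ inc a) ∎
    where
    open ≡-Reasoning
    X X′ : Fin n → ℤ
    X v = ∑ ys (λ y → ∑ (words p) (λ ks → ω ((v , y) ∷ ks) * η ((b , y) ∷ ks) * φ (inc b (inc v (wt m ks)))))
    X′ v = ∑ ys (λ y → ∑ (words p) (λ ks → ω ((a , y) ∷ ks) * η ((v , y) ∷ ks) * φ (inc a (inc v (wt m ks)))))
    exchanged : X a ≡ X′ b
    exchanged = ∑-cong ys (λ y → ∑-cong (words p) (λ ks →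
      cong (λ u → ω ((a , y) ∷ ks) * η ((b , y) ∷ ks) * φ u) (inc-comm b a (wt m ks))))
    tail : ∀ v y → pairing m (λ r → ω ((v , y) ∷ r)) (E m a b (λ r → η ((v , y) ∷ r))) (φ ∘ inc b ∘ inc v) ≡
                   pairing m (E m b a (λ r → ω ((v , y) ∷ r))) (λ r → η ((v , y) ∷ r)) (φ ∘ inc a ∘ inc v)
    tail v y = trans (pairing-test m (λ r → ω ((v , y) ∷ r)) (E m a b (λ r → η ((v , y) ∷ r))) (λ u → cong φ (inc-comm b v u)))
      (trans (adjoint-E m a b (λ r → ω ((v , y) ∷ r)) (λ r → η ((v , y) ∷ r)) (φ ∘ inc v))
        (pairing-test m (E m b a (λ r → ω ((v , y) ∷ r))) (λ r → η ((v , y) ∷ r)) (λ u → cong φ (inc-comm v a u))))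
    expandˡ : ∀ o e h t f → o * (1ℤ * (e * h) + t) * f ≡ e * (o * h * f) + o * t * f
    expandˡ = solve-∀
    expandʳ : ∀ o e h t f → (1ℤ * (e * o) + t) * h * f ≡ e * (o * h * f) + t * h * f
    expandʳ = solve-∀

  private
    put : Bool → Fin n → Vec ℕ n → Vec ℕ n
    put true  v u = inc v u
    put false v u = u

    wt-∷ : ∀ x (m : Vec Bool p) v y ks → wt (x ∷ m) ((v , y) ∷ ks) ≡ put x v (wt m ks)
    wt-∷ true  m v y ks = refl
    wt-∷ false m v y ks = refl

    put-unmarked : ∀ x v w u (φ : Test n) → unmarked x * φ (put x v u) ≡ unmarked x * φ (put x w u)
    put-unmarked true  v w u φ = refl
    put-unmarked false v w u φ = refl

  -- No variable has to be compensated here: the first component of an unmarked letter does not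
  -- enter the weight, and the second component never does. On the latter, adjointness is the
  -- transposition rule for `q`.
  adjoint-F : (m : Vec Bool p) → ∀ a b (ω η : State p) (φ : Test n) →
    pairing m ω (F m a b η) φ ≡ pairing m (F m b a ω) η φ
  adjoint-F []              a b ω η φ = cong (_+ 0ℤ) (cong (_* φ 𝟘) (ℤP.*-zeroʳ (ω [])))
  adjoint-F {suc p} (x ∷ m) a b ω η φ = begin
    pairing (x ∷ m) ω (F (x ∷ m) a b η) φ
      ≡⟨ ∑-words {p} _ ⟩
    ∑ (L.allFin n) (λ v → ∑ ys (λ y → ∑ (words p) (λ ks → ω ((v , y) ∷ ks) *
      (k * (eqF v a * η ((b , y) ∷ ks)) + (∑ ys (λ z → q a b y z * η ((v , z) ∷ ks)) + F m a b (λ r → η ((v , y) ∷ r)) ks))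
      * φ (wt (x ∷ m) ((v , y) ∷ ks)))))
      ≡⟨ ∑-separate (λ v → eqF v a) Hˡ Kˡ (λ v y ks → trans
           (cong (λ u → ω ((v , y) ∷ ks) * (k * (eqF v a * η ((b , y) ∷ ks)) + (∑ ys (λ z → q a b y z * η ((v , z) ∷ ks))
                   + F m a b (λ r → η ((v , y) ∷ r)) ks)) * φ u) (wt-∷ x m v y ks))
           (expandˡ (ω ((v , y) ∷ ks)) k (eqF v a) (η ((b , y) ∷ ks)) (∑ ys (λ z → q a b y z * η ((v , z) ∷ ks)))
             (F m a b (λ r → η ((v , y) ∷ r)) ks) (φ (put x v (wt m ks))))) ⟩
    ∑ (L.allFin n) (λ v → eqF v a * ∑ ys (λ y → ∑ (words p) (Hˡ v y))) + ∑ (L.allFin n) (λ v → ∑ ys (λ y → ∑ (words p) (Kˡ v y)))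
      ≡⟨ cong₂ _+_ (trans (∑-eqF a (λ v → ∑ ys (λ y → ∑ (words p) (Hˡ v y)))) (trans exchanged
           (sym (∑-eqF b (λ v → ∑ ys (λ y → ∑ (words p) (Hʳ v y))))))) (∑-cong (L.allFin n) tails) ⟩
    ∑ (L.allFin n) (λ v → eqF v b * ∑ ys (λ y → ∑ (words p) (Hʳ v y))) + ∑ (L.allFin n) (λ v → ∑ ys (λ y → ∑ (words p) (Kʳ v y)))
      ≡⟨ ∑-separate (λ v → eqF v b) Hʳ Kʳ (λ v y ks → trans
           (cong (λ u → (k * (eqF v b * ω ((a , y) ∷ ks)) + (∑ ys (λ z → q b a y z * ω ((v , z) ∷ ks))
                   + F m b a (λ r → ω ((v , y) ∷ r)) ks)) * η ((v , y) ∷ ks) * φ u) (wt-∷ x m v y ks))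
           (expandʳ (ω ((a , y) ∷ ks)) k (eqF v b) (η ((v , y) ∷ ks)) (∑ ys (λ z → q b a y z * ω ((v , z) ∷ ks)))
             (F m b a (λ r → ω ((v , y) ∷ r)) ks) (φ (put x v (wt m ks))))) ⟨
    ∑ (L.allFin n) (λ v → ∑ ys (λ y → ∑ (words p) (λ ks →
      (k * (eqF v b * ω ((a , y) ∷ ks)) + (∑ ys (λ z → q b a y z * ω ((v , z) ∷ ks)) + F m b a (λ r → ω ((v , y) ∷ r)) ks))
      * η ((v , y) ∷ ks) * φ (wt (x ∷ m) ((v , y) ∷ ks)))))
      ≡⟨ ∑-words {p} _ ⟨
    pairing (x ∷ m) (F (x ∷ m) b a ω) η φ ∎
    where
    open ≡-Reasoning
    k = unmarked x
    Hˡ Hʳ Kˡ Kʳ : Fin n → Y → Word p → ℤ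
    Hˡ v y ks = ω ((v , y) ∷ ks) * η ((b , y) ∷ ks) * (k * φ (put x v (wt m ks)))
    Hʳ v y ks = ω ((a , y) ∷ ks) * η ((v , y) ∷ ks) * (k * φ (put x v (wt m ks)))
    Kˡ v y ks = ω ((v , y) ∷ ks) * ∑ ys (λ z → q a b y z * η ((v , z) ∷ ks)) * φ (put x v (wt m ks))
              + ω ((v , y) ∷ ks) * F m a b (λ r → η ((v , y) ∷ r)) ks * φ (put x v (wt m ks))
    Kʳ v y ks = ∑ ys (λ z → q b a y z * ω ((v , z) ∷ ks)) * η ((v , y) ∷ ks) * φ (put x v (wt m ks))
              + F m b a (λ r → ω ((v , y) ∷ r)) ks * η ((v , y) ∷ ks) * φ (put x v (wt m ks))
    expandˡ : ∀ o k e h s t f → o * (k * (e * h) + (s + t)) * f ≡ e * (o * h * (k * f)) + (o * s * f + o * t * f)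
    expandˡ = solve-∀
    expandʳ : ∀ o k e h s t f → (k * (e * o) + (s + t)) * h * f ≡ e * (o * h * (k * f)) + (s * h * f + t * h * f)
    expandʳ = solve-∀
    exchanged : ∑ ys (λ y → ∑ (words p) (Hˡ a y)) ≡ ∑ ys (λ y → ∑ (words p) (Hʳ b y))
    exchanged = ∑-cong ys (λ y → ∑-cong (words p) (λ ks →
      cong (ω ((a , y) ∷ ks) * η ((b , y) ∷ ks) *_) (put-unmarked x a b (wt m ks) φ)))
    transposed : ∀ v ks f →
      ∑ ys (λ y → ω ((v , y) ∷ ks) * ∑ ys (λ z → q a b y z * η ((v , z) ∷ ks)) * f) ≡
      ∑ ys (λ y → ∑ ys (λ z → q b a y z * ω ((v , z) ∷ ks)) * η ((v , y) ∷ ks) * f)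
    transposed v ks f = begin
      ∑ ys (λ y → ω ((v , y) ∷ ks) * ∑ ys (λ z → q a b y z * η ((v , z) ∷ ks)) * f)
        ≡⟨ ∑-cong ys (λ y → trans (cong (_* f) (sym (∑-*ˡ ys (ω ((v , y) ∷ ks))))) (sym (∑-*ʳ ys f))) ⟩
      ∑ ys (λ y → ∑ ys (λ z → ω ((v , y) ∷ ks) * (q a b y z * η ((v , z) ∷ ks)) * f))
        ≡⟨ ∑-swap ys ys ⟩
      ∑ ys (λ z → ∑ ys (λ y → ω ((v , y) ∷ ks) * (q a b y z * η ((v , z) ∷ ks)) * f))
        ≡⟨ ∑-cong ys (λ z → ∑-cong ys (λ y → trans
             (cong (λ s → ω ((v , y) ∷ ks) * (s * η ((v , z) ∷ ks)) * f) (q-transpose a b y z))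
             (move (ω ((v , y) ∷ ks)) (q b a z y) (η ((v , z) ∷ ks)) f))) ⟩
      ∑ ys (λ z → ∑ ys (λ y → q b a z y * ω ((v , y) ∷ ks) * η ((v , z) ∷ ks) * f))
        ≡⟨ ∑-cong ys (λ z → trans (∑-*ʳ ys f) (cong (_* f) (∑-*ʳ ys (η ((v , z) ∷ ks))))) ⟩
      ∑ ys (λ y → ∑ ys (λ z → q b a y z * ω ((v , z) ∷ ks)) * η ((v , y) ∷ ks) * f) ∎
      where
      move : ∀ o q h f → o * (q * h) * f ≡ q * o * h * f
      move = solve-∀
    tails : ∀ v → ∑ ys (λ y → ∑ (words p) (Kˡ v y)) ≡ ∑ ys (λ y → ∑ (words p) (Kʳ v y))
    tails v = begin
      ∑ ys (λ y → ∑ (words p) (Kˡ v y))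
        ≡⟨ trans (∑-cong ys (λ y → ∑-+ (words p))) (∑-+ ys) ⟩
      ∑ ys (λ y → ∑ (words p) (λ ks → ω ((v , y) ∷ ks) * ∑ ys (λ z → q a b y z * η ((v , z) ∷ ks)) * φ (put x v (wt m ks))))
      + ∑ ys (λ y → pairing m (λ r → ω ((v , y) ∷ r)) (F m a b (λ r → η ((v , y) ∷ r))) (φ ∘ put x v))
        ≡⟨ cong₂ _+_ (trans (∑-swap ys (words p)) (trans
              (∑-cong (words p) (λ ks → transposed v ks (φ (put x v (wt m ks))))) (∑-swap (words p) ys)))
            (∑-cong ys (λ y → adjoint-F m a b (λ r → ω ((v , y) ∷ r)) (λ r → η ((v , y) ∷ r)) (φ ∘ put x v))) ⟩
      ∑ ys (λ y → ∑ (words p) (λ ks → ∑ ys (λ z → q b a y z * ω ((v , z) ∷ ks)) * η ((v , y) ∷ ks) * φ (put x v (wt m ks))))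
      + ∑ ys (λ y → pairing m (F m b a (λ r → ω ((v , y) ∷ r))) (λ r → η ((v , y) ∷ r)) (φ ∘ put x v))
        ≡⟨ trans (∑-cong ys (λ y → ∑-+ (words p))) (∑-+ ys) ⟨
      ∑ ys (λ y → ∑ (words p) (Kʳ v y)) ∎

  Invariant : State p → Set
  Invariant ω = ∀ a b → a ≢ b → ∀ ks → T a b ω ks ≡ 0ℤ

  private
    E≡-F : (m : Vec Bool p) {ω : State p} → Invariant ω → ∀ a b → a ≢ b → ∀ ks → E m a b ω ks ≡ - 1ℤ * F m a b ω ks
    E≡-F m {ω} inv a b ne ks = solveFor (E m a b ω ks) (F m a b ω ks) (trans (E+F m a b ω ks) (inv a b ne ks))
      where
      solveFor : ∀ x y → x + y ≡ 0ℤ → x ≡ - 1ℤ * y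
      solveFor x y e = trans (add x y) (trans (cong (_+ - 1ℤ * y) e) (ℤP.+-identityˡ _))
        where
        add : ∀ x y → x ≡ (x + y) + - 1ℤ * y
        add = solve-∀

    F≡-E : (m : Vec Bool p) {ω : State p} → Invariant ω → ∀ a b → a ≢ b → ∀ ks → F m a b ω ks ≡ - 1ℤ * E m a b ω ks
    F≡-E m {ω} inv a b ne ks = trans (double (F m a b ω ks)) (cong (- 1ℤ *_) (sym (E≡-F m inv a b ne ks)))
      where
      double : ∀ y → y ≡ - 1ℤ * (- 1ℤ * y)
      double = solve-∀

    pairing-scaleʳ : (m : Vec Bool p) (ω η : State p) (k : ℤ) (φ : Test n) →
      pairing m ω (λ ks → k * η ks) φ ≡ k * pairing m ω η φ
    pairing-scaleʳ {p} m ω η k φ = trans (∑-cong (words p) (λ ks → move (ω ks) k (η ks) (φ (wt m ks)))) (∑-*ˡ (words p) k)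
      where
      move : ∀ a k b c → a * (k * b) * c ≡ k * (a * b * c)
      move = solve-∀

  -- Invariance lets a raising operator on the marked factors be traded for one on
  -- the other factors, which commutes past everything and is traded back.
  exchange : (m : Vec Bool p) {ω η : State p} → Invariant ω → Invariant η → ∀ a b → a ≢ b → (φ : Test n) →
    pairing m ω (E m a b (E m b a η)) (φ ∘ inc b) ≡ pairing m ω (E m b a (E m a b η)) (φ ∘ inc a)
  exchange m {ω} {η} inv-ω inv-η a b a≢b φ = begin
    pairing m ω (E m a b (E m b a η)) (φ ∘ inc b)
      ≡⟨ adjoint-E m a b ω (E m b a η) φ ⟩
    pairing m (E m b a ω) (E m b a η) (φ ∘ inc a)
      ≡⟨ pairing-congʳ m (E m b a ω) (φ ∘ inc a) (E≡-F m inv-η b a (a≢b ∘ sym)) ⟩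
    pairing m (E m b a ω) (λ ks → - 1ℤ * F m b a η ks) (φ ∘ inc a)
      ≡⟨ pairing-scaleʳ m (E m b a ω) (F m b a η) (- 1ℤ) (φ ∘ inc a) ⟩
    - 1ℤ * pairing m (E m b a ω) (F m b a η) (φ ∘ inc a)
      ≡⟨ cong (- 1ℤ *_) (adjoint-F m b a (E m b a ω) η (φ ∘ inc a)) ⟩
    - 1ℤ * pairing m (F m a b (E m b a ω)) η (φ ∘ inc a)
      ≡⟨ cong (- 1ℤ *_) (pairing-comm m (F m a b (E m b a ω)) η (φ ∘ inc a)) ⟩
    - 1ℤ * pairing m η (F m a b (E m b a ω)) (φ ∘ inc a)
      ≡⟨ cong (- 1ℤ *_) (pairing-congʳ m η (φ ∘ inc a) (λ ks → trans (sym (E-F-commute m b a a b ω ks))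
           (trans (E-cong m b a (F≡-E m inv-ω a b a≢b) ks) (E-*ˡ m b a (- 1ℤ) (E m a b ω) ks)))) ⟩
    - 1ℤ * pairing m η (λ ks → - 1ℤ * E m b a (E m a b ω) ks) (φ ∘ inc a)
      ≡⟨ cong (- 1ℤ *_) (pairing-scaleʳ m η (E m b a (E m a b ω)) (- 1ℤ) (φ ∘ inc a)) ⟩
    - 1ℤ * (- 1ℤ * pairing m η (E m b a (E m a b ω)) (φ ∘ inc a))
      ≡⟨ double (pairing m η (E m b a (E m a b ω)) (φ ∘ inc a)) ⟩
    pairing m η (E m b a (E m a b ω)) (φ ∘ inc a)
      ≡⟨ adjoint-E m b a η (E m a b ω) φ ⟩
    pairing m (E m a b η) (E m a b ω) (φ ∘ inc b)
      ≡⟨ pairing-comm m (E m a b η) (E m a b ω) (φ ∘ inc b) ⟩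
    pairing m (E m a b ω) (E m a b η) (φ ∘ inc b)
      ≡⟨ adjoint-E m b a ω (E m a b η) φ ⟨
    pairing m ω (E m b a (E m a b η)) (φ ∘ inc a) ∎
    where
    open ≡-Reasoning
    double : ∀ y → - 1ℤ * (- 1ℤ * y) ≡ y
    double = solve-∀

  E-diagonal : (m : Vec Bool p) → ∀ a (ω : State p) ks → E m a a ω ks ≡ ⁺ lookup (wt m ks) a * ω ks
  E-diagonal []          a ω []             = sym (trans (cong (λ t → ⁺ t * ω []) (VP.lookup-replicate a 0)) refl)
  E-diagonal (false ∷ m) a ω ((v , y) ∷ ks) = trans (ℤP.+-identityˡ _) (E-diagonal m a (λ r → ω ((v , y) ∷ r)) ks)
  E-diagonal (true ∷ m)  a ω ((v , y) ∷ ks) = begin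
    1ℤ * (eqF v a * ω ((a , y) ∷ ks)) + E m a a (λ r → ω ((v , y) ∷ r)) ks
      ≡⟨ cong₂ _+_ (trans (ℤP.*-identityˡ _) (eqF-subst v a (λ w → ω ((w , y) ∷ ks))))
                   (E-diagonal m a (λ r → ω ((v , y) ∷ r)) ks) ⟩
    eqF v a * ω ((v , y) ∷ ks) + ⁺ lookup (wt m ks) a * ω ((v , y) ∷ ks)
      ≡⟨ ℤP.*-distribʳ-+ (ω ((v , y) ∷ ks)) (eqF v a) (⁺ lookup (wt m ks) a) ⟨
    (eqF v a + ⁺ lookup (wt m ks) a) * ω ((v , y) ∷ ks)
      ≡⟨ cong (_* ω ((v , y) ∷ ks)) (lookup-inc v a (wt m ks)) ⟨
    ⁺ lookup (inc v (wt m ks)) a * ω ((v , y) ∷ ks) ∎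
    where
    open ≡-Reasoning
    lookup-inc : ∀ {n} (v a : Fin n) (u : Vec ℕ n) → ⁺ lookup (inc v u) a ≡ eqF v a + ⁺ lookup u a
    lookup-inc zero    zero    (t ∷ u) = refl
    lookup-inc zero    (suc a) (t ∷ u) = sym (ℤP.+-identityˡ _)
    lookup-inc (suc v) zero    (t ∷ u) = sym (ℤP.+-identityˡ _)
    lookup-inc (suc v) (suc a) (t ∷ u) = lookup-inc v a u

  casimir : Vec Bool p → State p → State p
  casimir m ω ks = ∑ (L.allFin n) (λ a → ∑ (L.allFin n) (λ b → E m a b (E m b a ω) ks))

  private
    eqF-sym : ∀ {n} (a b : Fin n) → eqF a b ≡ eqF b a
    eqF-sym zero    zero    = refl
    eqF-sym zero    (suc b) = refl
    eqF-sym (suc a) zero    = refl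
    eqF-sym (suc a) (suc b) = eqF-sym a b

  -- Moving E_cd through both factors of each summand produces four contracted sums: `X` and `Z`,
  -- each occurring once with either sign.
  casimir-E : (m : Vec Bool p) → ∀ c d (ω : State p) ks → casimir m (E m c d ω) ks ≡ E m c d (casimir m ω) ks
  casimir-E m c d ω ks = begin
    ∑∑ (λ a b → E m a b (E m b a (E m c d ω)) ks)
      ≡⟨ ∑∑-cong (λ a b → trans (E-cong m a b (λ r → swapˡ b a c d ω r) ks) (trans (expand a b)
           (cong₂ (λ s t → (s + eqF a c * E m a b (E m b d ω) ks) - t)
             (swapˡ a b c d (E m b a ω) ks) (cong (_* E m a b (E m c a ω) ks) (eqF-sym d b))))) ⟩
    ∑∑ (λ a b → (((E m c d (E m a b (E m b a ω)) ks + eqF b c * E m a d (E m b a ω) ks) - eqF d a * E m c b (E m b a ω) ks)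
              + eqF a c * E m a b (E m b d ω) ks) - eqF b d * E m a b (E m c a ω) ks)
      ≡⟨ ∑∑-cong (λ a b → cong (λ s → (((E m c d (E m a b (E m b a ω)) ks + eqF b c * E m a d (E m b a ω) ks)
           - s * E m c b (E m b a ω) ks) + eqF a c * E m a b (E m b d ω) ks) - eqF b d * E m a b (E m c a ω) ks) (eqF-sym d a)) ⟩
    ∑∑ (λ a b → (((E m c d (E m a b (E m b a ω)) ks + eqF b c * E m a d (E m b a ω) ks) - eqF a d * E m c b (E m b a ω) ks)
              + eqF a c * E m a b (E m b d ω) ks) - eqF b d * E m a b (E m c a ω) ks)
      ≡⟨ trans (∑∑-sub _ _) (cong₂ _-_ (trans (∑∑-+ _ _) (cong₂ _+_ (trans (∑∑-sub _ _) (cong₂ _-_ (∑∑-+ _ _) refl)) refl)) refl) ⟩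
    (((∑∑ (λ a b → E m c d (E m a b (E m b a ω)) ks) + ∑∑ (λ a b → eqF b c * E m a d (E m b a ω) ks))
      - ∑∑ (λ a b → eqF a d * E m c b (E m b a ω) ks)) + ∑∑ (λ a b → eqF a c * E m a b (E m b d ω) ks))
      - ∑∑ (λ a b → eqF b d * E m a b (E m c a ω) ks)
      ≡⟨ cong₂ _-_ (cong₂ _+_ (cong₂ _-_ (cong (∑∑ (λ a b → E m c d (E m a b (E m b a ω)) ks) +_)
           (second (λ a b → E m a d (E m b a ω) ks) c)) (first (λ a b → E m c b (E m b a ω) ks) d))
           (first (λ a b → E m a b (E m b d ω) ks) c)) (second (λ a b → E m a b (E m c a ω) ks) d) ⟩
    (((∑∑ (λ a b → E m c d (E m a b (E m b a ω)) ks) + X) - Z) + Z) - X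
      ≡⟨ cancel (∑∑ (λ a b → E m c d (E m a b (E m b a ω)) ks)) X Z ⟩
    ∑∑ (λ a b → E m c d (E m a b (E m b a ω)) ks)
      ≡⟨ trans (E-∑ m c d (L.allFin n) (λ a r → ∑ (L.allFin n) (λ b → E m a b (E m b a ω) r)) ks)
           (∑-cong (L.allFin n) (λ a → E-∑ m c d (L.allFin n) (λ b → E m a b (E m b a ω)) ks)) ⟨
    E m c d (casimir m ω) ks ∎
    where
    open ≡-Reasoning
    ∑∑ : (Fin n → Fin n → ℤ) → ℤ
    ∑∑ g = ∑ (L.allFin n) (λ a → ∑ (L.allFin n) (g a))
    ∑∑-cong : {g h : Fin n → Fin n → ℤ} → (∀ a b → g a b ≡ h a b) → ∑∑ g ≡ ∑∑ h
    ∑∑-cong e = ∑-cong (L.allFin n) (λ a → ∑-cong (L.allFin n) (e a))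
    ∑∑-+ : (g h : Fin n → Fin n → ℤ) → ∑∑ (λ a b → g a b + h a b) ≡ ∑∑ g + ∑∑ h
    ∑∑-+ g h = trans (∑-cong (L.allFin n) (λ a → ∑-+ (L.allFin n))) (∑-+ (L.allFin n))
    ∑∑-sub : (g h : Fin n → Fin n → ℤ) → ∑∑ (λ a b → g a b - h a b) ≡ ∑∑ g - ∑∑ h
    ∑∑-sub g h = trans (∑∑-+ g (λ a b → - h a b)) (cong (∑∑ g +_)
      (trans (∑-cong (L.allFin n) (λ a → ∑-neg (L.allFin n))) (∑-neg (L.allFin n))))
    first : (g : Fin n → Fin n → ℤ) (c : Fin n) → ∑∑ (λ a b → eqF a c * g a b) ≡ ∑ (L.allFin n) (g c)
    first g c = trans (∑-cong (L.allFin n) (λ a → ∑-*ˡ (L.allFin n) (eqF a c))) (∑-eqF c (λ a → ∑ (L.allFin n) (g a)))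
    second : (g : Fin n → Fin n → ℤ) (c : Fin n) → ∑∑ (λ a b → eqF b c * g a b) ≡ ∑ (L.allFin n) (λ a → g a c)
    second g c = ∑-cong (L.allFin n) (λ a → ∑-eqF c (g a))
    X Z : ℤ
    X = ∑ (L.allFin n) (λ a → E m a d (E m c a ω) ks)
    Z = ∑ (L.allFin n) (λ b → E m c b (E m b d ω) ks)
    swapˡ : ∀ a b c d ζ r → E m a b (E m c d ζ) r ≡ (E m c d (E m a b ζ) r + eqF b c * E m a d ζ r) - eqF d a * E m c b ζ r
    swapˡ a b c d ζ r = solveFor (E m a b (E m c d ζ) r) (E m c d (E m a b ζ) r) (eqF b c * E m a d ζ r) (eqF d a * E m c b ζ r)
      (commutator m a b c d ζ r)
      where
      solveFor : ∀ x y s t → x - y ≡ s - t → x ≡ (y + s) - t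
      solveFor x y s t e = trans (add x y) (trans (cong (y +_) e) (assoc y s t))
        where
        add : ∀ x y → x ≡ y + (x - y)
        add = solve-∀
        assoc : ∀ y s t → y + (s - t) ≡ (y + s) - t
        assoc = solve-∀
    expand : ∀ a b → E m a b (λ r → (E m c d (E m b a ω) r + eqF a c * E m b d ω r) - eqF d b * E m c a ω r) ks ≡
      (E m a b (E m c d (E m b a ω)) ks + eqF a c * E m a b (E m b d ω) ks) - eqF d b * E m a b (E m c a ω) ks
    expand a b = trans (E-cong m a b (λ r → cong ((E m c d (E m b a ω) r + eqF a c * E m b d ω r) +_) (ℤP.neg-distribˡ-* (eqF d b) (E m c a ω r))) ks)
      (trans (E-+ m a b (λ r → E m c d (E m b a ω) r + eqF a c * E m b d ω r) (λ r → - eqF d b * E m c a ω r) ks)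
        (cong₂ _+_ (trans (E-+ m a b (E m c d (E m b a ω)) (λ r → eqF a c * E m b d ω r) ks)
            (cong (E m a b (E m c d (E m b a ω)) ks +_) (E-*ˡ m a b (eqF a c) (E m b d ω) ks)))
          (trans (E-*ˡ m a b (- eqF d b) (E m c a ω) ks) (sym (ℤP.neg-distribˡ-* (eqF d b) (E m a b (E m c a ω) ks))))))
    cancel : ∀ s x z → (((s + x) - z) + z) - x ≡ s
    cancel = solve-∀

  private
    F-+ : (m : Vec Bool p) → ∀ a b (ω η : State p) ks → F m a b (λ r → ω r + η r) ks ≡ F m a b ω ks + F m a b η ks
    F-+ m a b ω η ks = trans (F-cong m a b (λ r → cong (_+ η r) (sym (ℤP.*-identityˡ (ω r)))) ks)
      (trans (F-linear m a b 1ℤ ω η ks) (cong (_+ F m a b η ks) (ℤP.*-identityˡ (F m a b ω ks))))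

    F-zero : (m : Vec Bool p) → ∀ a b ks → F m a b (λ _ → 0ℤ) ks ≡ 0ℤ
    F-zero m a b ks = trans (F-linear m a b (- 1ℤ) (λ _ → 0ℤ) (λ _ → 0ℤ) ks) (cancel (F m a b (λ _ → 0ℤ) ks))
      where
      cancel : ∀ x → - 1ℤ * x + x ≡ 0ℤ
      cancel = solve-∀

    F-∑ : {A : Set} (m : Vec Bool p) → ∀ a b (as : List A) (ω : A → State p) ks →
      F m a b (λ r → ∑ as (λ i → ω i r)) ks ≡ ∑ as (λ i → F m a b (ω i) ks)
    F-∑ m a b []       ω ks = F-zero m a b ks
    F-∑ m a b (i ∷ as) ω ks = trans (F-+ m a b (ω i) (λ r → ∑ as (λ i → ω i r)) ks)
      (cong (F m a b (ω i) ks +_) (F-∑ m a b as ω ks))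

  casimir-F : (m : Vec Bool p) → ∀ c d (ω : State p) ks → casimir m (F m c d ω) ks ≡ F m c d (casimir m ω) ks
  casimir-F m c d ω ks = trans
    (∑-cong (L.allFin n) (λ a → trans (∑-cong (L.allFin n) (λ b → trans
        (E-cong m a b (E-F-commute m b a c d ω) ks) (E-F-commute m a b c d (E m b a ω) ks)))
      (sym (F-∑ m c d (L.allFin n) (λ b → E m a b (E m b a ω)) ks))))
    (sym (F-∑ m c d (L.allFin n) (λ a r → ∑ (L.allFin n) (λ b → E m a b (E m b a ω) r)) ks))

  shifted : Vec Bool p → ℤ → State p → State p
  shifted m k ω ks = casimir m ω ks + k * ω ks

  -- The total action is `E` plus `F`, and the Casimir operator commutes with each of them. Hence
  -- polynomials in it preserve invariance, as the induction in `form-positive` requires.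
  shifted-invariant : (m : Vec Bool p) (k : ℤ) {ω : State p} → Invariant ω → Invariant (shifted m k ω)
  shifted-invariant {p} m k {ω} inv c d c≢d ks = begin
    T c d (shifted m k ω) ks
      ≡⟨ E+F m c d (shifted m k ω) ks ⟨
    E m c d (shifted m k ω) ks + F m c d (shifted m k ω) ks
      ≡⟨ cong₂ _+_ (trans (E-+ m c d (casimir m ω) (λ r → k * ω r) ks) (cong₂ _+_ (sym (casimir-E m c d ω ks)) (E-*ˡ m c d k ω ks)))
                   (trans (F-cong m c d (λ r → ℤP.+-comm (casimir m ω r) (k * ω r)) ks)
                     (trans (F-linear m c d k ω (casimir m ω) ks) (cong (k * F m c d ω ks +_) (sym (casimir-F m c d ω ks))))) ⟩
    (casimir m (E m c d ω) ks + k * E m c d ω ks) + (k * F m c d ω ks + casimir m (F m c d ω) ks)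
      ≡⟨ regroup (casimir m (E m c d ω) ks) k (E m c d ω ks) (F m c d ω ks) (casimir m (F m c d ω) ks) ⟩
    (casimir m (E m c d ω) ks + casimir m (F m c d ω) ks) + k * (E m c d ω ks + F m c d ω ks)
      ≡⟨ cong₂ _+_ total (trans (cong (k *_) (trans (E+F m c d ω ks) (inv c d c≢d ks))) (ℤP.*-zeroʳ k)) ⟩
    0ℤ ∎
    where
    open ≡-Reasoning
    regroup : ∀ x k e f y → (x + k * e) + (k * f + y) ≡ (x + y) + k * (e + f)
    regroup = solve-∀
    total : casimir m (E m c d ω) ks + casimir m (F m c d ω) ks ≡ 0ℤ
    total = trans (sym (∑-+ (L.allFin n))) (∑-zero (L.allFin n) (λ a → trans (sym (∑-+ (L.allFin n)))
      (∑-zero (L.allFin n) (λ b → trans (sym (E-+ m a b (E m b a (E m c d ω)) (E m b a (F m c d ω)) ks))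
        (E-zero m a b (λ r → trans (sym (E-+ m b a (E m c d ω) (F m c d ω) r))
          (E-zero m b a (λ r′ → trans (E+F m c d ω r′) (inv c d c≢d r′)) r)) ks)))))

-- Strict exponents, adding and removing a box

⟦map⟧ : {A : Set} (as : List A) (c : A → ℤ) (u : A → Vec ℕ n) (φ : Test n) →
  ⟦ L.map (λ a → c a , u a) as ⟧ φ ≡ ∑ as (λ a → c a * φ (u a))
⟦map⟧ []       c u φ = ⟦[]⟧ φ
⟦map⟧ (a ∷ as) c u φ = trans (⟦⟧-term (c a) (u a) _ φ) (cong (c a * φ (u a) +_) (⟦map⟧ as c u φ))

δ-subst : (g : Test n) (l u : Vec ℕ n) → g u * δ l u ≡ g l * δ l u
δ-subst g l u with VP.≡-dec ℕP._≟_ l u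
... | yes refl = refl
... | no  l≢u  = trans (cong (g u *_) (δ-≢ l u l≢u)) (trans (ℤP.*-zeroʳ (g u))
                   (sym (trans (cong (g l *_) (δ-≢ l u l≢u)) (ℤP.*-zeroʳ (g l)))))

sq-∑ : (u : Vec ℕ n) → ∑ (L.allFin n) (λ a → ⁺ lookup u a * ⁺ lookup u a) ≡ sq u
sq-∑ []      = refl
sq-∑ (t ∷ u) = trans (∑-allFin (λ a → ⁺ lookup (t ∷ u) a * ⁺ lookup (t ∷ u) a)) (cong (⁺ t * ⁺ t +_) (sq-∑ u))

total : Vec ℕ n → ℤ
total u = sumOf ⁺_ (toList u)

total-∑ : (u : Vec ℕ n) → ∑ (L.allFin n) (λ a → ⁺ lookup u a) ≡ total u
total-∑ []      = refl
total-∑ (t ∷ u) = trans (∑-allFin (λ a → ⁺ lookup (t ∷ u) a)) (cong (⁺ t +_) (total-∑ u))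

total-⊕ : (u w : Vec ℕ n) → total (u ⊕ w) ≡ total u + total w
total-⊕ []      []      = refl
total-⊕ (s ∷ u) (t ∷ w) = trans (cong₂ _+_ (ℤP.pos-+ s t) (total-⊕ u w)) (interchange (⁺ s) (⁺ t) (total u) (total w))
  where
  interchange : ∀ a b c d → (a + b) + (c + d) ≡ (a + c) + (b + d)
  interchange = solve-∀

total-inc : (a : Fin n) (u : Vec ℕ n) → total (inc a u) ≡ 1ℤ + total u
total-inc zero    (t ∷ u) = trans (cong (_+ total u) (ℤP.pos-+ 1 t)) (ℤP.+-assoc 1ℤ (⁺ t) (total u))
total-inc (suc a) (t ∷ u) = trans (cong (⁺ t +_) (total-inc a u)) (swap (⁺ t) (total u))
  where
  swap : ∀ x y → x + (1ℤ + y) ≡ 1ℤ + (x + y)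
  swap = solve-∀

total-𝟘 : ∀ n → total (𝟘 {n}) ≡ 0ℤ
total-𝟘 zero    = refl
total-𝟘 (suc n) = trans (ℤP.+-identityˡ _) (total-𝟘 n)

staircase : ∀ n → Vec ℕ n
staircase zero    = []
staircase (suc n) = n ∷ staircase n

toList-staircase : ∀ n → toList (staircase n) ≡ L.downFrom n
toList-staircase zero    = refl
toList-staircase (suc n) = cong (n ∷_) (toList-staircase n)

staircase-strict : ∀ n → Strict (staircase n)
staircase-strict n = subst (Linked _>_) (sym (toList-staircase n)) (downFrom-strict n)

∈-toList : (b : Fin n) (u : Vec ℕ n) → lookup u b ∈ toList u
∈-toList zero    (x ∷ u) = here refl
∈-toList (suc b) (x ∷ u) = there (∈-toList b u)

strict-injective : (u : Vec ℕ n) → Strict u → ∀ a b → lookup u a ≡ lookup u b → a ≡ b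
strict-injective (t ∷ u) s zero    zero    e = refl
strict-injective (t ∷ u) s zero    (suc b) e = ⊥-elim (ℕP.<⇒≢ (All.lookup (head-max s) (∈-toList b u)) (sym e))
strict-injective (t ∷ u) s (suc a) zero    e = ⊥-elim (ℕP.<⇒≢ (All.lookup (head-max s) (∈-toList a u)) e)
strict-injective (t ∷ u) s (suc a) (suc b) e = cong suc (strict-injective u (Linked.tail s) a b e)

-- In terms of partitions, a nonempty one has a removable box and the staircase is the empty one.
-- The lowest row that still exceeds the staircase can be shortened.
removable : (l : Vec ℕ n) → Strict l → l ≡ staircase n ⊎ ∃₂ λ a m → Strict m × l ≡ inc a m
removable []      s = inj₁ refl
removable {suc n} (t ∷ u) s with removable u (Linked.tail s)
... | inj₂ (a , m , s′ , refl) = inj₂ (suc a , t ∷ m , prepend a m s s′ , refl)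
  where
  prepend : ∀ {n} (a : Fin n) (m : Vec ℕ n) → Linked _>_ (t ∷ toList (inc a m)) → Strict m → Strict (t ∷ m)
  prepend zero    (x ∷ m) (t>x ∷ _) s′ = ℕP.<-trans (ℕP.n<1+n x) t>x ∷ s′
  prepend (suc a) (x ∷ m) (t>x ∷ _) s′ = t>x ∷ s′
removable {suc n} (t ∷ .(staircase n)) s | inj₁ refl with ℕP.m≤n⇒m<n∨m≡n (above n s)
  where
  above : ∀ n → Strict (t ∷ staircase n) → n ℕ.≤ t
  above zero    s         = ℕ.z≤n
  above (suc n) (t>n ∷ _) = t>n
... | inj₂ refl = inj₁ refl
... | inj₁ n<t with t
...   | suc t′ = inj₂ (zero , t′ ∷ staircase n , lower n (ℕ.s≤s⁻¹ n<t) , refl)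
  where
  lower : ∀ n → n ℕ.≤ t′ → Strict (t′ ∷ staircase n)
  lower zero    _   = [-]
  lower (suc n) n<t = n<t ∷ staircase-strict (suc n)

sq-inc : (a : Fin n) (u : Vec ℕ n) → sq (inc a u) ≡ sq u + (⁺ lookup u a + ⁺ lookup u a) + 1ℤ
sq-inc a u = begin
  dot (inc a u) (inc a u)                          ≡⟨ dot-incˡ a u (inc a u) ⟩
  ⁺ lookup (inc a u) a + dot u (inc a u)           ≡⟨ cong₂ _+_ (trans (cong ⁺_ (VP.lookup∘updateAt a u)) (ℤP.pos-+ 1 (lookup u a)))
                                                        (trans (dot-comm u (inc a u)) (dot-incˡ a u u)) ⟩
  (1ℤ + ⁺ lookup u a) + (⁺ lookup u a + sq u)      ≡⟨ regroup (⁺ lookup u a) (sq u) ⟩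
  sq u + (⁺ lookup u a + ⁺ lookup u a) + 1ℤ        ∎
  where
  open ≡-Reasoning
  regroup : ∀ x s → (1ℤ + x) + (x + s) ≡ s + (x + x) + 1ℤ
  regroup = solve-∀

-- The difference is twice the difference of the entries of u at a and b, which are distinct in a
-- strict vector. So the Casimir operator separates the ways of adding a box.
sq-inc-≢ : (u : Vec ℕ n) → Strict u → ∀ a b → a ≢ b → sq (inc a u) - sq (inc b u) ≢ 0ℤ
sq-inc-≢ u s a b a≢b e = a≢b (strict-injective u s a b (ℤP.+-injective (halve (⁺ lookup u a) (⁺ lookup u b)
  (trans (sym (difference (sq u) (⁺ lookup u a) (⁺ lookup u b)))
    (trans (cong₂ _-_ (sym (sq-inc a u)) (sym (sq-inc b u))) e)))))
  where
  difference : ∀ s x y → (s + (x + x) + 1ℤ) - (s + (y + y) + 1ℤ) ≡ ⁺ 2 * (x - y)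
  difference = solve-∀
  halve : ∀ x y → ⁺ 2 * (x - y) ≡ 0ℤ → x ≡ y
  halve x y e = ℤP.i-j≡0⇒i≡j x y (ℤP.*-cancelˡ-≡ (⁺ 2) (x - y) 0ℤ e)

square-positive : ∀ g → g ≢ 0ℤ → ∃ λ k → g * g ≡ ⁺ suc k
square-positive (⁺ zero)  ne = ⊥-elim (ne refl)
square-positive (⁺ suc k) ne = _ , refl
square-positive -[1+ k ]  ne = _ , refl

square-nonneg : ∀ g → 0ℤ ≤ g * g
square-nonneg (⁺ zero)  = ℤP.≤-refl
square-nonneg (⁺ suc k) = +≤+ ℕ.z≤n
square-nonneg -[1+ k ]  = +≤+ ℕ.z≤n

∑-nonneg : {A : Set} (as : List A) {g : A → ℤ} → (∀ a → a ∈ as → 0ℤ ≤ g a) → 0ℤ ≤ ∑ as g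
∑-nonneg []       e = ℤP.≤-refl
∑-nonneg (a ∷ as) e = ℤP.+-mono-≤ (e a (here refl)) (∑-nonneg as (λ b b∈ → e b (there b∈)))

∑-single : (a : Fin n) (h : Fin n → ℤ) → (∀ c → c ≢ a → h c ≡ 0ℤ) → ∑ (L.allFin n) h ≡ h a
∑-single {n} a h e = trans (∑-cong (L.allFin n) (λ c → sym (indicator c))) (∑-eqF a h)
  where
  indicator : ∀ c → eqF c a * h c ≡ h c
  indicator c with c FP.≟ a
  ... | yes refl = trans (cong (_* h c) (eqF-refl c)) (ℤP.*-identityˡ (h c))
  ... | no  c≢a  = trans (cong (eqF c a *_) (e c c≢a)) (trans (ℤP.*-zeroʳ (eqF c a)) (sym (e c c≢a)))

-- Nonnegativity of the Schur coefficients

module Positivity (n : ℕ) (Y : Set) (ys : List Y) (q : Fin n → Fin n → Y → Y → ℤ)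
                  (q-transpose : ∀ a b y z → q a b y z ≡ q b a z y) where
  open Forms n Y ys q q-transpose public

  private variable
    p : ℕ

  form : Vec Bool p → State p → State p → Pol n
  form {p} m ω η = L.map (λ ks → ω ks * η ks , wt m ks) (words p)

  ⟦form⟧ : (m : Vec Bool p) (ω η : State p) (φ : Test n) → ⟦ form m ω η ⟧ φ ≡ pairing m ω η φ
  ⟦form⟧ {p} m ω η φ = ⟦map⟧ (words p) (λ ks → ω ks * η ks) (wt m) φ

  total-wt : (m : Vec Bool p) (ks : Word p) → total (wt m ks) ≡ ⁺ count m
  total-wt []          []             = total-𝟘 n
  total-wt (true ∷ m)  ((v , y) ∷ ks) = trans (total-inc v (wt m ks)) (cong (λ t → 1ℤ + t) (total-wt m ks))
  total-wt (false ∷ m) (k ∷ ks)       = total-wt m ks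

  -- For l = λ + (n-1, ..., 1, 0) with |λ| the number of marked positions, this is ∑ λᵢ (λᵢ + n + 1
  -- - 2i), the classical Casimir eigenvalue of gl_n at highest weight λ.
  eigenvalue : Vec Bool p → Vec ℕ n → ℤ
  eigenvalue m l = sq l - (⁺ L.length (L.allFin n) * ⁺ count m + vanderEigenvalue n - ⁺ count m)

  -- The radial part formula with Y a b the form of ω and E_ab E_ba η: `exchange` comes from
  -- invariance, the commutator from the relations of gl_n, and the diagonal terms count letters.
  -- Testing at `δ l` turns the weight `sq` into the number `sq l`.
  casimir-coefficient : (m : Vec Bool p) {ω η : State p} → Invariant ω → Invariant η → ∀ l →
    schurCoefficient (form m ω (casimir m η)) l ≡ eigenvalue m l * schurCoefficient (form m ω η) l
  casimir-coefficient {p} m {ω} {η} inv-ω inv-η l = begin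
    ⟦ V ⊛ form m ω (casimir m η) ⟧ (δ l)
      ≡⟨ at (PR.*-congˡ {x = V} (ev expand)) (δ l) ⟩
    ⟦ V ⊛ sum is (λ a → sum is (Yab a)) ⟧ (δ l)
      ≡⟨ ⟦casimir⟧ d Yab exchange′ commutator′ is (UP.allFin⁺ n) (⁺ count m) (vanderEigenvalue n)
           diagonal homogeneous (vander-laplace n) (δ l) ⟩
    ⟦ V ⊛ d ⟧ (λ u → sq u * δ l u) - c * ⟦ V ⊛ d ⟧ (δ l)
      ≡⟨ cong (_- c * ⟦ V ⊛ d ⟧ (δ l)) (trans (⟦⟧-cong (V ⊛ d) (δ-subst sq l)) (⟦⟧-*ˡ (V ⊛ d) (sq l) (δ l))) ⟩
    sq l * ⟦ V ⊛ d ⟧ (δ l) - c * ⟦ V ⊛ d ⟧ (δ l)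
      ≡⟨ factor (sq l) c (⟦ V ⊛ d ⟧ (δ l)) ⟩
    eigenvalue m l * ⟦ V ⊛ d ⟧ (δ l) ∎
    where
    open ≡-Reasoning
    open Casimir {n} using (sum; ⟦casimir⟧)
    V = vander n
    is = L.allFin n
    c = ⁺ L.length (L.allFin n) * ⁺ count m + vanderEigenvalue n - ⁺ count m
    d = form m ω η
    Yab : Fin n → Fin n → Pol n
    Yab a b = form m ω (E m a b (E m b a η))
    factor : ∀ s c x → s * x - c * x ≡ (s - c) * x
    factor = solve-∀
    expand : ∀ φ → ⟦ form m ω (casimir m η) ⟧ φ ≡ ⟦ sum is (λ a → sum is (Yab a)) ⟧ φ
    expand φ = trans (⟦form⟧ m ω (casimir m η) φ) (trans
      (pairing-∑ m ω is (λ a ks → ∑ is (λ b → E m a b (E m b a η) ks)) φ)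
      (sym (trans (⟦sum⟧ is (λ a → sum is (Yab a)) φ) (∑-cong is (λ a → trans (⟦sum⟧ is (Yab a) φ) (trans
        (∑-cong is (λ b → ⟦form⟧ m ω (E m a b (E m b a η)) φ))
        (sym (pairing-∑ m ω is (λ b → E m a b (E m b a η)) φ))))))))
    exchange′ : ∀ a b → a ≢ b → variable′ b ⊛ Yab a b ≋ variable′ a ⊛ Yab b a
    exchange′ a b a≢b = ev λ φ → trans (⟦variable⟧ b (Yab a b) φ) (trans (⟦form⟧ m ω _ (φ ∘ inc b))
      (trans (exchange m inv-ω inv-η a b a≢b φ)
        (sym (trans (⟦variable⟧ a (Yab b a) φ) (⟦form⟧ m ω _ (φ ∘ inc a))))))
    weighted : ∀ a φ → ⟦ euler a d ⟧ φ ≡ pairing m ω (λ ks → ⁺ lookup (wt m ks) a * η ks) φ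
    weighted a φ = trans (⟦reweight⟧ (λ u → ⁺ lookup u a) d φ) (trans (⟦form⟧ m ω η (λ u → ⁺ lookup u a * φ u))
      (∑-cong (words p) (λ ks → move (ω ks) (η ks) (⁺ lookup (wt m ks) a) (φ (wt m ks)))))
      where
      move : ∀ o h w f → o * h * (w * f) ≡ o * (w * h) * f
      move = solve-∀
    commutator′ : ∀ a b → a ≢ b → Yab a b ≋ Yab b a ⊞ (euler a d PR.- euler b d)
    commutator′ a b a≢b = ev λ φ → begin
      ⟦ Yab a b ⟧ φ ≡⟨ ⟦form⟧ m ω _ φ ⟩
      pairing m ω (E m a b (E m b a η)) φ
        ≡⟨ pairing-congʳ m ω φ (λ ks → pointwise ks) ⟩
      pairing m ω (λ ks → (E m b a (E m a b η) ks + 1ℤ * A ks) + - 1ℤ * C ks) φ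
        ≡⟨ trans (pairing-linear m ω (λ ks → E m b a (E m a b η) ks + 1ℤ * A ks) C (- 1ℤ) φ)
             (cong (_+ - 1ℤ * pairing m ω C φ) (pairing-linear m ω (E m b a (E m a b η)) A 1ℤ φ)) ⟩
      (pairing m ω (E m b a (E m a b η)) φ + 1ℤ * pairing m ω A φ) + - 1ℤ * pairing m ω C φ
        ≡⟨ regroup (pairing m ω (E m b a (E m a b η)) φ) (pairing m ω A φ) (pairing m ω C φ) ⟩
      pairing m ω (E m b a (E m a b η)) φ + (pairing m ω A φ - pairing m ω C φ)
        ≡⟨ cong₂ _+_ (⟦form⟧ m ω _ φ) (cong₂ _-_ (weighted a φ) (weighted b φ)) ⟨
      ⟦ Yab b a ⟧ φ + (⟦ euler a d ⟧ φ - ⟦ euler b d ⟧ φ)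
        ≡⟨ trans (⟦⊞⟧ (Yab b a) (euler a d PR.- euler b d) φ) (cong (⟦ Yab b a ⟧ φ +_)
             (trans (⟦⊞⟧ (euler a d) (negate (euler b d)) φ) (cong (⟦ euler a d ⟧ φ +_) (⟦negate⟧ (euler b d) φ)))) ⟨
      ⟦ Yab b a ⊞ (euler a d PR.- euler b d) ⟧ φ ∎
      where
      A C : State p
      A ks = ⁺ lookup (wt m ks) a * η ks
      C ks = ⁺ lookup (wt m ks) b * η ks
      regroup : ∀ x y z → (x + 1ℤ * y) + - 1ℤ * z ≡ x + (y - z)
      regroup = solve-∀
      solveFor : ∀ x y s t → x - y ≡ 1ℤ * s - 1ℤ * t → x ≡ (y + 1ℤ * s) + - 1ℤ * t
      solveFor x y s t e = trans (add x y) (trans (cong (y +_) e) (assoc y s t))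
        where
        add : ∀ x y → x ≡ y + (x - y)
        add = solve-∀
        assoc : ∀ y s t → y + (1ℤ * s - 1ℤ * t) ≡ (y + 1ℤ * s) + - 1ℤ * t
        assoc = solve-∀
      pointwise : ∀ ks → E m a b (E m b a η) ks ≡ (E m b a (E m a b η) ks + 1ℤ * A ks) + - 1ℤ * C ks
      pointwise ks = solveFor (E m a b (E m b a η) ks) (E m b a (E m a b η) ks) (A ks) (C ks)
        (trans (commutator m a b b a η ks) (cong₂ _-_
          (cong₂ _*_ (eqF-refl b) (E-diagonal m a η ks)) (cong₂ _*_ (eqF-refl a) (E-diagonal m b η ks))))
    diagonal : sum is (λ a → Yab a a) ≋ laplace d
    diagonal = ev λ φ → begin
      ⟦ sum is (λ a → Yab a a) ⟧ φ ≡⟨ trans (⟦sum⟧ is (λ a → Yab a a) φ) (∑-cong is (λ a → ⟦form⟧ m ω _ φ)) ⟩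
      ∑ is (λ a → pairing m ω (E m a a (E m a a η)) φ) ≡⟨ pairing-∑ m ω is (λ a → E m a a (E m a a η)) φ ⟨
      pairing m ω (λ ks → ∑ is (λ a → E m a a (E m a a η) ks)) φ
        ≡⟨ pairing-congʳ m ω φ (λ ks → trans (∑-cong is (λ a → trans (E-diagonal m a (E m a a η) ks)
             (trans (cong (⁺ lookup (wt m ks) a *_) (E-diagonal m a η ks)) (sym (ℤP.*-assoc (⁺ lookup (wt m ks) a) _ (η ks))))))
             (trans (∑-*ʳ is (η ks)) (cong (_* η ks) (sq-∑ (wt m ks))))) ⟩
      pairing m ω (λ ks → sq (wt m ks) * η ks) φ
        ≡⟨ ∑-cong (words p) (λ ks → move (ω ks) (η ks) (sq (wt m ks)) (φ (wt m ks))) ⟩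
      pairing m ω η (λ u → sq u * φ u) ≡⟨ ⟦form⟧ m ω η (λ u → sq u * φ u) ⟨
      ⟦ d ⟧ (λ u → sq u * φ u) ≡⟨ ⟦reweight⟧ sq d φ ⟨
      ⟦ laplace d ⟧ φ ∎
      where
      move : ∀ o h w f → o * (w * h) * f ≡ o * h * (w * f)
      move = solve-∀
    homogeneous : sum is (λ a → euler a d) ≋ constant (⁺ count m) ⊛ d
    homogeneous = ev λ φ → begin
      ⟦ sum is (λ a → euler a d) ⟧ φ ≡⟨ trans (⟦sum⟧ is (λ a → euler a d) φ) (∑-cong is (λ a → weighted a φ)) ⟩
      ∑ is (λ a → pairing m ω (λ ks → ⁺ lookup (wt m ks) a * η ks) φ)
        ≡⟨ pairing-∑ m ω is (λ a ks → ⁺ lookup (wt m ks) a * η ks) φ ⟨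
      pairing m ω (λ ks → ∑ is (λ a → ⁺ lookup (wt m ks) a * η ks)) φ
        ≡⟨ pairing-congʳ m ω φ (λ ks → trans (∑-*ʳ is (η ks)) (cong (_* η ks) (trans (total-∑ (wt m ks)) (total-wt m ks)))) ⟩
      pairing m ω (λ ks → ⁺ count m * η ks) φ
        ≡⟨ trans (∑-cong (words p) (λ ks → move (ω ks) (η ks) (⁺ count m) (φ (wt m ks)))) (∑-*ˡ (words p) (⁺ count m)) ⟩
      ⁺ count m * pairing m ω η φ ≡⟨ cong (⁺ count m *_) (⟦form⟧ m ω η φ) ⟨
      ⁺ count m * ⟦ d ⟧ φ ≡⟨ ⟦constant⊛⟧ (⁺ count m) d φ ⟨
      ⟦ constant (⁺ count m) ⊛ d ⟧ φ ∎
      where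
      move : ∀ o h w f → o * (w * h) * f ≡ w * (o * h * f)
      move = solve-∀

schurCoefficient-cong : ∀ {n} {f g : Pol n} → (∀ φ → ⟦ f ⟧ φ ≡ ⟦ g ⟧ φ) → ∀ l → schurCoefficient f l ≡ schurCoefficient g l
schurCoefficient-cong {n} e l = at (PR.*-congˡ {x = vander n} (ev e)) (δ l)

schurCoefficient-linear : ∀ {n} (f g h : Pol n) k → (∀ φ → ⟦ f ⟧ φ ≡ ⟦ g ⟧ φ + k * ⟦ h ⟧ φ) → ∀ l →
  schurCoefficient f l ≡ schurCoefficient g l + k * schurCoefficient h l
schurCoefficient-linear {n} f g h k e l = begin
  ⟦ V ⊛ f ⟧ (δ l)                                   ≡⟨ ⟦⊛⟧ V f (δ l) ⟩
  ⟦ V ⟧ (λ u → ⟦ f ⟧ (λ w → δ l (u ⊕ w)))           ≡⟨ ⟦⟧-cong V (λ u → e (λ w → δ l (u ⊕ w))) ⟩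
  ⟦ V ⟧ (λ u → G u + k * H u)                       ≡⟨ ⟦⟧-+ V G (λ u → k * H u) ⟩
  ⟦ V ⟧ G + ⟦ V ⟧ (λ u → k * H u)                   ≡⟨ cong (⟦ V ⟧ G +_) (⟦⟧-*ˡ V k H) ⟩
  ⟦ V ⟧ G + k * ⟦ V ⟧ H                             ≡⟨ cong₂ (λ x y → x + k * y) (⟦⊛⟧ V g (δ l)) (⟦⊛⟧ V h (δ l)) ⟨
  ⟦ V ⊛ g ⟧ (δ l) + k * ⟦ V ⊛ h ⟧ (δ l)             ∎
  where
  open ≡-Reasoning
  V = vander n
  G H : Test n
  G u = ⟦ g ⟧ (λ w → δ l (u ⊕ w))
  H u = ⟦ h ⟧ (λ w → δ l (u ⊕ w))

module PositivityTheorem (n : ℕ) (Y : Set) (ys : List Y) (q : Fin n → Fin n → Y → Y → ℤ)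
                         (q-transpose : ∀ a b y z → q a b y z ≡ q b a z y) where
  open Positivity n Y ys q q-transpose public

  private variable
    p : ℕ

  form-comm : (m : Vec Bool p) (ω η : State p) → ∀ l → schurCoefficient (form m ω η) l ≡ schurCoefficient (form m η ω) l
  form-comm m ω η = schurCoefficient-cong (λ φ → trans (⟦form⟧ m ω η φ)
    (trans (pairing-comm m ω η φ) (sym (⟦form⟧ m η ω φ))))

  shifted-coefficientʳ : (m : Vec Bool p) (k : ℤ) {ω η : State p} → Invariant ω → Invariant η → ∀ l →
    schurCoefficient (form m ω (shifted m k η)) l ≡ (eigenvalue m l + k) * schurCoefficient (form m ω η) l
  shifted-coefficientʳ m k {ω} {η} inv-ω inv-η l = trans
    (schurCoefficient-linear (form m ω (shifted m k η)) (form m ω (casimir m η)) (form m ω η) k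
      (λ φ → trans (⟦form⟧ m ω (shifted m k η) φ) (trans (pairing-linear m ω (casimir m η) η k φ)
        (sym (cong₂ (λ x y → x + k * y) (⟦form⟧ m ω (casimir m η) φ) (⟦form⟧ m ω η φ))))) l)
    (trans (cong (_+ k * schurCoefficient (form m ω η) l) (casimir-coefficient m inv-ω inv-η l))
      (sym (ℤP.*-distribʳ-+ (schurCoefficient (form m ω η) l) (eigenvalue m l) k)))

  -- The operator acts in both arguments of the form, so its eigenvalue appears squared and its sign
  -- is irrelevant.
  shifted-coefficient : (m : Vec Bool p) (k : ℤ) {ω : State p} → Invariant ω → ∀ l →
    schurCoefficient (form m (shifted m k ω) (shifted m k ω)) l ≡
    (eigenvalue m l + k) * ((eigenvalue m l + k) * schurCoefficient (form m ω ω) l)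
  shifted-coefficient m k {ω} inv l = trans (shifted-coefficientʳ m k (shifted-invariant m k inv) inv l)
    (cong ((eigenvalue m l + k) *_) (trans (form-comm m (shifted m k ω) ω l) (shifted-coefficientʳ m k inv inv l)))

  filtered : Vec Bool p → List ℤ → State p → State p
  filtered m []       ω = ω
  filtered m (k ∷ ks) ω = filtered m ks (shifted m k ω)

  filtered-invariant : (m : Vec Bool p) → ∀ ks {ω} → Invariant ω → Invariant (filtered m ks ω)
  filtered-invariant m []       inv = inv
  filtered-invariant m (k ∷ ks) inv = filtered-invariant m ks (shifted-invariant m k inv)

  gain : ℤ → List ℤ → ℤ
  gain e []       = 1ℤ
  gain e (k ∷ ks) = (e + k) * gain e ks

  filtered-coefficient : (m : Vec Bool p) → ∀ ks {ω} → Invariant ω → ∀ l →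
    schurCoefficient (form m (filtered m ks ω) (filtered m ks ω)) l ≡
    gain (eigenvalue m l) ks * gain (eigenvalue m l) ks * schurCoefficient (form m ω ω) l
  filtered-coefficient m []       inv l = sym (ℤP.*-identityˡ _)
  filtered-coefficient m (k ∷ ks) {ω} inv l = trans (filtered-coefficient m ks (shifted-invariant m k inv) l)
    (trans (cong (gain (eigenvalue m l) ks * gain (eigenvalue m l) ks *_) (shifted-coefficient m k inv l))
      (regroup (gain (eigenvalue m l) ks) (eigenvalue m l + k) (schurCoefficient (form m ω ω) l)))
    where
    regroup : ∀ g e x → g * g * (e * (e * x)) ≡ e * g * (e * g) * x
    regroup = solve-∀

  deletions : Vec Bool p → List (Vec Bool p)
  deletions []          = []
  deletions (true ∷ m)  = (false ∷ m) ∷ L.map (true ∷_) (deletions m)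
  deletions (false ∷ m) = L.map (false ∷_) (deletions m)

  deletions-count : (m : Vec Bool p) → All (λ m′ → suc (count m′) ≡ count m) (deletions m)
  deletions-count []          = []
  deletions-count (true ∷ m)  = refl ∷ AllP.map⁺ (All.map (cong suc) (deletions-count m))
  deletions-count (false ∷ m) = AllP.map⁺ (deletions-count m)

  -- The product rule: the weight is a product of one variable per marked position, and each term of
  -- the derivative drops one of them.
  ∇-wt : (m : Vec Bool p) (ks : Word p) (φ : Test n) → ∇ φ (wt m ks) ≡ ∑ (deletions m) (λ m′ → φ (wt m′ ks))
  ∇-wt []          []             φ = ∇-𝟘 n φ
  ∇-wt (true ∷ m)  ((v , y) ∷ ks) φ = trans (∇-inc φ v (wt m ks))
    (cong (φ (wt m ks) +_) (trans (∇-wt m ks (φ ∘ inc v)) (sym (∑-map (true ∷_) (deletions m)))))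
  ∇-wt (false ∷ m) (k ∷ ks)       φ = trans (∇-wt m ks φ) (sym (∑-map (false ∷_) (deletions m)))

  derivative : Vec Bool p → State p → Pol n
  derivative m ω = Casimir.sum (deletions m) (λ m′ → form m′ ω ω)

  ⟦derivative⟧ : (m : Vec Bool p) (ω : State p) (φ : Test n) → ⟦ derivative m ω ⟧ φ ≡ ⟦ form m ω ω ⟧ (∇ φ)
  ⟦derivative⟧ {p} m ω φ = begin
    ⟦ derivative m ω ⟧ φ
      ≡⟨ trans (⟦sum⟧ (deletions m) (λ m′ → form m′ ω ω) φ) (∑-cong (deletions m) (λ m′ → ⟦form⟧ m′ ω ω φ)) ⟩
    ∑ (deletions m) (λ m′ → ∑ (words p) (λ ks → ω ks * ω ks * φ (wt m′ ks)))
      ≡⟨ ∑-swap (deletions m) (words p) ⟩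
    ∑ (words p) (λ ks → ∑ (deletions m) (λ m′ → ω ks * ω ks * φ (wt m′ ks)))
      ≡⟨ ∑-cong (words p) (λ ks → trans (∑-*ˡ (deletions m) (ω ks * ω ks)) (cong (ω ks * ω ks *_) (sym (∇-wt m ks φ)))) ⟩
    pairing m ω ω (∇ φ)
      ≡⟨ ⟦form⟧ m ω ω (∇ φ) ⟨
    ⟦ form m ω ω ⟧ (∇ φ) ∎
    where open ≡-Reasoning

  private
    wt-unmarked : (m : Vec Bool p) → count m ≡ 0 → ∀ ks → wt m ks ≡ 𝟘
    wt-unmarked []          e []       = refl
    wt-unmarked (false ∷ m) e (k ∷ ks) = wt-unmarked m e ks

    -- Without marked positions the form is the constant ∑ ω², and V itself has the staircase as its
    -- only strict exponent.
    base : (m : Vec Bool p) → count m ≡ 0 → (ω : State p) → ∀ l → Strict l → 0ℤ ≤ schurCoefficient (form m ω ω) l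
    base {p} m e ω l s = subst (0ℤ ≤_) (sym value) (nonneg (VP.≡-dec ℕP._≟_ (staircase n) l))
      where
      open ≡-Reasoning
      N = ∑ (words p) (λ ks → ω ks * ω ks)
      value : schurCoefficient (form m ω ω) l ≡ N * δ (staircase n) l
      value = begin
        ⟦ vander n ⊛ form m ω ω ⟧ (δ l)
          ≡⟨ ⟦⊛⟧ (vander n) (form m ω ω) (δ l) ⟩
        ⟦ vander n ⟧ (λ u → ⟦ form m ω ω ⟧ (λ w → δ l (u ⊕ w)))
          ≡⟨ ⟦⟧-cong (vander n) (λ u → trans (⟦form⟧ m ω ω (λ w → δ l (u ⊕ w)))
               (trans (∑-cong (words p) (λ ks → cong (λ w → ω ks * ω ks * δ l w)
                 (trans (cong (u ⊕_) (wt-unmarked m e ks)) (trans (⊕-comm u 𝟘) (⊕-identityˡ u)))))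
               (∑-*ʳ (words p) (δ l u)))) ⟩
        ⟦ vander n ⟧ (λ u → N * δ l u)
          ≡⟨ ⟦⟧-*ˡ (vander n) N (δ l) ⟩
        N * ⟦ vander n ⟧ (δ l)
          ≡⟨ cong (N *_) (trans (⟦vander⟧ n (δ l)) (trans (cong (λ ls → altEval n ls (δ l)) (sym (toList-staircase n)))
               (altEval-strict n (staircase n) l (staircase-strict n) s))) ⟩
        N * δ (staircase n) l ∎
      nonneg : Dec (staircase n ≡ l) → 0ℤ ≤ N * δ (staircase n) l
      nonneg (yes refl) = subst (0ℤ ≤_) (sym (trans (cong (N *_) (δ-refl (staircase n))) (ℤP.*-identityʳ N)))
        (∑-nonneg (words p) (λ ks _ → square-nonneg (ω ks)))
      nonneg (no  ne)   = subst (0ℤ ≤_) (sym (trans (cong (N *_) (δ-≢ (staircase n) l ne)) (ℤP.*-zeroʳ N))) ℤP.≤-refl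

    -- The polynomial has degree count m, so V times it has no term of degree deg V.
    degree : (m : Vec Bool p) → ∀ t → count m ≡ suc t → (ω : State p) → schurCoefficient (form m ω ω) (staircase n) ≡ 0ℤ
    degree {p} m t e ω = conclude (schurCoefficient f (staircase n)) (trans (sym left) right)
      where
      open ≡-Reasoning
      f = form m ω ω
      V = vander n
      φ = δ (staircase n)
      Φ : Vec ℕ n → ℤ
      Φ u = ⟦ f ⟧ (λ w → φ (u ⊕ w))
      left : ⟦ V ⊛ f ⟧ (λ u → total u * φ u) ≡ total (staircase n) * ⟦ V ⊛ f ⟧ φ
      left = trans (⟦⟧-cong (V ⊛ f) (δ-subst total (staircase n))) (⟦⟧-*ˡ (V ⊛ f) (total (staircase n)) φ)
      homogeneous : ∀ ψ → ⟦ f ⟧ (λ w → total w * ψ w) ≡ ⁺ suc t * ⟦ f ⟧ ψ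
      homogeneous ψ = trans (⟦form⟧ m ω ω (λ w → total w * ψ w)) (trans
        (∑-cong (words p) (λ ks → trans (cong (λ s → ω ks * ω ks * (s * ψ (wt m ks))) (trans (total-wt m ks) (cong ⁺_ e)))
          (move (ω ks * ω ks) (⁺ suc t) (ψ (wt m ks)))))
        (trans (∑-*ˡ (words p) (⁺ suc t)) (cong (⁺ suc t *_) (sym (⟦form⟧ m ω ω ψ)))))
        where
        move : ∀ x s y → x * (s * y) ≡ s * (x * y)
        move = solve-∀
      right : ⟦ V ⊛ f ⟧ (λ u → total u * φ u) ≡ total (staircase n) * ⟦ V ⊛ f ⟧ φ + ⁺ suc t * ⟦ V ⊛ f ⟧ φ
      right = begin
        ⟦ V ⊛ f ⟧ (λ u → total u * φ u) ≡⟨ ⟦⊛⟧ V f _ ⟩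
        ⟦ V ⟧ (λ u → ⟦ f ⟧ (λ w → total (u ⊕ w) * φ (u ⊕ w)))
          ≡⟨ ⟦⟧-cong V (λ u → trans (⟦⟧-cong f (λ w → trans (cong (_* φ (u ⊕ w)) (total-⊕ u w))
               (ℤP.*-distribʳ-+ (φ (u ⊕ w)) (total u) (total w))))
             (trans (⟦⟧-+ f (λ w → total u * φ (u ⊕ w)) (λ w → total w * φ (u ⊕ w)))
               (cong₂ _+_ (⟦⟧-*ˡ f (total u) (λ w → φ (u ⊕ w))) (homogeneous (λ w → φ (u ⊕ w)))))) ⟩
        ⟦ V ⟧ (λ u → total u * Φ u + ⁺ suc t * Φ u)
          ≡⟨ ⟦⟧-+ V (λ u → total u * Φ u) (λ u → ⁺ suc t * Φ u) ⟩
        ⟦ V ⟧ (λ u → total u * Φ u) + ⟦ V ⟧ (λ u → ⁺ suc t * Φ u)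
          ≡⟨ cong₂ _+_ (trans (vander-weight ⁺_ Φ) (cong (λ ls → sumOf ⁺_ ls * ⟦ V ⟧ Φ) (sym (toList-staircase n))))
                       (⟦⟧-*ˡ V (⁺ suc t) Φ) ⟩
        total (staircase n) * ⟦ V ⟧ Φ + ⁺ suc t * ⟦ V ⟧ Φ
          ≡⟨ cong (λ x → total (staircase n) * x + ⁺ suc t * x) (⟦⊛⟧ V f φ) ⟨
        total (staircase n) * ⟦ V ⊛ f ⟧ φ + ⁺ suc t * ⟦ V ⊛ f ⟧ φ ∎
      conclude : ∀ c → total (staircase n) * c ≡ total (staircase n) * c + ⁺ suc t * c → c ≡ 0ℤ
      conclude c h = ℤP.*-cancelˡ-≡ (⁺ suc t) c 0ℤ (trans (isolate (total (staircase n) * c) (⁺ suc t * c))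
        (trans (cong (_- total (staircase n) * c) (sym h)) (trans (ℤP.+-inverseʳ (total (staircase n) * c)) (sym (ℤP.*-zeroʳ (⁺ suc t))))))
        where
        isolate : ∀ x y → y ≡ (x + y) - x
        isolate = solve-∀

  -- To isolate one summand in the coefficient of the derivative at m, apply to ω the
  -- polynomial in the Casimir operator that kills all the others.
  form-positive : ∀ t (mask : Vec Bool p) → count mask ≡ t → {ω : State p} → Invariant ω →
    ∀ l → Strict l → 0ℤ ≤ schurCoefficient (form mask ω ω) l
  form-positive zero    mask e {ω} inv l s = base mask e ω l s
  form-positive (suc t) mask e {ω} inv l s with removable l s
  ... | inj₁ refl = subst (0ℤ ≤_) (sym (degree mask t e ω)) ℤP.≤-refl
  ... | inj₂ (a , m , s′ , refl) = ℤP.*-cancelˡ-≤-pos 0ℤ (schurCoefficient (form mask ω ω) (inc a m)) (⁺ suc K)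
      (subst₂ _≤_ (sym (ℤP.*-zeroʳ (⁺ suc K))) evaluated nonneg)
    where
    others : List (Fin n)
    others = L.filter (λ b → ¬? (b FP.≟ a)) (L.allFin n)
    -- One root for each c ≠ a, whether or not `inc c m` is strict, so coefficients at non-strict
    -- neighbours of `m` are removed as well.
    constants : List ℤ
    constants = L.map (λ b → - eigenvalue mask (inc b m)) others
    Ω = filtered mask constants ω

    factor : ∀ c b → eigenvalue mask (inc c m) + - eigenvalue mask (inc b m) ≡ sq (inc c m) - sq (inc b m)
    factor c b = cancel (sq (inc c m)) (sq (inc b m)) _
      where
      cancel : ∀ x y z → (x - z) + - (y - z) ≡ x - y
      cancel = solve-∀

    killed : ∀ c bs → c ∈ bs → gain (eigenvalue mask (inc c m)) (L.map (λ b → - eigenvalue mask (inc b m)) bs) ≡ 0ℤ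
    killed c (b ∷ bs) (here refl) = cong (_* gain (eigenvalue mask (inc c m)) (L.map (λ b → - eigenvalue mask (inc b m)) bs))
      (ℤP.+-inverseʳ (eigenvalue mask (inc c m)))
    killed c (b ∷ bs) (there c∈) = trans (cong ((eigenvalue mask (inc c m) + - eigenvalue mask (inc b m)) *_) (killed c bs c∈))
      (ℤP.*-zeroʳ (eigenvalue mask (inc c m) + - eigenvalue mask (inc b m)))

    survives : ∀ bs → All (_≢ a) bs → gain (eigenvalue mask (inc a m)) (L.map (λ b → - eigenvalue mask (inc b m)) bs) ≢ 0ℤ
    survives []       _           ()
    survives (b ∷ bs) (b≢a ∷ ne) z with ℤP.i*j≡0⇒i≡0∨j≡0 (eigenvalue mask (inc a m) + - eigenvalue mask (inc b m)) z
    ... | inj₁ z₁ = sq-inc-≢ m s′ a b (b≢a ∘ sym) (trans (sym (factor a b)) z₁)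
    ... | inj₂ z₂ = survives bs ne z₂

    G : Fin n → ℤ
    G c = gain (eigenvalue mask (inc c m)) constants
    G-positive : ∃ λ k → G a * G a ≡ ⁺ suc k
    G-positive = square-positive (G a) (survives others (AllP.all-filter (λ b → ¬? (b FP.≟ a)) (L.allFin n)))
    -- Chosen so that `suc K` computes to (m_a + 1) times the square of `G a`.
    K : ℕ
    K = proj₁ G-positive ℕ.+ lookup m a ℕ.* suc (proj₁ G-positive)

    nonneg : 0ℤ ≤ schurCoefficient (derivative mask Ω) m
    nonneg = subst (0ℤ ≤_) (sym (⊛-sum (vander n) (deletions mask) (λ m′ → form m′ Ω Ω) (δ m)))
      (∑-nonneg (deletions mask) (λ m′ m′∈ → form-positive t m′
        (ℕP.suc-injective (trans (All.lookup (deletions-count mask) m′∈) e)) (filtered-invariant mask constants inv) m s′))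

    evaluated : schurCoefficient (derivative mask Ω) m ≡ ⁺ suc K * schurCoefficient (form mask ω ω) (inc a m)
    evaluated = begin
      schurCoefficient (derivative mask Ω) m
        ≡⟨ vander-∇ (form mask Ω Ω) (derivative mask Ω) (⟦derivative⟧ mask Ω) m ⟩
      ∑ (L.allFin n) (λ c → ⁺ suc (lookup m c) * schurCoefficient (form mask Ω Ω) (inc c m))
        ≡⟨ ∑-cong (L.allFin n) (λ c → cong (⁺ suc (lookup m c) *_) (filtered-coefficient mask constants inv (inc c m))) ⟩
      ∑ (L.allFin n) (λ c → ⁺ suc (lookup m c) * (G c * G c * schurCoefficient (form mask ω ω) (inc c m)))
        ≡⟨ ∑-single a _ (λ c c≢a → trans (cong (λ g → ⁺ suc (lookup m c) * (g * G c * schurCoefficient (form mask ω ω) (inc c m)))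
             (killed c others (∈P.∈-filter⁺ (λ b → ¬? (b FP.≟ a)) (∈P.∈-allFin c) c≢a))) (ℤP.*-zeroʳ (⁺ suc (lookup m c)))) ⟩
      ⁺ suc (lookup m a) * (G a * G a * schurCoefficient (form mask ω ω) (inc a m))
        ≡⟨ cong (λ g → ⁺ suc (lookup m a) * (g * schurCoefficient (form mask ω ω) (inc a m))) (proj₂ G-positive) ⟩
      ⁺ suc (lookup m a) * (⁺ suc (proj₁ G-positive) * schurCoefficient (form mask ω ω) (inc a m))
        ≡⟨ ℤP.*-assoc (⁺ suc (lookup m a)) (⁺ suc (proj₁ G-positive)) _ ⟨
      ⁺ suc (lookup m a) * ⁺ suc (proj₁ G-positive) * schurCoefficient (form mask ω ω) (inc a m) ∎
      where open ≡-Reasoning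

-- Annihilation operators of the exterior algebra

Subset : ℕ → Set
Subset n = Vec Bool n

-- Jordan-Wigner factors: the exterior algebra is a tensor power of a plane spanned by "absent" and
-- "present". `lower` removes a present coordinate, and `diag` is the sign for passing it.
eqB lower diag : Bool → Bool → ℤ
eqB true  true  = 1ℤ
eqB false false = 1ℤ
eqB _     _     = 0ℤ
lower false true = 1ℤ
lower _     _    = 0ℤ
diag true  true  = - 1ℤ
diag false false = 1ℤ
diag _     _     = 0ℤ

eqS : Subset n → Subset n → ℤ
eqS []      []      = 1ℤ
eqS (x ∷ S) (y ∷ T) = eqB x y * eqS S T

-- J v R S is the coefficient of e_R in the contraction of e_S with the v-th coordinate.
J : Fin n → Subset n → Subset n → ℤ
J zero    (x ∷ R) (y ∷ S) = lower x y * eqS R S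
J (suc v) (x ∷ R) (y ∷ S) = diag x y * J v R S

mem : Fin n → Subset n → ℤ
mem v S = marked (lookup S v)

∑-allSubsets : (G : Subset (suc n) → ℤ) →
  ∑ (allSubsets (suc n)) G ≡ ∑ (allSubsets n) (λ S → G (true ∷ S) + G (false ∷ S))
∑-allSubsets {n} G = trans (∑-concatMap _ (allSubsets n))
  (∑-cong (allSubsets n) (λ S → cong (G (true ∷ S) +_) (ℤP.+-identityʳ (G (false ∷ S)))))

∑-tensor : (G : Subset (suc n) → ℤ) (h : Bool → ℤ) (g : Subset n → ℤ) → (∀ x S → G (x ∷ S) ≡ h x * g S) →
  ∑ (allSubsets (suc n)) G ≡ (h true + h false) * ∑ (allSubsets n) g
∑-tensor {n} G h g e = trans (∑-allSubsets G) (trans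
  (∑-cong (allSubsets n) (λ S → trans (cong₂ _+_ (e true S) (e false S)) (sym (ℤP.*-distribʳ-+ (g S) (h true) (h false)))))
  (∑-*ˡ (allSubsets n) (h true + h false)))

eqS-refl : (S : Subset n) → eqS S S ≡ 1ℤ
eqS-refl []          = refl
eqS-refl (true ∷ S)  = trans (ℤP.*-identityˡ (eqS S S)) (eqS-refl S)
eqS-refl (false ∷ S) = trans (ℤP.*-identityˡ (eqS S S)) (eqS-refl S)

eqS-≢ : (S T : Subset n) → S ≢ T → eqS S T ≡ 0ℤ
eqS-≢ []          []          ne = ⊥-elim (ne refl)
eqS-≢ (true ∷ S)  (false ∷ T) ne = refl
eqS-≢ (false ∷ S) (true ∷ T)  ne = refl
eqS-≢ (true ∷ S)  (true ∷ T)  ne = trans (ℤP.*-identityˡ (eqS S T)) (eqS-≢ S T (ne ∘ cong (true ∷_)))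
eqS-≢ (false ∷ S) (false ∷ T) ne = trans (ℤP.*-identityˡ (eqS S T)) (eqS-≢ S T (ne ∘ cong (false ∷_)))

∑-eqS : (R : Subset n) (g : Subset n → ℤ) → ∑ (allSubsets n) (λ S → eqS R S * g S) ≡ g R
∑-eqS []          g = trans (ℤP.+-identityʳ _) (ℤP.*-identityˡ (g []))
∑-eqS {suc n} (true ∷ R)  g = trans (∑-allSubsets (λ S → eqS (true ∷ R) S * g S)) (trans
  (∑-cong (allSubsets n) (λ S → first (eqS R S) (g (true ∷ S)))) (∑-eqS R (λ S → g (true ∷ S))))
  where
  first : ∀ e a → 1ℤ * e * a + 0ℤ ≡ e * a
  first = solve-∀
∑-eqS {suc n} (false ∷ R) g = trans (∑-allSubsets (λ S → eqS (false ∷ R) S * g S)) (trans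
  (∑-cong (allSubsets n) (λ S → second (eqS R S) (g (false ∷ S)))) (∑-eqS R (λ S → g (false ∷ S))))
  where
  second : ∀ e a → 0ℤ + 1ℤ * e * a ≡ e * a
  second = solve-∀

eqS-sym : (R S : Subset n) → eqS R S ≡ eqS S R
eqS-sym []      []      = refl
eqS-sym (x ∷ R) (y ∷ S) = cong₂ _*_ (eqB-sym x y) (eqS-sym R S)
  where
  eqB-sym : ∀ x y → eqB x y ≡ eqB y x
  eqB-sym true  true  = refl
  eqB-sym true  false = refl
  eqB-sym false true  = refl
  eqB-sym false false = refl

private
  mix : ∀ a c b d → (a * c) * (b * d) ≡ (a * b) * (c * d)
  mix = solve-∀

  -- Products of tensor product matrices are formed factor by factor. The relations of the operators
  -- `J` thereby reduce to finite checks on 2 × 2 matrices.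
  compose : (A B : Bool → ℤ) (C D : Subset n → ℤ) (G : Subset (suc n) → ℤ) →
    (∀ x S → G (x ∷ S) ≡ (A x * C S) * (B x * D S)) → ∀ {z} → ∑ (allSubsets n) (λ S → C S * D S) ≡ z →
    ∑ (allSubsets (suc n)) G ≡ (A true * B true + A false * B false) * z
  compose A B C D G e tail = trans (∑-tensor G (λ x → A x * B x) (λ S → C S * D S)
    (λ x S → trans (e x S) (mix (A x) (C S) (B x) (D S)))) (cong ((A true * B true + A false * B false) *_) tail)

  add-heads : ∀ {X X′} h h′ k z → X ≡ h * z → X′ ≡ h′ * z → h + h′ ≡ k → X + X′ ≡ k * z
  add-heads h h′ k z e e′ f = trans (cong₂ _+_ e e′) (trans (sym (ℤP.*-distribʳ-+ z h h′)) (cong (_* z) f))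

  eqSʳ : (g : Subset n → ℤ) (R : Subset n) → ∑ (allSubsets n) (λ S → g S * eqS S R) ≡ g R
  eqSʳ {n} g R = trans (∑-cong (allSubsets n) (λ S → trans (ℤP.*-comm (g S) (eqS S R)) (cong (_* g S) (eqS-sym S R)))) (∑-eqS R g)

JJ : Fin n → Fin n → Subset n → Subset n → ℤ
JJ {n} v w R S = ∑ (allSubsets n) (λ T → J v R T * J w T S)

JJᵗ JᵗJ : Fin n → Fin n → Subset n → Subset n → ℤ
JJᵗ {n} v w R S = ∑ (allSubsets n) (λ T → J v R T * J w S T)
JᵗJ {n} v w R S = ∑ (allSubsets n) (λ T → J v T R * J w T S)

private
  JJ-anti₀ : (w : Fin n) (R S : Subset (suc n)) → JJ zero (suc w) R S ≡ - JJ (suc w) zero R S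
  JJ-anti₀ w (x ∷ R) (y ∷ S) = begin
    JJ zero (suc w) (x ∷ R) (y ∷ S)
      ≡⟨ compose (lower x) (λ t → diag t y) (eqS R) (λ T → J w T S) _ (λ t T → refl) (∑-eqS R (λ T → J w T S)) ⟩
    (lower x true * diag true y + lower x false * diag false y) * J w R S
      ≡⟨ cong (_* J w R S) (opposite x y) ⟩
    - (diag x true * lower true y + diag x false * lower false y) * J w R S
      ≡⟨ ℤP.neg-distribˡ-* (diag x true * lower true y + diag x false * lower false y) (J w R S) ⟨
    - ((diag x true * lower true y + diag x false * lower false y) * J w R S)
      ≡⟨ cong -_ (compose (diag x) (λ t → lower t y) (J w R) (λ T → eqS T S) _ (λ t T → refl) (eqSʳ (J w R) S)) ⟨
    - JJ (suc w) zero (x ∷ R) (y ∷ S) ∎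
    where
    open ≡-Reasoning
    opposite : ∀ x y → lower x true * diag true y + lower x false * diag false y ≡
                       - (diag x true * lower true y + diag x false * lower false y)
    opposite true  true  = refl
    opposite true  false = refl
    opposite false true  = refl
    opposite false false = refl

-- Two contractions anticommute: `lower` has square zero, and it anticommutes with the sign `diag`
-- which the later coordinate places on the earlier one.
JJ-anti : (v w : Fin n) (R S : Subset n) → JJ v w R S ≡ - JJ w v R S
JJ-anti zero zero (x ∷ R) (y ∷ S) = trans value (cong -_ (sym value))
  where
  nilpotent : ∀ x y → lower x true * lower true y + lower x false * lower false y ≡ 0ℤ
  nilpotent true  true  = refl
  nilpotent true  false = refl
  nilpotent false true  = refl
  nilpotent false false = refl
  value : JJ zero zero (x ∷ R) (y ∷ S) ≡ 0ℤ
  value = trans (compose (lower x) (λ t → lower t y) (eqS R) (λ T → eqS T S) _ (λ t T → refl) refl)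
    (cong (_* ∑ (allSubsets _) (λ T → eqS R T * eqS T S)) (nilpotent x y))
JJ-anti zero (suc w) R S = JJ-anti₀ w R S
JJ-anti (suc v) zero R S = trans (sym (ℤP.neg-involutive _)) (cong -_ (sym (JJ-anti₀ v R S)))
JJ-anti (suc v) (suc w) (x ∷ R) (y ∷ S) = begin
  JJ (suc v) (suc w) (x ∷ R) (y ∷ S)
    ≡⟨ compose (diag x) (λ t → diag t y) (J v R) (λ T → J w T S) _ (λ t T → refl) refl ⟩
  D * JJ v w R S       ≡⟨ cong (D *_) (JJ-anti v w R S) ⟩
  D * - JJ w v R S     ≡⟨ ℤP.neg-distribʳ-* D (JJ w v R S) ⟨
  - (D * JJ w v R S)   ≡⟨ cong -_ (compose (diag x) (λ t → diag t y) (J w R) (λ T → J v T S) _ (λ t T → refl) refl) ⟨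
  - JJ (suc w) (suc v) (x ∷ R) (y ∷ S) ∎
  where
  open ≡-Reasoning
  D = diag x true * diag true y + diag x false * diag false y

-- The canonical anticommutation relation.
J-anticommutator : (v w : Fin n) (R S : Subset n) → JJᵗ v w R S + JᵗJ w v R S ≡ eqF v w * eqS R S
J-anticommutator zero zero (x ∷ R) (y ∷ S) = trans
  (add-heads (lower x true * lower y true + lower x false * lower y false)
             (lower true x * lower true y + lower false x * lower false y) (eqB x y) (eqS R S)
    (compose (lower x) (lower y) (eqS R) (eqS S) _ (λ t T → refl) (trans (∑-eqS R (eqS S)) (eqS-sym S R)))
    (compose (λ t → lower t x) (λ t → lower t y) (λ T → eqS T R) (λ T → eqS T S) _ (λ t T → refl)
      (trans (eqSʳ (λ T → eqS T R) S) (eqS-sym S R)))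
    (heads x y))
  (sym (ℤP.*-identityˡ _))
  where
  heads : ∀ x y → (lower x true * lower y true + lower x false * lower y false)
                  + (lower true x * lower true y + lower false x * lower false y) ≡ eqB x y
  heads true  true  = refl
  heads true  false = refl
  heads false true  = refl
  heads false false = refl
J-anticommutator zero (suc w) (x ∷ R) (y ∷ S) =
  add-heads (lower x true * diag y true + lower x false * diag y false)
            (diag true x * lower true y + diag false x * lower false y) 0ℤ (J w S R)
    (compose (lower x) (diag y) (eqS R) (J w S) _ (λ t T → refl) (∑-eqS R (J w S)))
    (compose (λ t → diag t x) (λ t → lower t y) (λ T → J w T R) (λ T → eqS T S) _ (λ t T → refl) (eqSʳ (λ T → J w T R) S))
    (heads x y)
  where
  heads : ∀ x y → (lower x true * diag y true + lower x false * diag y false)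
                  + (diag true x * lower true y + diag false x * lower false y) ≡ 0ℤ
  heads true  true  = refl
  heads true  false = refl
  heads false true  = refl
  heads false false = refl
J-anticommutator (suc v) zero (x ∷ R) (y ∷ S) =
  add-heads (diag x true * lower y true + diag x false * lower y false)
            (lower true x * diag true y + lower false x * diag false y) 0ℤ (J v R S)
    (compose (diag x) (lower y) (J v R) (eqS S) _ (λ t T → refl)
      (trans (∑-cong (allSubsets _) (λ T → ℤP.*-comm (J v R T) (eqS S T))) (∑-eqS S (J v R))))
    (compose (λ t → lower t x) (λ t → diag t y) (λ T → eqS T R) (λ T → J v T S) _ (λ t T → refl)
      (trans (∑-cong (allSubsets _) (λ T → ℤP.*-comm (eqS T R) (J v T S))) (eqSʳ (λ T → J v T S) R)))
    (heads x y)
  where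
  heads : ∀ x y → (diag x true * lower y true + diag x false * lower y false)
                  + (lower true x * diag true y + lower false x * diag false y) ≡ 0ℤ
  heads true  true  = refl
  heads true  false = refl
  heads false true  = refl
  heads false false = refl
J-anticommutator (suc v) (suc w) (x ∷ R) (y ∷ S) = trans (cong₂ _+_
    (trans (compose (diag x) (diag y) (J v R) (J w S) _ (λ t T → refl) refl) (cong (_* JJᵗ v w R S) (left x y)))
    (trans (compose (λ t → diag t x) (λ t → diag t y) (λ T → J w T R) (λ T → J v T S) _ (λ t T → refl) refl)
      (cong (_* JᵗJ w v R S) (right x y))))
  (trans (sym (ℤP.*-distribˡ-+ (eqB x y) (JJᵗ v w R S) (JᵗJ w v R S)))
    (trans (cong (eqB x y *_) (J-anticommutator v w R S)) (swap (eqB x y) (eqF v w) (eqS R S))))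
  where
  swap : ∀ a b c → a * (b * c) ≡ b * (a * c)
  swap = solve-∀
  left : ∀ x y → diag x true * diag y true + diag x false * diag y false ≡ eqB x y
  left true  true  = refl
  left true  false = refl
  left false true  = refl
  left false false = refl
  right : ∀ x y → diag true x * diag true y + diag false x * diag false y ≡ eqB x y
  right true  true  = refl
  right true  false = refl
  right false true  = refl
  right false false = refl

-- The matrix of the elementary matrix a b acting on the exterior algebra.
exterior : Fin n → Fin n → Subset n → Subset n → ℤ
exterior = JᵗJ

exterior-transpose : (a b : Fin n) (R S : Subset n) → exterior a b R S ≡ exterior b a S R
exterior-transpose a b R S = ∑-cong (allSubsets _) (λ T → ℤP.*-comm (J a T R) (J b T S))

-- Since `exterior a b` is creation at a after annihilation at b, moving the contraction by v past
-- the creation operator yields the term δ_va by the anticommutation relation, and the two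
-- annihilation operators then swap. The two signs cancel.
J-equivariant : (a b v : Fin n) (R S : Subset n) →
  eqF v a * J b R S + ∑ (allSubsets n) (λ T → exterior a b R T * J v T S) ≡
  ∑ (allSubsets n) (λ T → J v R T * exterior a b T S)
J-equivariant {n} a b v R S = sym (begin
  ∑ X (λ T → J v R T * ∑ X (λ U → J a U T * J b U S))
    ≡⟨ ∑-cong X (λ T → trans (sym (∑-*ˡ X (J v R T))) (∑-cong X (λ U → sym (ℤP.*-assoc (J v R T) (J a U T) (J b U S))))) ⟩
  ∑ X (λ T → ∑ X (λ U → J v R T * J a U T * J b U S))
    ≡⟨ trans (∑-swap X X) (∑-cong X (λ U → ∑-*ʳ X (J b U S))) ⟩
  ∑ X (λ U → JJᵗ v a R U * J b U S)
    ≡⟨ ∑-cong X (λ U → cong (_* J b U S) (solveFor (JJᵗ v a R U) (JᵗJ a v R U) (eqF v a * eqS R U) (J-anticommutator v a R U))) ⟩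
  ∑ X (λ U → (eqF v a * eqS R U - JᵗJ a v R U) * J b U S)
    ≡⟨ trans (∑-cong X (λ U → split (eqF v a) (eqS R U) (JᵗJ a v R U) (J b U S)))
         (trans (∑-+ X) (cong₂ _+_ (trans (∑-*ˡ X (eqF v a)) (cong (eqF v a *_) (∑-eqS R (λ U → J b U S)))) (∑-neg X))) ⟩
  eqF v a * J b R S - ∑ X (λ U → JᵗJ a v R U * J b U S)
    ≡⟨ cong (λ s → eqF v a * J b R S - s) (reassociate v b) ⟩
  eqF v a * J b R S - ∑ X (λ W → J a W R * JJ v b W S)
    ≡⟨ cong (eqF v a * J b R S +_) (trans (sym (∑-neg X)) (∑-cong X (λ W → trans
         (ℤP.neg-distribʳ-* (J a W R) (JJ v b W S)) (cong (J a W R *_) (sym (JJ-anti b v W S)))))) ⟩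
  eqF v a * J b R S + ∑ X (λ W → J a W R * JJ b v W S)
    ≡⟨ cong (eqF v a * J b R S +_) (reassociate b v) ⟨
  eqF v a * J b R S + ∑ X (λ T → exterior a b R T * J v T S) ∎)
  where
  open ≡-Reasoning
  X = allSubsets n
  solveFor : ∀ x y z → x + y ≡ z → x ≡ z - y
  solveFor x y z e = trans (add x y) (cong (_- y) e)
    where
    add : ∀ x y → x ≡ (x + y) - y
    add = solve-∀
  split : ∀ f e t j → (f * e - t) * j ≡ f * (e * j) + - (t * j)
  split = solve-∀
  reassociate : ∀ v b → ∑ X (λ U → JᵗJ a v R U * J b U S) ≡ ∑ X (λ W → J a W R * JJ v b W S)
  reassociate v b = trans (∑-cong X (λ U → sym (∑-*ʳ X (J b U S)))) (trans (∑-swap X X) (∑-cong X (λ W →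
    trans (∑-cong X (λ U → ℤP.*-assoc (J a W R) (J v W U) (J b U S))) (∑-*ˡ X (J a W R)))))

-- Creation after annihilation at v is the projection onto the sets containing v. This makes
-- distinct columns orthogonal and produces the sum of x_v over v in S from the column S.
J-gram : (v : Fin n) (S T : Subset n) → JᵗJ v v S T ≡ eqS S T * mem v S
J-gram zero (x ∷ S) (y ∷ T) = trans
  (compose (λ t → lower t x) (λ t → lower t y) (λ R → eqS R S) (λ R → eqS R T) _ (λ t R → refl) (trans (eqSʳ (λ R → eqS R S) T) (eqS-sym T S)))
  (trans (cong (_* eqS S T) (heads x y)) (swap (eqB x y) (marked x) (eqS S T)))
  where
  swap : ∀ a b c → a * b * c ≡ a * c * b
  swap = solve-∀
  heads : ∀ x y → lower true x * lower true y + lower false x * lower false y ≡ eqB x y * marked x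
  heads true  true  = refl
  heads true  false = refl
  heads false true  = refl
  heads false false = refl
J-gram (suc v) (x ∷ S) (y ∷ T) = trans
  (compose (λ t → diag t x) (λ t → diag t y) (λ R → J v R S) (λ R → J v R T) _ (λ t R → refl) refl)
  (trans (cong₂ _*_ (heads x y) (J-gram v S T)) (sym (ℤP.*-assoc (eqB x y) (eqS S T) (mem v S))))
  where
  heads : ∀ x y → diag true x * diag true y + diag false x * diag false y ≡ eqB x y
  heads true  true  = refl
  heads true  false = refl
  heads false true  = refl
  heads false false = refl

J-card : (v : Fin n) (R S : Subset n) → J v R S ≡ 0ℤ ⊎ card S ≡ suc (card R)
J-card zero (true ∷ R)  (y ∷ S)     = inj₁ refl
J-card zero (false ∷ R) (false ∷ S) = inj₁ refl
J-card zero (false ∷ R) (true ∷ S)  with VP.≡-dec Bool._≟_ R S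
... | yes refl = inj₂ refl
... | no  R≢S  = inj₁ (trans (ℤP.*-identityˡ (eqS R S)) (eqS-≢ R S R≢S))
J-card (suc v) (true ∷ R)  (false ∷ S) = inj₁ refl
J-card (suc v) (false ∷ R) (true ∷ S)  = inj₁ refl
J-card (suc v) (true ∷ R)  (true ∷ S)  with J-card v R S
... | inj₁ z = inj₁ (trans (cong (- 1ℤ *_) z) refl)
... | inj₂ e = inj₂ (cong suc e)
J-card (suc v) (false ∷ R) (false ∷ S) with J-card v R S
... | inj₁ z = inj₁ (trans (cong (1ℤ *_) z) refl)
... | inj₂ e = inj₂ e

exterior-card : (a b : Fin n) (R S : Subset n) → card R ≢ card S → exterior a b R S ≡ 0ℤ
exterior-card a b R S ne = ∑-zero (allSubsets _) vanish
  where
  vanish : ∀ T → J a T R * J b T S ≡ 0ℤ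
  vanish T with J-card a T R | J-card b T S
  ... | inj₁ z | _      = cong (_* J b T S) z
  ... | inj₂ _ | inj₁ z = trans (cong (J a T R *_) z) (ℤP.*-zeroʳ (J a T R))
  ... | inj₂ e | inj₂ f = ⊥-elim (ne (trans e (sym f)))

-- A nonzero term would need one set T obtained from S by deleting a and also by deleting b.
exterior-diagonal : (a b : Fin n) → a ≢ b → (S : Subset n) → exterior a b S S ≡ 0ℤ
exterior-diagonal a b a≢b S = ∑-zero (allSubsets _) (λ T → vanish a b a≢b T S)
  where
  vanish : ∀ {n} (a b : Fin n) → a ≢ b → (T S : Subset n) → J a T S * J b T S ≡ 0ℤ
  vanish zero    zero    ne T S = ⊥-elim (ne refl)
  vanish zero    (suc b) ne (x ∷ T) (y ∷ S) = trans (mix (lower x y) (eqS T S) (diag x y) (J b T S))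
    (cong (_* (eqS T S * J b T S)) (heads x y))
    where
    heads : ∀ x y → lower x y * diag x y ≡ 0ℤ
    heads true  true  = refl
    heads true  false = refl
    heads false true  = refl
    heads false false = refl
  vanish (suc a) zero    ne (x ∷ T) (y ∷ S) = trans (ℤP.*-comm (J (suc a) (x ∷ T) (y ∷ S)) _) (vanish zero (suc a) (ne ∘ sym) (x ∷ T) (y ∷ S))
  vanish (suc a) (suc b) ne (x ∷ T) (y ∷ S) = trans (mix (diag x y) (J a T S) (diag x y) (J b T S))
    (trans (cong (diag x y * diag x y *_) (vanish a b (ne ∘ cong suc) T S)) (ℤP.*-zeroʳ (diag x y * diag x y)))

-- Minors of the contraction matrix as invariant states

CardClosed : ∀ {n} → List (Subset n) → Set
CardClosed cols = ∀ S T → S ∈ cols → card T ≡ card S → T ∈ cols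

module _ {A : Set} where
  det-repeatedʳ : ∀ rs as (t : A) bs → t ∈ bs → det rs (as ++ t ∷ bs) ≡ 0ℤ
  det-repeatedʳ rs as t (b ∷ bs) (here refl) = det-alternating rs as t bs
  det-repeatedʳ rs as t (b ∷ bs) (there t∈)  = trans (det-skew rs as t b bs)
    (cong -_ (trans (cong (det rs) (sym (LP.++-assoc as (b ∷ []) (t ∷ bs)))) (det-repeatedʳ rs (as ++ b ∷ []) t bs t∈)))

  det-repeatedˡ : ∀ rs as (t : A) bs → t ∈ as → det rs (as ++ t ∷ bs) ≡ 0ℤ
  det-repeatedˡ rs as t bs t∈ with ∈P.∈-∃++ t∈
  ... | as₁ , as₂ , refl = trans (cong (det rs) (LP.++-assoc as₁ (t ∷ as₂) (t ∷ bs)))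
    (det-repeatedʳ rs as₁ t (as₂ ++ t ∷ bs) (∈P.∈-++⁺ʳ as₂ (here refl)))

  -- The unsigned counterpart of `pick`, needed where two equal Laplace signs multiply to 1.
  remove : List A → (A → List A → ℤ) → ℤ
  remove []       H = 0ℤ
  remove (a ∷ as) H = H a as + remove as (λ c r → H c (a ∷ r))

  remove-const : ∀ as {H : A → List A → ℤ} z → (∀ c r → Picked as c r → H c r ≡ z) → remove as H ≡ ⁺ L.length as * z
  remove-const []       z e = refl
  remove-const (a ∷ as) z e = trans (cong₂ _+_ (e a as here) (remove-const as z (λ c r p → e c (a ∷ r) (there p))))
    (sym (ℤP.suc-* (⁺ L.length as) z))

  picked-∈ : ∀ {as : List A} {c r} → Picked as c r → c ∈ as
  picked-∈ here      = here refl
  picked-∈ (there p) = there (picked-∈ p)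

  picked-unique : ∀ {as : List A} {c r} → Unique as → Picked as c r → Unique r
  picked-unique (_ ∷ un)   here      = un
  picked-unique (new ∷ un) (there p) = picked-all p new ∷ picked-unique un p
    where
    picked-all : ∀ {as : List A} {c r} {P : A → Set} → Picked as c r → All P as → All P r
    picked-all here      (_ ∷ ps)  = ps
    picked-all (there p) (px ∷ ps) = px ∷ picked-all p ps

  picked-length : ∀ {as : List A} {c r} → Picked as c r → L.length as ≡ suc (L.length r)
  picked-length here      = refl
  picked-length (there p) = cong suc (picked-length p)

  -- In a product of two Laplace expansions over the same distinct columns, only equal picks
  -- contribute, and then both signs agree.
  pick-diagonal : ∀ as → Unique as → (h : A → A → List A → List A → ℤ) →
    (∀ c c′ r r′ → c ≢ c′ → h c c′ r r′ ≡ 0ℤ) →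
    pick as (λ c r → pick as (λ c′ r′ → h c c′ r r′)) ≡ remove as (λ c r → h c c r r)
  pick-diagonal []       un         h z = refl
  pick-diagonal (a ∷ as) (new ∷ un) h z = begin
    (h a a as as - pick as (λ c′ r′ → h a c′ as (a ∷ r′)))
      - pick as (λ c r → h c a (a ∷ r) as - pick as (λ c′ r′ → h c c′ (a ∷ r) (a ∷ r′)))
      ≡⟨ cong₂ (λ s t → (h a a as as - s) - t)
           (pick-zeroᴾ as (λ c′ r′ p → z a c′ as (a ∷ r′) (All.lookup new (picked-∈ p))))
           (trans (pick-congᴾ as (λ c r p → trans (cong (_- pick as (λ c′ r′ → h c c′ (a ∷ r) (a ∷ r′)))
               (z c a (a ∷ r) as (All.lookup new (picked-∈ p) ∘ sym))) (ℤP.+-identityˡ _))) (pick-neg as)) ⟩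
    (h a a as as - 0ℤ) - - pick as (λ c r → pick as (λ c′ r′ → h c c′ (a ∷ r) (a ∷ r′)))
      ≡⟨ simplify (h a a as as) _ ⟩
    h a a as as + pick as (λ c r → pick as (λ c′ r′ → h c c′ (a ∷ r) (a ∷ r′)))
      ≡⟨ cong (h a a as as +_) (pick-diagonal as un (λ c c′ r r′ → h c c′ (a ∷ r) (a ∷ r′)) (λ c c′ r r′ → z c c′ (a ∷ r) (a ∷ r′))) ⟩
    h a a as as + remove as (λ c r → h c c (a ∷ r) (a ∷ r)) ∎
    where
    open ≡-Reasoning
    simplify : ∀ x y → (x - 0ℤ) - - y ≡ x + y
    simplify = solve-∀

module DeterminantState (n : ℕ) where
  -- The second space of the letters is the exterior algebra, so that a letter (v , R) indexes a row
  -- of the contraction matrix.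
  open PositivityTheorem n (Subset n) (allSubsets n) exterior exterior-transpose public

  private variable
    p : ℕ

  row : Letter → Subset n → ℤ
  row (v , R) S = J v R S

  rows : Word p → List (Subset n → ℤ)
  rows []       = []
  rows (k ∷ ks) = row k ∷ rows ks

  detState : List (Subset n) → State p
  detState cols ks = det (rows ks) cols

  T-linear : ∀ a b k (ω η : State p) ks → T a b (λ r → k * ω r + η r) ks ≡ k * T a b ω ks + T a b η ks
  T-linear {p} a b k ω η ks = trans (sym (E+F m a b (λ r → k * ω r + η r) ks)) (trans
    (cong₂ _+_ (trans (E-+ m a b (λ r → k * ω r) η ks) (cong (_+ E m a b η ks) (E-*ˡ m a b k ω ks))) (F-linear m a b k ω η ks))
    (trans (regroup k (E m a b ω ks) (E m a b η ks) (F m a b ω ks) (F m a b η ks))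
      (cong₂ (λ x y → k * x + y) (E+F m a b ω ks) (E+F m a b η ks))))
    where
    m = V.replicate p true
    regroup : ∀ k x y z w → (k * x + y) + (k * z + w) ≡ k * (x + z) + (y + w)
    regroup = solve-∀

  T-cong : ∀ a b {ω η : State p} → (∀ ks → ω ks ≡ η ks) → ∀ ks → T a b ω ks ≡ T a b η ks
  T-cong {p} a b {ω} {η} e ks = trans (sym (E+F m a b ω ks)) (trans (cong₂ _+_ (E-cong m a b e ks) (F-cong m a b e ks)) (E+F m a b η ks))
    where
    m = V.replicate p true

  T-zero : ∀ a b (ks : Word p) → T a b (λ _ → 0ℤ) ks ≡ 0ℤ
  T-zero a b ks = trans (T-linear a b (- 1ℤ) (λ _ → 0ℤ) (λ _ → 0ℤ) ks) (cancel (T a b (λ _ → 0ℤ) ks))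
    where
    cancel : ∀ x → - 1ℤ * x + x ≡ 0ℤ
    cancel = solve-∀

  T-pick : ∀ a b {A : Set} (as : List A) (h : A → ℤ) (g : List A → State p) ks →
    T a b (λ r → pick as (λ c as′ → h c * g as′ r)) ks ≡ pick as (λ c as′ → h c * T a b (g as′) ks)
  T-pick a b []       h g ks = T-zero a b ks
  T-pick a b (x ∷ as) h g ks = begin
    T a b (λ r → h x * g as r - P r) ks
      ≡⟨ T-cong a b (λ r → cong (h x * g as r +_) (sym (trans (ℤP.+-identityʳ (- 1ℤ * P r)) (ℤP.-1*i≡-i (P r))))) ks ⟩
    T a b (λ r → h x * g as r + (- 1ℤ * P r + 0ℤ)) ks
      ≡⟨ T-linear a b (h x) (g as) (λ r → - 1ℤ * P r + 0ℤ) ks ⟩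
    h x * T a b (g as) ks + T a b (λ r → - 1ℤ * P r + 0ℤ) ks
      ≡⟨ cong (h x * T a b (g as) ks +_) (trans (T-linear a b (- 1ℤ) P (λ _ → 0ℤ) ks)
           (trans (cong₂ _+_ (ℤP.-1*i≡-i (T a b P ks)) (T-zero a b ks)) (ℤP.+-identityʳ _))) ⟩
    h x * T a b (g as) ks - T a b P ks
      ≡⟨ cong (λ s → h x * T a b (g as) ks - s) (T-pick a b as h (λ r → g (x ∷ r)) ks) ⟩
    pick (x ∷ as) (λ c as′ → h c * T a b (g as′) ks) ∎
    where
    open ≡-Reasoning
    P : State _
    P r = pick as (λ c as′ → h c * g (x ∷ as′) r)

  -- The derivation replacing one column at a time by its image under exterior a b.
  columnwise : Fin n → Fin n → (List (Subset n) → ℤ) → List (Subset n) → ℤ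
  columnwise a b g []       = 0ℤ
  columnwise a b g (c ∷ cs) =
    ∑ (allSubsets n) (λ S → exterior a b S c * g (S ∷ cs)) + columnwise a b (λ r → g (c ∷ r)) cs

  columnwise-zero : ∀ a b {g} → (∀ cs → g cs ≡ 0ℤ) → ∀ cs → columnwise a b g cs ≡ 0ℤ
  columnwise-zero a b e []       = refl
  columnwise-zero a b e (c ∷ cs) = cong₂ _+_
    (∑-zero (allSubsets n) (λ S → trans (cong (exterior a b S c *_) (e (S ∷ cs))) (ℤP.*-zeroʳ (exterior a b S c))))
    (columnwise-zero a b (λ r → e (c ∷ r)) cs)

  columnwise-sub : ∀ a b k (g h : List (Subset n) → ℤ) cs →
    columnwise a b (λ r → k * g r - h r) cs ≡ k * columnwise a b g cs - columnwise a b h cs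
  columnwise-sub a b k g h []       = sym (cong (_- 0ℤ) (ℤP.*-zeroʳ k))
  columnwise-sub a b k g h (c ∷ cs) = trans
    (cong₂ _+_ (trans (∑-cong (allSubsets n) (λ S → split (exterior a b S c) k (g (S ∷ cs)) (h (S ∷ cs))))
        (trans (∑-+ (allSubsets n)) (cong₂ _+_ (∑-*ˡ (allSubsets n) k) (∑-neg (allSubsets n)))))
      (columnwise-sub a b k (λ r → g (c ∷ r)) (λ r → h (c ∷ r)) cs))
    (regroup k _ _ (columnwise a b (λ r → g (c ∷ r)) cs) (columnwise a b (λ r → h (c ∷ r)) cs))
    where
    split : ∀ e k x y → e * (k * x - y) ≡ k * (e * x) + - (e * y)
    split = solve-∀
    regroup : ∀ k x y z w → (k * x - y) + (k * z - w) ≡ k * (x + z) - (y + w)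
    regroup = solve-∀

  -- The column replaced is either the picked one, where the replacement acts on the row entry, or
  -- one of those left in the minor.
  columnwise-pick : ∀ a b (h : Subset n → ℤ) (k : List (Subset n) → ℤ) cs →
    columnwise a b (λ r → pick r (λ c r′ → h c * k r′)) cs ≡
    pick cs (λ c r → ∑ (allSubsets n) (λ S → h S * exterior a b S c) * k r + h c * columnwise a b k r)
  columnwise-pick a b h k []       = refl
  columnwise-pick a b h k (c ∷ cs) = begin
    ∑ X (λ S → e S c * (h S * k cs - pick cs (λ d r → h d * k (S ∷ r))))
      + columnwise a b (λ r → h c * k r - pick r (λ d r′ → h d * k (c ∷ r′))) cs
      ≡⟨ cong₂ _+_ (trans (∑-cong X (λ S → split (e S c) (h S) (k cs) (pick cs (λ d r → h d * k (S ∷ r)))))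
             (trans (∑-+ X) (cong₂ _+_ (∑-*ʳ X (k cs)) (∑-neg X))))
           (trans (columnwise-sub a b (h c) k _ cs) (cong (λ s → h c * columnwise a b k cs - s) (columnwise-pick a b h (λ r → k (c ∷ r)) cs))) ⟩
    (H c * k cs - ∑ X (λ S → e S c * pick cs (λ d r → h d * k (S ∷ r))))
      + (h c * columnwise a b k cs - pick cs (λ d r → H d * k (c ∷ r) + h d * columnwise a b (λ r′ → k (c ∷ r′)) r))
      ≡⟨ regroup (H c * k cs) _ (h c * columnwise a b k cs) _ ⟩
    (H c * k cs + h c * columnwise a b k cs)
      - (∑ X (λ S → e S c * pick cs (λ d r → h d * k (S ∷ r))) + pick cs (λ d r → H d * k (c ∷ r) + h d * columnwise a b (λ r′ → k (c ∷ r′)) r))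
      ≡⟨ cong (λ s → (H c * k cs + h c * columnwise a b k cs) - s) merge ⟩
    (H c * k cs + h c * columnwise a b k cs) - pick cs (λ d r → H d * k (c ∷ r) + h d * columnwise a b k (c ∷ r)) ∎
    where
    open ≡-Reasoning
    X = allSubsets n
    e = exterior a b
    H : Subset n → ℤ
    H c = ∑ X (λ S → h S * e S c)
    split : ∀ e h k p → e * (h * k - p) ≡ h * e * k + - (e * p)
    split = solve-∀
    regroup : ∀ x y z w → (x - y) + (z - w) ≡ (x + z) - (y + w)
    regroup = solve-∀
    collect : ∀ x y h z → h * x + (y + h * z) ≡ y + h * (x + z)
    collect = solve-∀
    merge : ∑ X (λ S → e S c * pick cs (λ d r → h d * k (S ∷ r))) + pick cs (λ d r → H d * k (c ∷ r) + h d * columnwise a b (λ r′ → k (c ∷ r′)) r)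
          ≡ pick cs (λ d r → H d * k (c ∷ r) + h d * columnwise a b k (c ∷ r))
    merge = trans (cong (_+ pick cs (λ d r → H d * k (c ∷ r) + h d * columnwise a b (λ r′ → k (c ∷ r′)) r))
        (trans (∑-cong X (λ S → sym (pick-*ˡ cs (e S c)))) (sym (pick-∑ X cs))))
      (trans (sym (pick-+ cs)) (pick-cong cs (λ d r → trans
        (cong (_+ (H d * k (c ∷ r) + h d * columnwise a b (λ r′ → k (c ∷ r′)) r))
          (trans (∑-cong X (λ S → swap (e S c) (h d) (k (S ∷ r)))) (∑-*ˡ X (h d))))
        (collect (∑ X (λ S → e S c * k (S ∷ r))) (H d * k (c ∷ r)) (h d) (columnwise a b (λ r′ → k (c ∷ r′)) r)))))
      where
      swap : ∀ x y z → x * (y * z) ≡ y * (x * z)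
      swap = solve-∀

  -- By `J-equivariant`, acting on the letter of a row equals acting on the columns of that row.
  -- Summed over all rows, the action on words becomes a derivation on the columns.
  T-detState : ∀ a b cols (ks : Word p) → T a b (detState cols) ks ≡ columnwise a b (det (rows ks)) cols
  T-detState a b []       []       = refl
  T-detState a b (c ∷ cs) []       = sym (cong₂ _+_ (∑-zero (allSubsets n) (λ S → ℤP.*-zeroʳ (exterior a b S c)))
    (columnwise-zero a b (λ _ → refl) cs))
  T-detState a b cols ((v , R) ∷ ks) = begin
    (eqF v a * pick cols (λ c r → J b R c * D r) + ∑ X (λ Z → exterior a b R Z * pick cols (λ c r → J v Z c * D r)))
      + T a b (λ r → pick cols (λ c r′ → J v R c * detState r′ r)) ks
      ≡⟨ cong₂ _+_ headpart (trans (T-pick a b cols (J v R) detState ks)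
           (pick-cong cols (λ c r → cong (J v R c *_) (T-detState a b r ks)))) ⟩
    pick cols (λ c r → ∑ X (λ S → J v R S * exterior a b S c) * D r) + pick cols (λ c r → J v R c * columnwise a b D r)
      ≡⟨ pick-+ cols ⟨
    pick cols (λ c r → ∑ X (λ S → J v R S * exterior a b S c) * D r + J v R c * columnwise a b D r)
      ≡⟨ columnwise-pick a b (J v R) D cols ⟨
    columnwise a b (λ r → pick r (λ c r′ → J v R c * D r′)) cols ∎
    where
    open ≡-Reasoning
    X = allSubsets n
    D : List (Subset n) → ℤ
    D = det (rows ks)
    headpart : eqF v a * pick cols (λ c r → J b R c * D r) + ∑ X (λ Z → exterior a b R Z * pick cols (λ c r → J v Z c * D r))
             ≡ pick cols (λ c r → ∑ X (λ S → J v R S * exterior a b S c) * D r)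
    headpart = trans (cong₂ _+_ (sym (pick-*ˡ cols (eqF v a)))
        (trans (∑-cong X (λ Z → sym (pick-*ˡ cols (exterior a b R Z)))) (sym (pick-∑ X cols))))
      (trans (sym (pick-+ cols)) (pick-cong cols (λ c r → trans
        (cong₂ _+_ (sym (ℤP.*-assoc (eqF v a) (J b R c) (D r)))
          (trans (∑-cong X (λ Z → sym (ℤP.*-assoc (exterior a b R Z) (J v Z c) (D r)))) (∑-*ʳ X (D r))))
        (trans (sym (ℤP.*-distribʳ-+ (D r) (eqF v a * J b R c) (∑ X (λ Z → exterior a b R Z * J v Z c))))
          (cong (_* D r) (J-equivariant a b v R c))))))

  columnwise-vanish : ∀ a b (g : List (Subset n) → ℤ) cols →
    (∀ as c bs → cols ≡ as ++ c ∷ bs → ∀ S → exterior a b S c * g (as ++ S ∷ bs) ≡ 0ℤ) → columnwise a b g cols ≡ 0ℤ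
  columnwise-vanish a b g []       z = refl
  columnwise-vanish a b g (c ∷ cs) z = cong₂ _+_ (∑-zero (allSubsets n) (z [] c cs refl))
    (columnwise-vanish a b (λ r → g (c ∷ r)) cs (λ as d bs e → z (c ∷ as) d bs (cong (c ∷_) e)))

  -- An off-diagonal elementary matrix replaces a column by another one already present.
  detState-invariant : ∀ {cols} → CardClosed cols → Invariant {p} (detState cols)
  detState-invariant {p} {cols} closed a b a≢b ks = trans (T-detState a b cols ks)
    (columnwise-vanish a b (det (rows ks)) cols vanish)
    where
    vanish : ∀ as c bs → cols ≡ as ++ c ∷ bs → ∀ S → exterior a b S c * det (rows ks) (as ++ S ∷ bs) ≡ 0ℤ
    vanish as c bs e S with card S ℕ.≟ card c
    ... | no  ne = cong (_* det (rows ks) (as ++ S ∷ bs)) (exterior-card a b S c ne)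
    ... | yes eq with ∈P.∈-++⁻ as (subst (S ∈_) e (closed c S (subst (c ∈_) (sym e) (∈P.∈-++⁺ʳ as (here refl))) eq))
    ...   | inj₁ S∈as         = trans (cong (exterior a b S c *_) (det-repeatedˡ (rows ks) as S bs S∈as)) (ℤP.*-zeroʳ (exterior a b S c))
    ...   | inj₂ (here refl)  = cong (_* det (rows ks) (as ++ S ∷ bs)) (exterior-diagonal a b a≢b S)
    ...   | inj₂ (there S∈bs) = trans (cong (exterior a b S c *_) (det-repeatedʳ (rows ks) as S bs S∈bs)) (ℤP.*-zeroʳ (exterior a b S c))

-- Boolean products

embed : Poly n → Pol n
embed = L.map (λ α → 1ℤ , α)

⟦embed⟧ : (p : Poly n) (φ : Test n) → ⟦ embed p ⟧ φ ≡ ∑ p φ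
⟦embed⟧ p φ = trans (⟦map⟧ p (λ _ → 1ℤ) id φ) (∑-cong p (λ α → ℤP.*-identityˡ (φ α)))

∑-cartesianProductWith : {A B C : Set} (f : A → B → C) (as : List A) (bs : List B) {g : C → ℤ} →
  ∑ (L.cartesianProductWith f as bs) g ≡ ∑ as (λ a → ∑ bs (λ b → g (f a b)))
∑-cartesianProductWith f []       bs = refl
∑-cartesianProductWith f (a ∷ as) bs {g} = trans (∑-++ (L.map (f a) bs) _)
  (cong₂ _+_ (∑-map (f a) bs) (∑-cartesianProductWith f as bs))

embed-* : (p q : Poly n) → embed (p *P q) ≋ embed p ⊛ embed q
embed-* p q = ev λ φ → trans (⟦embed⟧ (p *P q) φ) (trans (∑-cartesianProductWith _⊕_ p q)
  (sym (trans (⟦⊛⟧ (embed p) (embed q) φ) (trans (⟦embed⟧ p _) (∑-cong p (λ u → ⟦embed⟧ q (λ w → φ (u ⊕ w))))))))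

unit : (v : Fin n) → V.tabulate (λ j → if ⌊ v FP.≟ j ⌋ then 1 else 0) ≡ inc v 𝟘
unit {suc n} zero    = cong (1 ∷_) (zeros n)
  where
  zeros : ∀ n → V.tabulate {n = n} (λ j → 0) ≡ 𝟘
  zeros zero    = refl
  zeros (suc n) = cong (0 ∷_) (zeros n)
unit {suc n} (suc v) = cong (0 ∷_) (trans (VP.tabulate-cong (λ j → same j)) (unit v))
  where
  same : ∀ j → (if ⌊ suc v FP.≟ suc j ⌋ then 1 else 0) ≡ (if ⌊ v FP.≟ j ⌋ then 1 else 0)
  same j with v FP.≟ j
  ... | yes _ = refl
  ... | no  _ = refl

⟦linSum⟧ : (S : Subset n) (φ : Test n) → ⟦ embed (linSum S) ⟧ φ ≡ ∑ (L.allFin n) (λ v → mem v S * φ (inc v 𝟘))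
⟦linSum⟧ {n} S φ = trans (⟦embed⟧ (linSum S) φ) (trans (∑-concatMap _ (L.allFin n)) (∑-cong (L.allFin n) term))
  where
  term : ∀ v → ∑ (if lookup S v then var v else []) φ ≡ mem v S * φ (inc v 𝟘)
  term v with lookup S v
  ... | true  = trans (ℤP.+-identityʳ _) (trans (cong φ (unit v)) (sym (ℤP.*-identityˡ (φ (inc v 𝟘)))))
  ... | false = refl

⟦linSum⊛⟧ : (S : Subset n) (q : Pol n) (φ : Test n) →
  ⟦ embed (linSum S) ⊛ q ⟧ φ ≡ ∑ (L.allFin n) (λ v → mem v S * ⟦ q ⟧ (φ ∘ inc v))
⟦linSum⊛⟧ {n} S q φ = trans (⟦⊛⟧ (embed (linSum S)) q φ) (trans (⟦linSum⟧ S (λ u → ⟦ q ⟧ (λ w → φ (u ⊕ w))))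
  (∑-cong (L.allFin n) (λ v → cong (mem v S *_) (⟦⟧-cong q (λ w → cong φ (trans (inc-⊕ v 𝟘 w) (cong (inc v) (⊕-identityˡ w))))))))

boolean : List (Subset n) → Pol n
boolean cols = embed (prodP (L.map linSum cols))

boolean-∷ : (c : Subset n) (cols : List (Subset n)) → boolean (c ∷ cols) ≋ embed (linSum c) ⊛ boolean cols
boolean-∷ c cols = embed-* (linSum c) (prodP (L.map linSum cols))

boolean-picked : ∀ {cols : List (Subset n)} {c r} → Picked cols c r → boolean cols ≋ embed (linSum c) ⊛ boolean r
boolean-picked {cols = c ∷ cols} here = boolean-∷ c cols
boolean-picked {cols = a ∷ cols} {c} {_ ∷ r} (there p) = begin
  boolean (a ∷ cols)                                       ≈⟨ boolean-∷ a cols ⟩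
  embed (linSum a) ⊛ boolean cols                          ≈⟨ PR.*-congˡ (boolean-picked p) ⟩
  embed (linSum a) ⊛ (embed (linSum c) ⊛ boolean r)        ≈⟨ PR.*-assoc (embed (linSum a)) (embed (linSum c)) (boolean r) ⟨
  (embed (linSum a) ⊛ embed (linSum c)) ⊛ boolean r        ≈⟨ PR.*-congʳ (PR.*-comm (embed (linSum a)) (embed (linSum c))) ⟩
  (embed (linSum c) ⊛ embed (linSum a)) ⊛ boolean r        ≈⟨ PR.*-assoc (embed (linSum c)) (embed (linSum a)) (boolean r) ⟩
  embed (linSum c) ⊛ (embed (linSum a) ⊛ boolean r)        ≈⟨ PR.*-congˡ (PR.sym (boolean-∷ a r)) ⟩
  embed (linSum c) ⊛ boolean (a ∷ r)                       ∎
  where open import Relation.Binary.Reasoning.Setoid (PR.setoid)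

module Norm (n : ℕ) where
  open DeterminantState n public

  private
    X = allSubsets n

    gram : ∀ v (c c′ : Subset n) → ∑ X (λ R → J v R c * J v R c′) ≡ eqS c c′ * mem v c
    gram = J-gram

  full : ∀ p → Vec Bool p
  full p = V.replicate p true

  -- Andréief's identity, with the orthogonality of the columns.
  detState-norm : ∀ p (cols : List (Subset n)) → Unique cols → L.length cols ≡ p → (φ : Test n) →
    pairing (full p) (detState cols) (detState cols) φ ≡ ⁺ (p !) * ⟦ boolean cols ⟧ φ
  detState-norm zero    []   un len φ = trans (simplify (φ 𝟘)) (cong (1ℤ *_) (sym (trans (⟦embed⟧ oneP φ) (ℤP.+-identityʳ (φ 𝟘)))))
    where
    simplify : ∀ x → 1ℤ * 1ℤ * x + 0ℤ ≡ 1ℤ * x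
    simplify = solve-∀
  detState-norm (suc p) cols un len φ = begin
    pairing (full (suc p)) (detState cols) (detState cols) φ
      ≡⟨ ∑-words {p} _ ⟩
    ∑ Vs (λ v → ∑ X (λ R → ∑ (words p) (λ ks →
      pick cols (λ c r → J v R c * D r ks) * pick cols (λ c r → J v R c * D r ks) * φ (inc v (wt (full p) ks)))))
      ≡⟨ ∑-cong Vs (λ v → ∑-cong X (λ R → trans (∑-cong (words p) (λ ks → distribute v R ks)) (pull v R))) ⟩
    ∑ Vs (λ v → ∑ X (λ R → pick cols (λ c r → pick cols (λ c′ r′ → J v R c * J v R c′ * M r r′ v))))
      ≡⟨ trans (∑-cong Vs (λ v → trans (sym (pick-∑ X cols)) (pick-cong cols (λ c r → sym (pick-∑ X cols)))))
               (trans (sym (pick-∑ Vs cols)) (pick-cong cols (λ c r → sym (pick-∑ Vs cols)))) ⟩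
    pick cols (λ c r → pick cols (λ c′ r′ → ∑ Vs (λ v → ∑ X (λ R → J v R c * J v R c′ * M r r′ v))))
      ≡⟨ pick-cong cols (λ c r → pick-cong cols (λ c′ r′ → ∑-cong Vs (λ v → trans (∑-*ʳ X (M r r′ v)) (cong (_* M r r′ v) (gram v c c′))))) ⟩
    pick cols (λ c r → pick cols (λ c′ r′ → ∑ Vs (λ v → eqS c c′ * mem v c * M r r′ v)))
      -- Different columns are orthogonal, so only the terms picking the same column twice remain.
      ≡⟨ pick-diagonal cols un _ (λ c c′ r r′ ne → ∑-zero Vs (λ v → cong (λ e → e * mem v c * M r r′ v) (eqS-≢ c c′ ne))) ⟩
    remove cols (λ c r → ∑ Vs (λ v → eqS c c * mem v c * M r r v))
      -- Every choice of the first column yields the same product after induction on the others, and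
      -- there are p + 1 choices: this is where (p + 1)! arises.
      ≡⟨ remove-const cols (⁺ (p !) * ⟦ boolean cols ⟧ φ) each ⟩
    ⁺ L.length cols * (⁺ (p !) * ⟦ boolean cols ⟧ φ)
      ≡⟨ ℤP.*-assoc (⁺ L.length cols) (⁺ (p !)) _ ⟨
    ⁺ L.length cols * ⁺ (p !) * ⟦ boolean cols ⟧ φ
      ≡⟨ cong (_* ⟦ boolean cols ⟧ φ) (trans (cong (λ k → ⁺ k * ⁺ (p !)) len) (sym (ℤP.pos-* (suc p) (p !)))) ⟩
    ⁺ (suc p !) * ⟦ boolean cols ⟧ φ ∎
    where
    open ≡-Reasoning
    Vs = L.allFin n
    D : List (Subset n) → Word p → ℤ
    D r ks = det (rows ks) r
    M : List (Subset n) → List (Subset n) → Fin n → ℤ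
    M r r′ v = pairing (full p) (detState r) (detState r′) (φ ∘ inc v)
    distribute : ∀ v R ks → pick cols (λ c r → J v R c * D r ks) * pick cols (λ c r → J v R c * D r ks) * φ (inc v (wt (full p) ks)) ≡
      pick cols (λ c r → pick cols (λ c′ r′ → J v R c * J v R c′ * (D r ks * D r′ ks * φ (inc v (wt (full p) ks)))))
    distribute v R ks = trans (move P f) (trans (sym (pick-*ˡ cols (P * f))) (pick-cong cols (λ c r →
      trans (move′ P f (J v R c * D r ks)) (trans (sym (pick-*ˡ cols (J v R c * D r ks * f)))
        (pick-cong cols (λ c′ r′ → mixed (J v R c) (D r ks) f (J v R c′) (D r′ ks)))))))
      where
      P = pick cols (λ c r → J v R c * D r ks)
      f = φ (inc v (wt (full p) ks))
      move : ∀ x f → x * x * f ≡ x * f * x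
      move = solve-∀
      move′ : ∀ x f y → x * f * y ≡ y * f * x
      move′ = solve-∀
      mixed : ∀ a d f a′ d′ → a * d * f * (a′ * d′) ≡ a * a′ * (d * d′ * f)
      mixed = solve-∀
    pull : ∀ v R → ∑ (words p) (λ ks → pick cols (λ c r → pick cols (λ c′ r′ → J v R c * J v R c′ * (D r ks * D r′ ks * φ (inc v (wt (full p) ks))))))
      ≡ pick cols (λ c r → pick cols (λ c′ r′ → J v R c * J v R c′ * M r r′ v))
    pull v R = trans (sym (pick-∑ (words p) cols)) (pick-cong cols (λ c r → trans (sym (pick-∑ (words p) cols))
      (pick-cong cols (λ c′ r′ → ∑-*ˡ (words p) (J v R c * J v R c′)))))
    each : ∀ c r → Picked cols c r → ∑ Vs (λ v → eqS c c * mem v c * M r r v) ≡ ⁺ (p !) * ⟦ boolean cols ⟧ φ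
    each c r pk = begin
      ∑ Vs (λ v → eqS c c * mem v c * M r r v)
        ≡⟨ ∑-cong Vs (λ v → trans (cong₂ (λ e m → e * mem v c * m) (eqS-refl c)
             (detState-norm p r (picked-unique un pk) (ℕP.suc-injective (trans (sym (picked-length pk)) len)) (φ ∘ inc v)))
             (regroup (mem v c) (⁺ (p !)) (⟦ boolean r ⟧ (φ ∘ inc v)))) ⟩
      ∑ Vs (λ v → ⁺ (p !) * (mem v c * ⟦ boolean r ⟧ (φ ∘ inc v)))
        ≡⟨ ∑-*ˡ Vs (⁺ (p !)) ⟩
      ⁺ (p !) * ∑ Vs (λ v → mem v c * ⟦ boolean r ⟧ (φ ∘ inc v))
        ≡⟨ cong (⁺ (p !) *_) (trans (at (boolean-picked pk) φ) (⟦linSum⊛⟧ c (boolean r) φ)) ⟨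
      ⁺ (p !) * ⟦ boolean cols ⟧ φ ∎
      where
      regroup : ∀ m k x → 1ℤ * m * (k * x) ≡ k * (m * x)
      regroup = solve-∀

-- With every position marked, the form of the determinant state is p! times the Boolean product,
-- and the positive factor cancels in the inequality.
boolean-positive : (cols : List (Subset n)) → Unique cols → CardClosed cols → ∀ l → Strict l →
  0ℤ ≤ schurCoefficient (boolean cols) l
boolean-positive {n} cols un closed l s = ℤP.*-cancelˡ-≤-pos 0ℤ (schurCoefficient (boolean cols) l) (⁺ (p !)) {{factorial-positive}}
  (subst₂ _≤_ (sym (ℤP.*-zeroʳ (⁺ (p !)))) scaled
    (form-positive (count (full p)) (full p) refl (detState-invariant closed) l s))
  where
  open Norm n
  p = L.length cols
  factorial-positive : Positive (⁺ (p !))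
  factorial-positive = ℤ.positive (ℤ.+<+ (ℕ.>-nonZero⁻¹ (p !) {{ℕP._!≢0 p}}))
  scaled : schurCoefficient (form (full p) (detState cols) (detState cols)) l ≡ ⁺ (p !) * schurCoefficient (boolean cols) l
  scaled = trans (schurCoefficient-linear (form (full p) (detState cols) (detState cols)) [] (boolean cols) (⁺ (p !))
      (λ φ → trans (⟦form⟧ (full p) (detState cols) (detState cols) φ) (trans (detState-norm p cols un refl φ)
        (sym (trans (cong (_+ ⁺ (p !) * ⟦ boolean cols ⟧ φ) (⟦[]⟧ φ)) (ℤP.+-identityˡ _))))) l)
    (trans (cong (_+ ⁺ (p !) * schurCoefficient (boolean cols) l) (trans (at (PR.zeroʳ (vander n)) (δ l)) (⟦[]⟧ (δ l)))) (ℤP.+-identityˡ _))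

-- Symmetry of Boolean products

transposition : Fin n → Fin (suc n) → Fin (suc n)
transposition zero    zero          = suc zero
transposition zero    (suc zero)    = zero
transposition zero    (suc (suc j)) = suc (suc j)
transposition (suc i) zero          = zero
transposition (suc i) (suc j)       = suc (transposition i j)

∑-transposition : (i : Fin n) (g : Fin (suc n) → ℤ) → ∑ (L.allFin (suc n)) (g ∘ transposition i) ≡ ∑ (L.allFin (suc n)) g
∑-transposition {suc n} zero g = begin
  ∑ (L.allFin (suc (suc n))) (g ∘ transposition zero)
    ≡⟨ trans (∑-allFin (g ∘ transposition zero)) (cong (g (suc zero) +_) (∑-allFin (g ∘ transposition zero ∘ suc))) ⟩
  g (suc zero) + (g zero + rest) ≡⟨ exchange′ (g (suc zero)) (g zero) rest ⟩
  g zero + (g (suc zero) + rest)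
    ≡⟨ trans (∑-allFin g) (cong (g zero +_) (∑-allFin (g ∘ suc))) ⟨
  ∑ (L.allFin (suc (suc n))) g ∎
  where
  open ≡-Reasoning
  rest = ∑ (L.allFin n) (λ j → g (suc (suc j)))
  exchange′ : ∀ a b c → a + (b + c) ≡ b + (a + c)
  exchange′ = solve-∀
∑-transposition {suc n} (suc i) g = trans (∑-allFin (g ∘ transposition (suc i)))
  (trans (cong (g zero +_) (∑-transposition i (g ∘ suc))) (sym (∑-allFin g)))

inc-swap : (i : Fin n) (v : Fin (suc n)) (u : Vec ℕ (suc n)) → swapAt i (inc v u) ≡ inc (transposition i v) (swapAt i u)
inc-swap zero    zero          (x ∷ y ∷ u) = refl
inc-swap zero    (suc zero)    (x ∷ y ∷ u) = refl
inc-swap zero    (suc (suc v)) (x ∷ y ∷ u) = refl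
inc-swap (suc i) zero          (x ∷ u)     = refl
inc-swap (suc i) (suc v)       (x ∷ u)     = cong (x ∷_) (inc-swap i v u)

lookup-swap : {A : Set} (i : Fin n) (v : Fin (suc n)) (u : Vec A (suc n)) → lookup (swapAt i u) (transposition i v) ≡ lookup u v
lookup-swap zero    zero          (x ∷ y ∷ u) = refl
lookup-swap zero    (suc zero)    (x ∷ y ∷ u) = refl
lookup-swap zero    (suc (suc v)) (x ∷ y ∷ u) = refl
lookup-swap (suc i) zero          (x ∷ u)     = refl
lookup-swap (suc i) (suc v)       (x ∷ u)     = lookup-swap i v u

swapAt-involutive : {A : Set} (i : Fin n) (u : Vec A (suc n)) → swapAt i (swapAt i u) ≡ u
swapAt-involutive zero    (x ∷ y ∷ u) = refl
swapAt-involutive (suc i) (x ∷ u)     = cong (x ∷_) (swapAt-involutive i u)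

swapAt-𝟘 : (i : Fin n) → swapAt i 𝟘 ≡ 𝟘
swapAt-𝟘 {suc n} zero    = refl
swapAt-𝟘 {suc n} (suc i) = cong (0 ∷_) (swapAt-𝟘 i)

card-swap : (i : Fin n) (S : Subset (suc n)) → card (swapAt i S) ≡ card S
card-swap zero    (true ∷ true ∷ S)   = refl
card-swap zero    (true ∷ false ∷ S)  = refl
card-swap zero    (false ∷ true ∷ S)  = refl
card-swap zero    (false ∷ false ∷ S) = refl
card-swap (suc i) (true ∷ S)          = cong suc (card-swap i S)
card-swap (suc i) (false ∷ S)         = card-swap i S

boolean-swap : (i : Fin n) (cols : List (Subset (suc n))) (φ : Test (suc n)) →
  ⟦ boolean cols ⟧ (φ ∘ swapAt i) ≡ ⟦ boolean (L.map (swapAt i) cols) ⟧ φ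
boolean-swap i [] φ = trans (⟦embed⟧ oneP (φ ∘ swapAt i)) (trans (cong (λ u → φ u + 0ℤ) (swapAt-𝟘 i)) (sym (⟦embed⟧ oneP φ)))
boolean-swap {n} i (c ∷ cols) φ = begin
  ⟦ boolean (c ∷ cols) ⟧ (φ ∘ swapAt i)
    ≡⟨ trans (at (boolean-∷ c cols) (φ ∘ swapAt i)) (⟦linSum⊛⟧ c (boolean cols) (φ ∘ swapAt i)) ⟩
  ∑ Vs (λ v → mem v c * ⟦ boolean cols ⟧ (φ ∘ swapAt i ∘ inc v))
    ≡⟨ ∑-cong Vs (λ v → cong₂ _*_ (cong marked (sym (lookup-swap i v c)))
         (trans (⟦⟧-cong (boolean cols) (λ u → cong φ (inc-swap i v u)))
           (boolean-swap i cols (φ ∘ inc (transposition i v))))) ⟩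
  ∑ Vs ((λ v → mem v (swapAt i c) * ⟦ boolean (L.map (swapAt i) cols) ⟧ (φ ∘ inc v)) ∘ transposition i)
    ≡⟨ ∑-transposition i (λ v → mem v (swapAt i c) * ⟦ boolean (L.map (swapAt i) cols) ⟧ (φ ∘ inc v)) ⟩
  ∑ Vs (λ v → mem v (swapAt i c) * ⟦ boolean (L.map (swapAt i) cols) ⟧ (φ ∘ inc v))
    ≡⟨ trans (at (boolean-∷ (swapAt i c) (L.map (swapAt i) cols)) φ) (⟦linSum⊛⟧ (swapAt i c) (boolean (L.map (swapAt i) cols)) φ) ⟨
  ⟦ boolean (L.map (swapAt i) (c ∷ cols)) ⟧ φ ∎
  where
  open ≡-Reasoning
  Vs = L.allFin (suc n)

boolean-↭ : {as bs : List (Subset n)} → as ↭ bs → boolean as ≋ boolean bs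
boolean-↭ Perm.refl = PR.refl
boolean-↭ (Perm.prep {xs} {ys} c p) = PR.trans (boolean-∷ c xs) (PR.trans (PR.*-congˡ (boolean-↭ p)) (PR.sym (boolean-∷ c ys)))
boolean-↭ (Perm.swap {xs} {ys} c d p) = PR.trans (boolean-picked {cols = c ∷ d ∷ xs} {d} {c ∷ xs} (there here)) (PR.trans
  (PR.*-congˡ (PR.trans (boolean-∷ c xs) (PR.trans (PR.*-congˡ (boolean-↭ p)) (PR.sym (boolean-∷ c ys)))))
  (PR.sym (boolean-∷ d (c ∷ ys))))
boolean-↭ (Perm.trans p q) = PR.trans (boolean-↭ p) (boolean-↭ q)

-- A transposition of the variables preserves the sizes of the subsets, so it only permutes the
-- factors of a closed family.
boolean-symmetric : (cols : List (Subset (suc n))) → Unique cols → CardClosed cols → Symmetric (boolean cols)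
boolean-symmetric cols un closed i φ = trans (boolean-swap i cols φ) (at (boolean-↭ permuted) φ)
  where
  injective : ∀ {S T} → swapAt i S ≡ swapAt i T → S ≡ T
  injective {S} {T} e = trans (sym (swapAt-involutive i S)) (trans (cong (swapAt i) e) (swapAt-involutive i T))
  forward : ∀ {S} → S ∈ L.map (swapAt i) cols → S ∈ cols
  forward S∈ with ∈P.∈-map⁻ (swapAt i) S∈
  ... | T , T∈ , refl = closed T (swapAt i T) T∈ (card-swap i T)
  backward : ∀ {S} → S ∈ cols → S ∈ L.map (swapAt i) cols
  backward {S} S∈ = subst (_∈ L.map (swapAt i) cols) (swapAt-involutive i S)
    (∈P.∈-map⁺ (swapAt i) (closed S (swapAt i S) S∈ (card-swap i S)))
  permuted : L.map (swapAt i) cols ↭ cols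
  permuted = ∼bag⇒↭ (∈K.unique∧set⇒bag (UP.map⁺ injective un) un (mk⇔ forward backward))

-- Branching of tableaux: removing the largest letter

-- Tableau conditions enter as weights 0 and 1, which can be factored and moved through sums in a
-- way that filters cannot.
ind : Bool → ℤ
ind true  = 1ℤ
ind false = 0ℤ

ind-∧ : ∀ x y → ind (x ∧ y) ≡ ind x * ind y
ind-∧ true  y = sym (ℤP.*-identityˡ (ind y))
ind-∧ false y = refl

∑-congᴬ : {A : Set} {P : A → Set} {as : List A} → All P as → {g h : A → ℤ} → (∀ a → P a → g a ≡ h a) → ∑ as g ≡ ∑ as h
∑-congᴬ []       e = refl
∑-congᴬ (p ∷ ps) e = cong₂ _+_ (e _ p) (∑-congᴬ ps e)

∑-allFin-last : (g : Fin (suc n) → ℤ) → ∑ (L.allFin (suc n)) g ≡ ∑ (L.allFin n) (g ∘ inject₁) + g (fromℕ n)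
∑-allFin-last {zero}  g = trans (∑-allFin g) (ℤP.+-comm (g zero) 0ℤ)
∑-allFin-last {suc n} g = begin
  ∑ (L.allFin (suc (suc n))) g                                             ≡⟨ ∑-allFin g ⟩
  g zero + ∑ (L.allFin (suc n)) (g ∘ suc)                                  ≡⟨ cong (g zero +_) (∑-allFin-last (g ∘ suc)) ⟩
  g zero + (∑ (L.allFin n) (g ∘ suc ∘ inject₁) + g (suc (fromℕ n)))        ≡⟨ ℤP.+-assoc (g zero) _ _ ⟨
  g zero + ∑ (L.allFin n) (g ∘ inject₁ ∘ suc) + g (suc (fromℕ n))          ≡⟨ cong (_+ g (suc (fromℕ n))) (∑-allFin (g ∘ inject₁)) ⟨
  ∑ (L.allFin (suc n)) (g ∘ inject₁) + g (suc (fromℕ n))                   ∎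
  where open ≡-Reasoning

-- ∑ of h (a + k - 1 - m) m over m = a, …, a + k - 1
range : ℕ → ℕ → (ℕ → ℕ → ℤ) → ℤ
range a zero    h = 0ℤ
range a (suc k) h = h k a + range (suc a) k h

range-cong : ∀ a k {g h : ℕ → ℕ → ℤ} → (∀ j m → a ℕ.≤ m → j ℕ.+ suc m ≡ a ℕ.+ k → g j m ≡ h j m) → range a k g ≡ range a k h
range-cong a zero    e = refl
range-cong a (suc k) e = cong₂ _+_
  (e k a ℕP.≤-refl (trans (ℕP.+-suc k a) (trans (cong suc (ℕP.+-comm k a)) (sym (ℕP.+-suc a k)))))
  (range-cong (suc a) k (λ j m a<m eq → e j m (ℕP.<⇒≤ a<m) (trans eq (sym (ℕP.+-suc a k)))))

range-suc : ∀ a k (h : ℕ → ℕ → ℤ) → range (suc a) k h ≡ range a k (λ j m → h j (suc m))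
range-suc a zero    h = refl
range-suc a (suc k) h = cong (h k (suc a) +_) (range-suc (suc a) k h)

range-∑ : {A : Set} (as : List A) → ∀ a k {h : A → ℕ → ℕ → ℤ} →
  range a k (λ j m → ∑ as (λ i → h i j m)) ≡ ∑ as (λ i → range a k (h i))
range-∑ as a zero    = sym (∑-zero as (λ _ → refl))
range-∑ as a (suc k) {h} = trans (cong (∑ as (λ i → h i k a) +_) (range-∑ as (suc a) k)) (sym (∑-+ as))

range-skip : ∀ a k (h : ℕ → ℕ → ℤ) → (∀ j m → m ℕ.< a → h j m ≡ 0ℤ) → range 0 (a ℕ.+ k) h ≡ range a k h
range-skip zero    k h z = refl
range-skip (suc a) k h z = trans (cong₂ _+_ (z (a ℕ.+ k) 0 (ℕ.s≤s ℕ.z≤n)) (trans (range-suc 0 (a ℕ.+ k) h)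
    (trans (range-skip a k (λ j m → h j (suc m)) (λ j m lt → z j (suc m) (ℕ.s≤s lt))) (sym (range-suc a k h)))))
  (ℤP.+-identityˡ _)

range-only-zero : ∀ a k (h : ℕ → ℕ → ℤ) → (∀ j m → h j (suc m) ≡ 0ℤ) → range (suc a) k h ≡ 0ℤ
range-only-zero a zero    h z = refl
range-only-zero a (suc k) h z = cong₂ _+_ (z k a) (range-only-zero (suc a) k h z)

rowSum : ∀ n → ℕ → (List (Fin n) → ℤ) → ℤ
rowSum n r G = ∑ (listsOfLength n r) (λ w → ind (rowWeak w) * G w)

fits : Fin n → List (Fin n) → Bool
fits a []      = true
fits a (b ∷ w) = a ≤F b

rowWeak-∷ : (a : Fin n) (w : List (Fin n)) → ind (rowWeak (a ∷ w)) ≡ ind (fits a w) * ind (rowWeak w)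
rowWeak-∷ a []      = refl
rowWeak-∷ a (b ∷ w) = ind-∧ (a ≤F b) (rowWeak (b ∷ w))

rowSum-suc : ∀ n r (G : List (Fin n) → ℤ) →
  rowSum n (suc r) G ≡ ∑ (L.allFin n) (λ a → rowSum n r (λ w → ind (fits a w) * G (a ∷ w)))
rowSum-suc n r G = trans (∑-concatMap _ (L.allFin n)) (∑-cong (L.allFin n) (λ a → trans (∑-map (a ∷_) (listsOfLength n r))
  (∑-cong (listsOfLength n r) (λ w → trans (cong (_* G (a ∷ w)) (rowWeak-∷ a w)) (move (ind (fits a w)) (ind (rowWeak w)) (G (a ∷ w)))))))
  where
  move : ∀ x y z → x * y * z ≡ y * (x * z)
  move = solve-∀

lengths : ∀ n r → All (λ w → length w ≡ r) (listsOfLength n r)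
lengths n zero    = refl ∷ []
lengths n (suc r) = AllP.concat⁺ (AllP.map⁺ (All.universal (λ a → AllP.map⁺ (All.map (cong suc) (lengths n r))) (L.allFin n)))

rowSum-cong : ∀ n r {G H : List (Fin n) → ℤ} → (∀ w → length w ≡ r → G w ≡ H w) → rowSum n r G ≡ rowSum n r H
rowSum-cong n r e = ∑-congᴬ (lengths n r) (λ w len → cong (ind (rowWeak w) *_) (e w len))

rowSum-zero : ∀ n r {G : List (Fin n) → ℤ} → (∀ w → G w ≡ 0ℤ) → rowSum n r G ≡ 0ℤ
rowSum-zero n r e = ∑-zero (listsOfLength n r) (λ w → trans (cong (ind (rowWeak w) *_) (e w)) (ℤP.*-zeroʳ (ind (rowWeak w))))

top : ∀ n → Fin (suc n)
top n = fromℕ n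

-- A weakly increasing row consists of its letters below the largest one followed by copies of the
-- largest; this is the inverse of cutting it there.
raise : List (Fin n) → ℕ → List (Fin (suc n))
raise {n} w j = L.map inject₁ w ++ L.replicate j (top n)

private
  ≤ᵇ-true : ∀ {a b} → a ℕ.≤ b → (a ℕ.≤ᵇ b) ≡ true
  ≤ᵇ-true {a} {b} le with a ℕ.≤ᵇ b | ℕP.≤⇒≤ᵇ le
  ... | true | _ = refl

  ≤ᵇ-false : ∀ {a b} → ¬ a ℕ.≤ b → (a ℕ.≤ᵇ b) ≡ false
  ≤ᵇ-false {a} {b} nle with a ℕ.≤ᵇ b in eq
  ... | false = refl
  ... | true  = ⊥-elim (nle (ℕP.≤ᵇ⇒≤ a b (subst Bool.T (sym eq) tt)))

  ≤F-top : (a : Fin (suc n)) → (a ≤F top n) ≡ true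
  ≤F-top {n} a = ≤ᵇ-true (subst (toℕ a ℕ.≤_) (sym (FP.toℕ-fromℕ n)) (ℕ.s≤s⁻¹ (FP.toℕ<n a)))

  top-≤F-inject : (a : Fin n) → (top n ≤F inject₁ a) ≡ false
  top-≤F-inject {n} a = ≤ᵇ-false (λ le → ℕP.<⇒≱ (FP.toℕ<n a)
    (subst₂ ℕ._≤_ (FP.toℕ-fromℕ n) (FP.toℕ-inject₁ a) le))

  inject-≤F : (a b : Fin n) → (inject₁ a ≤F inject₁ b) ≡ (a ≤F b)
  inject-≤F a b = cong₂ ℕ._≤ᵇ_ (FP.toℕ-inject₁ a) (FP.toℕ-inject₁ b)

  ≤ᵇ-suc : ∀ a b → (a ℕ.≤ᵇ b) ≡ (suc a ℕ.≤ᵇ suc b)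
  ≤ᵇ-suc zero    b = refl
  ≤ᵇ-suc (suc a) b = refl

  inject-<F : (a b : Fin n) → (inject₁ a <F inject₁ b) ≡ (a <F b)
  inject-<F a b = cong₂ ℕ._<ᵇ_ (FP.toℕ-inject₁ a) (FP.toℕ-inject₁ b)

  inject-<F-top : (a : Fin n) → (inject₁ a <F top n) ≡ true
  inject-<F-top {n} a = ≤ᵇ-true (subst₂ ℕ._<_ (sym (FP.toℕ-inject₁ a)) (sym (FP.toℕ-fromℕ n)) (FP.toℕ<n a))

  top-<F : (b : Fin (suc n)) → (top n <F b) ≡ false
  top-<F {n} b = ≤ᵇ-false (λ le → ℕP.<⇒≱ (FP.toℕ<n b) (subst (λ t → suc t ℕ.≤ toℕ b) (FP.toℕ-fromℕ n) le))

  fits-raise : (a : Fin n) (w : List (Fin n)) (j : ℕ) → fits (inject₁ a) (raise w j) ≡ fits a w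
  fits-raise a []      zero    = refl
  fits-raise a []      (suc j) = ≤F-top (inject₁ a)
  fits-raise a (b ∷ w) j       = inject-≤F a b

rowSum-top : ∀ n r (G : List (Fin (suc n)) → ℤ) →
  rowSum (suc n) r (λ w → ind (fits (top n) w) * G w) ≡ G (L.replicate r (top n))
rowSum-top n zero    G = trans (ℤP.+-identityʳ _) (trans (ℤP.*-identityˡ _) (ℤP.*-identityˡ (G [])))
rowSum-top n (suc r) G = begin
  rowSum (suc n) (suc r) (λ w → ind (fits (top n) w) * G w)
    ≡⟨ rowSum-suc (suc n) r (λ w → ind (fits (top n) w) * G w) ⟩
  ∑ (L.allFin (suc n)) (λ a → rowSum (suc n) r (λ w → ind (fits a w) * (ind (top n ≤F a) * G (a ∷ w))))
    ≡⟨ ∑-allFin-last (λ a → rowSum (suc n) r (λ w → ind (fits a w) * (ind (top n ≤F a) * G (a ∷ w)))) ⟩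
  ∑ (L.allFin n) (λ a → rowSum (suc n) r (λ w → ind (fits (inject₁ a) w) * (ind (top n ≤F inject₁ a) * G (inject₁ a ∷ w))))
    + rowSum (suc n) r (λ w → ind (fits (top n) w) * (ind (top n ≤F top n) * G (top n ∷ w)))
    ≡⟨ cong₂ _+_
         (∑-zero (L.allFin n) (λ a → rowSum-zero (suc n) r (λ w → trans
           (cong (λ b → ind (fits (inject₁ a) w) * (ind b * G (inject₁ a ∷ w))) (top-≤F-inject a)) (ℤP.*-zeroʳ (ind (fits (inject₁ a) w))))))
         (trans (rowSum-cong (suc n) r (λ w _ → cong (λ b → ind (fits (top n) w) * (ind b * G (top n ∷ w))) (≤F-top (top n))))
           (rowSum-top n r (λ w → 1ℤ * G (top n ∷ w)))) ⟩
  0ℤ + 1ℤ * G (top n ∷ L.replicate r (top n))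
    ≡⟨ trans (ℤP.+-identityˡ _) (ℤP.*-identityˡ _) ⟩
  G (L.replicate (suc r) (top n)) ∎
  where open ≡-Reasoning

rowSum-branch : ∀ n r (G : List (Fin (suc n)) → ℤ) →
  rowSum (suc n) r G ≡ range 0 (suc r) (λ j i → rowSum n i (λ w → G (raise w j)))
rowSum-branch n zero    G = sym (ℤP.+-identityʳ _)
rowSum-branch n (suc r) G = begin
  rowSum (suc n) (suc r) G
    ≡⟨ rowSum-suc (suc n) r G ⟩
  ∑ (L.allFin (suc n)) (λ a → rowSum (suc n) r (λ w → ind (fits a w) * G (a ∷ w)))
    ≡⟨ ∑-allFin-last (λ a → rowSum (suc n) r (λ w → ind (fits a w) * G (a ∷ w))) ⟩
  ∑ (L.allFin n) (λ a → rowSum (suc n) r (λ w → ind (fits (inject₁ a) w) * G (inject₁ a ∷ w)))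
    + rowSum (suc n) r (λ w → ind (fits (top n) w) * G (top n ∷ w))
    ≡⟨ cong₂ _+_ (∑-cong (L.allFin n) (λ a → trans (rowSum-branch n r (λ w → ind (fits (inject₁ a) w) * G (inject₁ a ∷ w)))
           (range-cong 0 (suc r) (λ j i _ _ → rowSum-cong n i (λ w _ → cong (λ b → ind b * G (inject₁ a ∷ raise w j)) (fits-raise a w j))))))
         (rowSum-top n r (λ w → G (top n ∷ w))) ⟩
  ∑ (L.allFin n) (λ a → range 0 (suc r) (λ j i → rowSum n i (λ w → ind (fits a w) * G (raise (a ∷ w) j))))
    + G (L.replicate (suc r) (top n))
    ≡⟨ cong (_+ G (L.replicate (suc r) (top n))) (trans (sym (range-∑ (L.allFin n) 0 (suc r)))
         (range-cong 0 (suc r) (λ j i _ _ → sym (rowSum-suc n i (λ w → G (raise w j)))))) ⟩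
  range 0 (suc r) (λ j i → rowSum n (suc i) (λ w → G (raise w j))) + G (L.replicate (suc r) (top n))
    ≡⟨ ℤP.+-comm (range 0 (suc r) (λ j i → rowSum n (suc i) (λ w → G (raise w j)))) (G (L.replicate (suc r) (top n))) ⟩
  G (L.replicate (suc r) (top n)) + range 0 (suc r) (λ j i → rowSum n (suc i) (λ w → G (raise w j)))
    ≡⟨ cong₂ _+_ (sym (trans (ℤP.+-identityʳ _) (ℤP.*-identityˡ (G (L.replicate (suc r) (top n))))))
         (sym (range-suc 0 (suc r) (λ j i → rowSum n i (λ w → G (raise w j))))) ⟩
  range 0 (suc (suc r)) (λ j i → rowSum n i (λ w → G (raise w j))) ∎
  where open ≡-Reasoning

-- Nothing can stand below a largest letter. So the whole lower row, its own largest letters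
-- included, must fit under the remaining part of the upper row: the horizontal strip condition.
colStrict-raise : (w : List (Fin n)) (j : ℕ) (w′ : List (Fin n)) (j′ : ℕ) → length w′ ℕ.+ j′ ℕ.≤ length w ℕ.+ j →
  ind (colStrict (raise w j) (raise w′ j′)) ≡ ind (length w′ ℕ.+ j′ ℕ.≤ᵇ length w) * ind (colStrict w w′)
colStrict-raise []      zero    []       zero     le = refl
colStrict-raise []      (suc j) []       zero     le = refl
colStrict-raise {n} []  (suc j) []       (suc j′) le = cong (λ b → ind (b ∧ and (L.zipWith _<F_ (L.replicate j (top n)) (L.replicate j′ (top n))))) (top-<F (top n))
colStrict-raise {n} []  (suc j) (b ∷ w′) j′       le = cong (λ c → ind (c ∧ and (L.zipWith _<F_ (L.replicate j (top n)) (raise w′ j′)))) (top-<F (inject₁ b))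
colStrict-raise (a ∷ w) j       []       zero     le = refl
colStrict-raise (a ∷ w) j       []       (suc j′) le = trans
  (cong (λ b → ind (b ∧ colStrict (raise w j) (raise [] j′))) (inject-<F-top a))
  (trans (colStrict-raise w j [] j′ (ℕ.s≤s⁻¹ le)) (cong₂ (λ b c → ind b * ind c) (≤ᵇ-suc j′ (length w)) (zip-[] w)))
  where
  zip-[] : (w : List (Fin _)) → colStrict w [] ≡ true
  zip-[] []      = refl
  zip-[] (a ∷ w) = refl
colStrict-raise (a ∷ w) j       (b ∷ w′) j′       le = trans
  (cong (λ c → ind (c ∧ colStrict (raise w j) (raise w′ j′))) (inject-<F a b))
  (trans (ind-∧ (a <F b) (colStrict (raise w j) (raise w′ j′)))
    (trans (cong (ind (a <F b) *_) (colStrict-raise w j w′ j′ (ℕ.s≤s⁻¹ le)))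
      (trans (move (ind (a <F b)) (ind (length w′ ℕ.+ j′ ℕ.≤ᵇ length w)) (ind (colStrict w w′)))
        (cong₂ (λ c d → ind c * d) (≤ᵇ-suc (length w′ ℕ.+ j′) (length w)) (sym (ind-∧ (a <F b) (colStrict w w′)))))))
  where
  move : ∀ x y z → x * (y * z) ≡ y * (x * z)
  move = solve-∀

tabSum : ∀ n → List ℕ → (List (List (Fin n)) → ℤ) → ℤ
tabSum n ts G = ∑ (fillings n ts) (λ T → ind (isSSYT T) * G T)

above : List (Fin n) → List (List (Fin n)) → Bool
above r []       = true
above r (r′ ∷ T) = colStrict r r′

isSSYT-∷ : (r : List (Fin n)) (T : List (List (Fin n))) → ind (isSSYT (r ∷ T)) ≡ ind (rowWeak r) * (ind (above r T) * ind (isSSYT T))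
isSSYT-∷ r []       = sym (ℤP.*-identityʳ (ind (rowWeak r)))
isSSYT-∷ r (r′ ∷ T) = trans (ind-∧ (rowWeak r) _) (cong (ind (rowWeak r) *_) (ind-∧ (colStrict r r′) (isSSYT (r′ ∷ T))))

tabSum-∷ : ∀ n t ts (G : List (List (Fin n)) → ℤ) →
  tabSum n (t ∷ ts) G ≡ rowSum n t (λ r → tabSum n ts (λ T → ind (above r T) * G (r ∷ T)))
tabSum-∷ n t ts G = trans (∑-cartesianProductWith _∷_ (listsOfLength n t) (fillings n ts))
  (∑-cong (listsOfLength n t) (λ r → trans (∑-cong (fillings n ts) (λ T → trans (cong (_* G (r ∷ T)) (isSSYT-∷ r T))
      (move (ind (rowWeak r)) (ind (above r T)) (ind (isSSYT T)) (G (r ∷ T)))))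
    (∑-*ˡ (fillings n ts) (ind (rowWeak r)))))
  where
  move : ∀ a b c d → a * (b * c) * d ≡ a * (c * (b * d))
  move = solve-∀

shape : List (List (Fin n)) → List ℕ
shape = L.map length

shapes : ∀ n ts → All (λ T → shape T ≡ ts) (fillings n ts)
shapes n []       = refl ∷ []
shapes n (t ∷ ts) = AllP.cartesianProductWith⁺ (setoid _) (setoid _) _∷_ (listsOfLength n t) (fillings n ts)
  (λ r∈ T∈ → cong₂ _∷_ (All.lookup (lengths n t) r∈) (All.lookup (shapes n ts) T∈))

tabSum-cong : ∀ n ts {G H : List (List (Fin n)) → ℤ} → (∀ T → shape T ≡ ts → G T ≡ H T) → tabSum n ts G ≡ tabSum n ts H
tabSum-cong n ts e = ∑-congᴬ (shapes n ts) (λ T sh → cong (ind (isSSYT T) *_) (e T sh))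

nextPart : List ℕ → ℕ
nextPart []      = 0
nextPart (t ∷ _) = t

-- Sum over all μ with t₁ ≥ μ₁ ≥ t₂ ≥ μ₂ ≥ ⋯ ≥ tᵣ ≥ μᵣ ≥ 0 and the differences j = t - μ.
branch : List ℕ → (List ℕ → List ℕ → ℤ) → ℤ
branch []       g = g [] []
branch (t ∷ ts) g = range (nextPart ts) (suc (t ∸ nextPart ts)) (λ j μ → branch ts (λ js μs → g (j ∷ js) (μ ∷ μs)))

-- Keeps only t = μ + j row by row; the inequalities of the interlacing are already built into the
-- ranges of `branch`.
data Interlaced : List ℕ → List ℕ → List ℕ → Set where
  []  : Interlaced [] [] []
  _∷_ : ∀ {t ts j js μ μs} → μ ℕ.+ j ≡ t → Interlaced ts js μs → Interlaced (t ∷ ts) (j ∷ js) (μ ∷ μs)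

nextPart≤ : ∀ {t ts} → Linked _≥_ (t ∷ ts) → nextPart ts ℕ.≤ t
nextPart≤ [-]        = ℕ.z≤n
nextPart≤ (t≥t′ ∷ _) = t≥t′

private
  complement : ∀ {a t} j m → a ℕ.≤ t → j ℕ.+ suc m ≡ a ℕ.+ suc (t ∸ a) → m ℕ.+ j ≡ t
  complement {a} {t} j m a≤t e = ℕP.suc-injective (trans (cong suc (ℕP.+-comm m j)) (trans (sym (ℕP.+-suc j m))
    (trans e (trans (ℕP.+-suc a (t ∸ a)) (cong suc (ℕP.m+[n∸m]≡n a≤t))))))

branch-cong : ∀ {ts} → Linked _≥_ ts → {g h : List ℕ → List ℕ → ℤ} →
  (∀ js μs → Interlaced ts js μs → g js μs ≡ h js μs) → branch ts g ≡ branch ts h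
branch-cong {[]}     p e = e [] [] []
branch-cong {t ∷ ts} p e = range-cong (nextPart ts) (suc (t ∸ nextPart ts)) (λ j m a≤m eq →
  branch-cong (Linked.tail p) (λ js μs il → e (j ∷ js) (m ∷ μs) (complement j m (nextPart≤ p) eq ∷ il)))

branch-∑ : {A : Set} (as : List A) → ∀ ts (h : A → List ℕ → List ℕ → ℤ) →
  branch ts (λ js μs → ∑ as (λ i → h i js μs)) ≡ ∑ as (λ i → branch ts (h i))
branch-∑ as []       h = refl
branch-∑ as (t ∷ ts) h = trans
  (range-cong (nextPart ts) (suc (t ∸ nextPart ts)) (λ j m _ _ → branch-∑ as ts (λ i js μs → h i (j ∷ js) (m ∷ μs))))
  (range-∑ as (nextPart ts) (suc (t ∸ nextPart ts)))

range-*ˡ : ∀ c a k (h : ℕ → ℕ → ℤ) → range a k (λ j m → c * h j m) ≡ c * range a k h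
range-*ˡ c a zero    h = sym (ℤP.*-zeroʳ c)
range-*ˡ c a (suc k) h = trans (cong (c * h k a +_) (range-*ˡ c (suc a) k h)) (sym (ℤP.*-distribˡ-+ c (h k a) (range (suc a) k h)))

branch-*ˡ : ∀ c ts (h : List ℕ → List ℕ → ℤ) → branch ts (λ js μs → c * h js μs) ≡ c * branch ts h
branch-*ˡ c []       h = refl
branch-*ˡ c (t ∷ ts) h = trans
  (range-cong (nextPart ts) (suc (t ∸ nextPart ts)) (λ j m _ _ → branch-*ˡ c ts (λ js μs → h (j ∷ js) (m ∷ μs))))
  (range-*ˡ c (nextPart ts) (suc (t ∸ nextPart ts)) (λ j m → branch ts (λ js μs → h (j ∷ js) (m ∷ μs))))

above-raise : ∀ {ts js μs} (w : List (Fin n)) (j : ℕ) (T : List (List (Fin n))) → Interlaced ts js μs → shape T ≡ μs →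
  nextPart ts ℕ.≤ length w ℕ.+ j →
  ind (above (raise w j) (L.zipWith raise T js)) ≡ ind (nextPart ts ℕ.≤ᵇ length w) * ind (above w T)
above-raise w j []       []         sh le = refl
above-raise {js = j′ ∷ js} w j (w′ ∷ T) (e ∷ il) sh le with LP.∷-injectiveˡ sh
... | refl = trans (colStrict-raise w j w′ j′ (subst (ℕ._≤ length w ℕ.+ j) (sym e) le))
  (cong (λ t → ind (t ℕ.≤ᵇ length w) * ind (colStrict w w′)) e)

-- Cutting off the largest letters in every row leaves a tableau in the smaller letters. Column
-- strictness between the removed parts becomes the bound `a ≤ i` on the shortened row, which
-- narrows the range from 0 ... t to `a` ... t.
tabSum-branch : ∀ n {ts} → Linked _≥_ ts → (G : List (List (Fin (suc n))) → ℤ) →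
  tabSum (suc n) ts G ≡ branch ts (λ js μs → tabSum n μs (λ T → G (L.zipWith raise T js)))
tabSum-branch n {[]}     p G = refl
tabSum-branch n {t ∷ ts} p G = begin
  tabSum (suc n) (t ∷ ts) G
    ≡⟨ tabSum-∷ (suc n) t ts G ⟩
  rowSum (suc n) t (λ r → tabSum (suc n) ts (λ T → ind (above r T) * G (r ∷ T)))
    ≡⟨ rowSum-branch n t _ ⟩
  range 0 (suc t) (λ j i → rowSum n i (λ w → tabSum (suc n) ts (λ T → ind (above (raise w j) T) * G (raise w j ∷ T))))
    ≡⟨ range-cong 0 (suc t) (λ j i _ eq → trans (rowSum-cong n i (λ w len → inner j i eq w len)) (outer j i)) ⟩
  range 0 (suc t) (λ j i → ind (a ℕ.≤ᵇ i) * Y j i)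
    ≡⟨ cong (λ k → range 0 k (λ j i → ind (a ℕ.≤ᵇ i) * Y j i)) (sym (trans (ℕP.+-suc a (t ∸ a)) (cong suc (ℕP.m+[n∸m]≡n (nextPart≤ p))))) ⟩
  range 0 (a ℕ.+ suc (t ∸ a)) (λ j i → ind (a ℕ.≤ᵇ i) * Y j i)
    ≡⟨ range-skip a (suc (t ∸ a)) (λ j i → ind (a ℕ.≤ᵇ i) * Y j i) (λ j i lt → cong (λ b → ind b * Y j i) (≤ᵇ-false (ℕP.<⇒≱ lt))) ⟩
  range a (suc (t ∸ a)) (λ j i → ind (a ℕ.≤ᵇ i) * Y j i)
    ≡⟨ range-cong a (suc (t ∸ a)) (λ j i le _ → trans (cong (λ b → ind b * Y j i) (≤ᵇ-true le)) (ℤP.*-identityˡ (Y j i))) ⟩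
  branch (t ∷ ts) (λ js μs → tabSum n μs (λ T → G (L.zipWith raise T js))) ∎
  where
  open ≡-Reasoning
  a = nextPart ts
  Y : ℕ → ℕ → ℤ
  Y j i = branch ts (λ js μs → tabSum n (i ∷ μs) (λ T → G (L.zipWith raise T (j ∷ js))))
  X : ℕ → List (Fin n) → List ℕ → List ℕ → ℤ
  X j w js μs = tabSum n μs (λ T → ind (above w T) * G (raise w j ∷ L.zipWith raise T js))
  inner : ∀ j i → j ℕ.+ suc i ≡ 0 ℕ.+ suc t → ∀ w → length w ≡ i →
    tabSum (suc n) ts (λ T → ind (above (raise w j) T) * G (raise w j ∷ T)) ≡ ind (a ℕ.≤ᵇ i) * branch ts (X j w)
  inner j i eq w refl = trans (tabSum-branch n (Linked.tail p) _) (trans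
    (branch-cong (Linked.tail p) (λ js μs il → trans
      (tabSum-cong n μs (λ T sh → trans (cong (_* G (raise w j ∷ L.zipWith raise T js))
          (above-raise w j T il sh (subst (a ℕ.≤_) (sym (complement j i ℕ.z≤n eq)) (nextPart≤ p))))
        (ℤP.*-assoc (ind (a ℕ.≤ᵇ i)) (ind (above w T)) (G (raise w j ∷ L.zipWith raise T js)))))
      (scale (ind (a ℕ.≤ᵇ i)) μs (λ T → ind (above w T) * G (raise w j ∷ L.zipWith raise T js)))))
    (branch-*ˡ (ind (a ℕ.≤ᵇ i)) ts (X j w)))
    where
    scale : ∀ c μs (H : List (List (Fin n)) → ℤ) → tabSum n μs (λ T → c * H T) ≡ c * tabSum n μs H
    scale c μs H = trans (∑-cong (fillings n μs) (λ T → move (ind (isSSYT T)) c (H T))) (∑-*ˡ (fillings n μs) c)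
      where
      move : ∀ x c y → x * (c * y) ≡ c * (x * y)
      move = solve-∀
  outer : ∀ j i → rowSum n i (λ w → ind (a ℕ.≤ᵇ i) * branch ts (X j w)) ≡ ind (a ℕ.≤ᵇ i) * Y j i
  outer j i = trans (trans (∑-cong (listsOfLength n i) (λ w → move (ind (rowWeak w)) (ind (a ℕ.≤ᵇ i)) (branch ts (X j w))))
      (∑-*ˡ (listsOfLength n i) (ind (a ℕ.≤ᵇ i))))
    (cong (ind (a ℕ.≤ᵇ i) *_) (trans (∑-cong (listsOfLength n i) (λ w → sym (branch-*ˡ (ind (rowWeak w)) ts (X j w))))
      (trans (sym (branch-∑ (listsOfLength n i) ts (λ w js μs → ind (rowWeak w) * X j w js μs)))
        (branch-cong (Linked.tail p) (λ js μs _ → sym (tabSum-∷ n i μs (λ T → G (L.zipWith raise T (j ∷ js)))))))))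
    where
    move : ∀ x c y → x * (c * y) ≡ c * (x * y)
    move = solve-∀

-- The same sum with μᵣ = 0, this last part being dropped.
branchInner : List ℕ → (List ℕ → List ℕ → ℤ) → ℤ
branchInner []            g = g [] []
branchInner (t ∷ [])      g = g (t ∷ []) []
branchInner (t ∷ t′ ∷ ts) g = range t′ (suc (t ∸ t′)) (λ j μ → branchInner (t′ ∷ ts) (λ js νs → g (j ∷ js) (μ ∷ νs)))

private
  squeeze : ∀ {t t′ m νs} → t ≥ m → m ≥ t′ → Linked _≥_ (t′ ∷ νs) → Linked _≥_ (t ∷ m ∷ νs)
  squeeze t≥m m≥t′ [-]        = t≥m ∷ [-]
  squeeze t≥m m≥t′ (t′≥h ∷ s) = t≥m ∷ (ℕP.≤-trans t′≥h m≥t′ ∷ s)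

  bounded : ∀ {a t} j m → a ℕ.≤ t → j ℕ.+ suc m ≡ a ℕ.+ suc (t ∸ a) → m ℕ.≤ t
  bounded {a} {t} j m a≤t e = ℕ.s≤s⁻¹ (ℕP.≤-trans (ℕP.m≤n+m (suc m) j)
    (ℕP.≤-reflexive (trans e (trans (ℕP.+-suc a (t ∸ a)) (cong suc (ℕP.m+[n∸m]≡n a≤t))))))

branchInner-cong : ∀ {t ts} → Linked _≥_ (t ∷ ts) → {g h : List ℕ → List ℕ → ℤ} →
  (∀ js νs → length js ≡ suc (length ts) → length νs ≡ length ts → Linked _≥_ (t ∷ νs) → g js νs ≡ h js νs) →
  branchInner (t ∷ ts) g ≡ branchInner (t ∷ ts) h
branchInner-cong [-] e = e _ [] refl refl [-]
branchInner-cong {t} {t′ ∷ ts} (t≥t′ ∷ p) e = range-cong t′ (suc (t ∸ t′)) (λ j m le eq →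
  branchInner-cong p (λ js νs len len′ s → e (j ∷ js) (m ∷ νs) (cong suc len) (cong suc len′)
    (squeeze (bounded j m t≥t′ eq) le s)))

-- The hypothesis on K expresses that there is no tableau with more nonempty rows than letters; it
-- forces the last shortened row to be empty.
branch-inner : ∀ {t ts} → Linked _≥_ (t ∷ ts) → (K : List ℕ → List ℕ → ℤ) →
  (∀ js μs m → length μs ≡ length ts → Linked _≥_ (t ∷ (μs ++ suc m ∷ [])) → K js (μs ++ suc m ∷ []) ≡ 0ℤ) →
  branch (t ∷ ts) K ≡ branchInner (t ∷ ts) (λ js νs → K js (νs ++ 0 ∷ []))
branch-inner {t} [-] K z = trans (cong (K (t ∷ []) (0 ∷ []) +_) (trans (range-cong 1 t vanish)
  (range-only-zero 0 t (λ _ _ → 0ℤ) (λ _ _ → refl)))) (ℤP.+-identityʳ _)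
  where
  vanish : ∀ j m → 1 ℕ.≤ m → j ℕ.+ suc m ≡ suc t → K (j ∷ []) (m ∷ []) ≡ 0ℤ
  vanish j (suc m) _ e = z (j ∷ []) [] m refl
    (subst (suc m ℕ.≤_) (ℕP.suc-injective (trans (sym (ℕP.+-suc j (suc m))) e)) (ℕP.m≤n+m (suc m) j) ∷ [-])
branch-inner {t} {t′ ∷ ts} (t≥t′ ∷ p) K z = range-cong t′ (suc (t ∸ t′)) (λ j m le eq →
  branch-inner p (λ js μs → K (j ∷ js) (m ∷ μs)) (λ js μs k len s →
    z (j ∷ js) (m ∷ μs) k (cong suc len) (squeeze (bounded j m t≥t′ eq) le s)))

private
  ∧-true : ∀ {x y} → x ∧ y ≡ true → x ≡ true × y ≡ true
  ∧-true {true} {true} e = refl , refl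

  <ᵇ-true : ∀ a b → (a ℕ.<ᵇ b) ≡ true → a ℕ.< b
  <ᵇ-true a b e = ℕP.<ᵇ⇒< a b (subst Bool.T (sym e) _)

-- The first column of a tableau increases strictly.
column-height : (a : Fin n) (r : List (Fin n)) (T : List (List (Fin n))) → All (1 ℕ.≤_) (shape T) →
  isSSYT ((a ∷ r) ∷ T) ≡ true → length T ℕ.+ toℕ a ℕ.< n
column-height a r []             ne         e = FP.toℕ<n a
column-height {n} a r ((b ∷ r′) ∷ T) (_ ∷ ne) e with ∧-true {rowWeak (a ∷ r)} e
... | _ , e′ with ∧-true {colStrict (a ∷ r) (b ∷ r′)} e′
...   | col , e″ = ℕP.≤-<-trans
  (subst (ℕ._≤ length T ℕ.+ toℕ b) (ℕP.+-suc (length T) (toℕ a))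
    (ℕP.+-monoʳ-≤ (length T) (<ᵇ-true (toℕ a) (toℕ b) (proj₁ (∧-true {a <F b} col)))))
  (column-height b r′ T ne e″)

private
  all-positive : ∀ {t} μs m → Linked _≥_ (t ∷ (μs ++ suc m ∷ [])) → 1 ℕ.≤ t × All (1 ℕ.≤_) (μs ++ suc m ∷ [])
  all-positive []       m (t≥ ∷ [-]) = ℕP.≤-trans (ℕ.s≤s ℕ.z≤n) t≥ , ℕ.s≤s ℕ.z≤n ∷ []
  all-positive (μ ∷ μs) m (t≥ ∷ s) with all-positive μs m s
  ... | μ≥1 , rest = ℕP.≤-trans μ≥1 t≥ , μ≥1 ∷ rest

tabSum-tall : ∀ n {t} μs m (G : List (List (Fin n)) → ℤ) → length μs ≡ n → Linked _≥_ (t ∷ (μs ++ suc m ∷ [])) →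
  tabSum n (μs ++ suc m ∷ []) G ≡ 0ℤ
tabSum-tall n μs m G len s = trans (∑-congᴬ (shapes n (μs ++ suc m ∷ [])) (λ T sh → cong (_* G T) (not-tableau T sh)))
  (∑-zero (fillings n (μs ++ suc m ∷ [])) (λ _ → refl))
  where
  tall : ∀ T → shape T ≡ μs ++ suc m ∷ [] → length T ≡ suc n
  tall T sh = trans (sym (LP.length-map length T)) (trans (cong length sh) (trans (LP.length-++ μs)
    (trans (ℕP.+-comm (length μs) 1) (cong suc len))))
  contradiction : ∀ T → length T ≡ suc n → All (1 ℕ.≤_) (shape T) → isSSYT T ≢ true
  contradiction ((a ∷ r) ∷ T) len (_ ∷ ne) e = ℕP.<⇒≱ (column-height a r T ne e)
    (subst (ℕ._≤ length T ℕ.+ toℕ a) (ℕP.suc-injective len) (ℕP.m≤m+n (length T) (toℕ a)))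
  not-tableau : ∀ T → shape T ≡ μs ++ suc m ∷ [] → ind (isSSYT T) ≡ 0ℤ
  not-tableau T sh with isSSYT T in eq
  ... | false = refl
  ... | true  = ⊥-elim (contradiction T (tall T sh) (subst (All (1 ℕ.≤_)) (sym sh) (proj₂ (all-positive μs m s))) eq)

tabSum-empty-row : ∀ n νs (G : List (List (Fin n)) → ℤ) → tabSum n (νs ++ 0 ∷ []) G ≡ tabSum n νs (λ T → G (T ++ [] ∷ []))
tabSum-empty-row n []       G = refl
tabSum-empty-row n (ν ∷ νs) G = trans (tabSum-∷ n ν (νs ++ 0 ∷ []) G) (trans
  (rowSum-cong n ν (λ r _ → trans (tabSum-empty-row n νs (λ T → ind (above r T) * G (r ∷ T)))
    (tabSum-cong n νs (λ T _ → cong (λ b → ind b * G (r ∷ (T ++ [] ∷ []))) (above-empty r T)))))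
  (sym (tabSum-∷ n ν νs (λ T → G (T ++ [] ∷ [])))))
  where
  above-empty : (r : List (Fin n)) (T : List (List (Fin n))) → above r (T ++ [] ∷ []) ≡ above r T
  above-empty []      []      = refl
  above-empty (_ ∷ _) []      = refl
  above-empty r       (_ ∷ T) = refl

occurrences : Fin n → List (Fin n) → ℕ
occurrences i w = length (L.filter (λ a → i FP.≟ a) w)

occurrences-++ : (i : Fin n) (w w′ : List (Fin n)) → occurrences i (w ++ w′) ≡ occurrences i w ℕ.+ occurrences i w′
occurrences-++ i w w′ = trans (cong length (LP.filter-++ (λ a → i FP.≟ a) w w′)) (LP.length-++ (L.filter (λ a → i FP.≟ a) w))

occurrences-∷ : (i a : Fin n) (w : List (Fin n)) → i ≡ a → occurrences i (a ∷ w) ≡ suc (occurrences i w)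
occurrences-∷ i a w e = cong length (LP.filter-accept (λ b → i FP.≟ b) e)

occurrences-skip : (i a : Fin n) (w : List (Fin n)) → i ≢ a → occurrences i (a ∷ w) ≡ occurrences i w
occurrences-skip i a w ne = cong length (LP.filter-reject (λ b → i FP.≟ b) ne)

occurrences-raise : (i : Fin n) (w : List (Fin n)) (j : ℕ) → occurrences (inject₁ i) (raise w j) ≡ occurrences i w
occurrences-raise i []      zero    = refl
occurrences-raise {n} i []  (suc j) = trans (occurrences-skip (inject₁ i) (top n) (L.replicate j (top n)) (FP.fromℕ≢inject₁ ∘ sym))
  (occurrences-raise i [] j)
occurrences-raise i (a ∷ w) j with i FP.≟ a
... | yes refl = trans (occurrences-∷ (inject₁ i) (inject₁ i) (raise w j) refl) (cong suc (occurrences-raise i w j))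
... | no  i≢a  = trans (occurrences-skip (inject₁ i) (inject₁ a) (raise w j) (i≢a ∘ FP.inject₁-injective)) (occurrences-raise i w j)

occurrences-top : (w : List (Fin n)) (j : ℕ) → occurrences (top n) (raise w j) ≡ j
occurrences-top     []      zero    = refl
occurrences-top {n} []      (suc j) = trans (occurrences-∷ (top n) (top n) (L.replicate j (top n)) refl) (cong suc (occurrences-top {n} [] j))
occurrences-top {n} (a ∷ w) j       = trans (occurrences-skip (top n) (inject₁ a) (raise w j) FP.fromℕ≢inject₁) (occurrences-top w j)

tabulate-last : {A : Set} (f : Fin (suc n) → A) → V.tabulate f ≡ V.tabulate (f ∘ inject₁) ∷ʳ f (fromℕ n)
tabulate-last {zero}  f = refl
tabulate-last {suc n} f = cong (f zero ∷_) (tabulate-last (f ∘ suc))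

weight-raise : (T : List (List (Fin n))) (js : List ℕ) → length js ≡ length T →
  weight (L.zipWith raise T js) ≡ weight T ∷ʳ sumℕ js
weight-raise {n} T js len = trans (tabulate-last (λ i → occurrences i (L.concat (L.zipWith raise T js))))
  (cong₂ _∷ʳ_ (VP.tabulate-cong (λ i → low i T js len)) (high T js len))
  where
  low : ∀ i T js → length js ≡ length T → occurrences (inject₁ i) (L.concat (L.zipWith raise T js)) ≡ occurrences i (L.concat T)
  low i []      []       len = refl
  low i (w ∷ T) (j ∷ js) len = trans (occurrences-++ (inject₁ i) (raise w j) _) (trans
    (cong₂ ℕ._+_ (occurrences-raise i w j) (low i T js (ℕP.suc-injective len))) (sym (occurrences-++ i w (L.concat T))))
  high : ∀ T js → length js ≡ length T → occurrences (top n) (L.concat (L.zipWith raise T js)) ≡ sumℕ js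
  high []      []       len = refl
  high (w ∷ T) (j ∷ js) len = trans (occurrences-++ (top n) (raise w j) _)
    (cong₂ ℕ._+_ (occurrences-top w j) (high T js (ℕP.suc-injective len)))

weight-empty-row : (T : List (List (Fin n))) → weight (T ++ [] ∷ []) ≡ weight T
weight-empty-row T = VP.tabulate-cong (λ i → cong (occurrences i) (trans (sym (LP.concat-++ T ([] ∷ []))) (LP.++-identityʳ (L.concat T))))

-- Schur polynomials, evaluated on test functions

-- Follows `interlace`, but also hands over the exponents of x contributed by the single rows; their
-- sum is the exponent of the variable removed.
interlaceEval : List ℕ → (List ℕ → List ℕ → ℤ) → ℤ
interlaceEval []            g = 0ℤ
interlaceEval (l ∷ [])      g = g (l ∷ []) []
interlaceEval (l ∷ l′ ∷ ls) g = range l′ (l ∸ l′) (λ j m → interlaceEval (l′ ∷ ls) (λ js ms → g (j ∷ js) (m ∷ ms)))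

interlaceEval-cong : ∀ l {g h : List ℕ → List ℕ → ℤ} → (∀ js ms → g js ms ≡ h js ms) → interlaceEval l g ≡ interlaceEval l h
interlaceEval-cong []            e = refl
interlaceEval-cong (l ∷ [])      e = e _ _
interlaceEval-cong (l ∷ l′ ∷ ls) e = range-cong l′ (l ∸ l′) (λ j m _ _ → interlaceEval-cong (l′ ∷ ls) (λ js ms → e (j ∷ js) (m ∷ ms)))

schurEval : ∀ n → List ℕ → Test n → ℤ
schurEval zero    []      φ = φ []
schurEval zero    (_ ∷ _) φ = 0ℤ
schurEval (suc n) l       φ = interlaceEval l (λ js ms → schurEval n ms (λ u → φ (sumℕ js ∷ u)))

schurEval-cong : ∀ n l {φ ψ : Test n} → (∀ u → φ u ≡ ψ u) → schurEval n l φ ≡ schurEval n l ψ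
schurEval-cong zero    []      e = e []
schurEval-cong zero    (_ ∷ _) e = refl
schurEval-cong (suc n) l       e = interlaceEval-cong l (λ js ms → schurEval-cong n ms (λ u → e (sumℕ js ∷ u)))

inc^-+ : ∀ j k (a : Fin n) (u : Vec ℕ n) → inc^ j a (inc^ k a u) ≡ inc^ (j ℕ.+ k) a u
inc^-+ j zero    a u = cong (λ t → inc^ t a u) (sym (ℕP.+-identityʳ j))
inc^-+ j (suc k) a u = trans (inc^-+ j k a (inc a u)) (cong (λ t → inc^ t a u) (sym (ℕP.+-suc j k)))

module _ {n : ℕ} where
  open Alternants (polynomialRing n)

  ⟦window⟧ : ∀ (a : Fin n) s k (h : ℕ → Pol n) (φ : Test n) →
    ⟦ window (variable′ a) s k h ⟧ φ ≡ range s k (λ j m → ⟦ h m ⟧ (φ ∘ inc^ j a))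
  ⟦window⟧ a s zero    h φ = ⟦[]⟧ φ
  ⟦window⟧ a s (suc k) h φ = trans (⟦⊞⟧ ((variable′ a ^ k) ⊛ h s) _ φ) (cong₂ _+_ (⟦power⟧ a k (h s) φ) (⟦window⟧ a (suc s) k h φ))

  ⟦interlace⟧ : ∀ (a : Fin n) l (g : List ℕ → Pol n) (φ : Test n) →
    ⟦ interlace (variable′ a) l g ⟧ φ ≡ interlaceEval l (λ js ms → ⟦ g ms ⟧ (φ ∘ inc^ (sumℕ js) a))
  ⟦interlace⟧ a []            g φ = ⟦[]⟧ φ
  ⟦interlace⟧ a (l ∷ [])      g φ = trans (⟦power⟧ a l (g []) φ)
    (⟦⟧-cong (g []) (λ u → cong (λ t → φ (inc^ t a u)) (sym (ℕP.+-identityʳ l))))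
  ⟦interlace⟧ a (l ∷ l′ ∷ ls) g φ = trans (⟦window⟧ a l′ (l ∸ l′) _ φ) (range-cong l′ (l ∸ l′) (λ j m _ _ →
    trans (⟦interlace⟧ a (l′ ∷ ls) (λ ms → g (m ∷ ms)) (φ ∘ inc^ j a))
      (interlaceEval-cong (l′ ∷ ls) (λ js ms → ⟦⟧-cong (g (m ∷ ms)) (λ u → cong φ (inc^-+ j (sumℕ js) a u))))))

⟦schurStrict⟧-lift : ∀ (is : List (Fin n)) l (φ : Test (suc n)) →
  ⟦ Alternants.schurStrict (polynomialRing (suc n)) (L.map variable′ (L.map suc is)) l ⟧ φ ≡
  ⟦ Alternants.schurStrict (polynomialRing n) (L.map variable′ is) l ⟧ (φ ∘ (0 ∷_))
⟦schurStrict⟧-lift []       []      φ = trans (⟦monomial⟧ 1ℤ 𝟘 φ) (sym (⟦monomial⟧ 1ℤ 𝟘 _))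
⟦schurStrict⟧-lift []       (_ ∷ _) φ = trans (⟦[]⟧ φ) (sym (⟦[]⟧ _))
⟦schurStrict⟧-lift (i ∷ is) l       φ = trans (⟦interlace⟧ (suc i) l _ φ) (trans
  (interlaceEval-cong l (λ js ms → trans (⟦schurStrict⟧-lift is ms (φ ∘ inc^ (sumℕ js) (suc i)))
    (⟦⟧-cong _ (λ u → cong φ (inc^-suc (sumℕ js) i 0 u)))))
  (sym (⟦interlace⟧ i l _ (φ ∘ (0 ∷_)))))

⟦schurStrict⟧ : ∀ n l (φ : Test n) →
  ⟦ Alternants.schurStrict (polynomialRing n) (allVariables n) l ⟧ φ ≡ schurEval n l φ
⟦schurStrict⟧ zero    []      φ = trans (⟦monomial⟧ 1ℤ 𝟘 φ) (ℤP.*-identityˡ (φ []))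
⟦schurStrict⟧ zero    (_ ∷ _) φ = ⟦[]⟧ φ
⟦schurStrict⟧ (suc n) l       φ = trans (⟦interlace⟧ zero l _ φ) (interlaceEval-cong l (λ js ms → trans
  (cong (λ is → ⟦ Alternants.schurStrict (polynomialRing (suc n)) (L.map variable′ is) ms ⟧ (φ ∘ inc^ (sumℕ js) zero))
        (sym (LP.map-tabulate id suc)))
  (trans (⟦schurStrict⟧-lift (L.allFin n) ms (φ ∘ inc^ (sumℕ js) zero))
    (trans (⟦schurStrict⟧ n ms _) (schurEval-cong n ms (λ u → cong φ
      (trans (inc^-zero (sumℕ js) 0 u) (cong (_∷ u) (ℕP.+-identityʳ (sumℕ js))))))))))

addStaircase : List ℕ → List ℕ
addStaircase []       = []
addStaircase (t ∷ ts) = length ts ℕ.+ t ∷ addStaircase ts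

range-shift : ∀ c a k (h : ℕ → ℕ → ℤ) → range (c ℕ.+ a) k h ≡ range a k (λ j m → h j (c ℕ.+ m))
range-shift zero    a k h = refl
range-shift (suc c) a k h = trans (range-suc (c ℕ.+ a) k h) (range-shift c a k (λ j m → h j (suc m)))

-- Subtracting staircases turns l′ ≤ m < l into t′ ≤ μ ≤ t. The smaller exponent list has a
-- staircase shorter by one, so m is shifted by the same amount as the next part l′ and one less
-- than l; hence the window has 1 + (t - t′) values.
interlaceEval-branchInner : ∀ {t ts} → Linked _≥_ (t ∷ ts) → (g : List ℕ → List ℕ → ℤ) →
  interlaceEval (addStaircase (t ∷ ts)) g ≡ branchInner (t ∷ ts) (λ js νs → g js (addStaircase νs))
interlaceEval-branchInner [-] g = refl
interlaceEval-branchInner {t} {t′ ∷ ts} (t≥t′ ∷ p) g = begin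
  range (c ℕ.+ t′) ((suc c ℕ.+ t) ∸ (c ℕ.+ t′)) (λ j m → interlaceEval (addStaircase (t′ ∷ ts)) (λ js ms → g (j ∷ js) (m ∷ ms)))
    ≡⟨ cong (λ k → range (c ℕ.+ t′) k (λ j m → interlaceEval (addStaircase (t′ ∷ ts)) (λ js ms → g (j ∷ js) (m ∷ ms))))
         (trans (cong (_∸ (c ℕ.+ t′)) (sym (ℕP.+-suc c t))) (trans (ℕP.[m+n]∸[m+o]≡n∸o c (suc t) t′) (ℕP.+-∸-assoc 1 t≥t′))) ⟩
  range (c ℕ.+ t′) (suc (t ∸ t′)) (λ j m → interlaceEval (addStaircase (t′ ∷ ts)) (λ js ms → g (j ∷ js) (m ∷ ms)))
    ≡⟨ range-shift c t′ (suc (t ∸ t′)) (λ j m → interlaceEval (addStaircase (t′ ∷ ts)) (λ js ms → g (j ∷ js) (m ∷ ms))) ⟩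
  range t′ (suc (t ∸ t′)) (λ j m → interlaceEval (addStaircase (t′ ∷ ts)) (λ js ms → g (j ∷ js) (c ℕ.+ m ∷ ms)))
    ≡⟨ range-cong t′ (suc (t ∸ t′)) (λ j m _ _ → trans (interlaceEval-branchInner p (λ js ms → g (j ∷ js) (c ℕ.+ m ∷ ms)))
         (branchInner-cong p (λ js νs _ len _ → cong (λ k → g (j ∷ js) (k ℕ.+ m ∷ addStaircase νs)) (sym len)))) ⟩
  range t′ (suc (t ∸ t′)) (λ j m → branchInner (t′ ∷ ts) (λ js νs → g (j ∷ js) (addStaircase (m ∷ νs)))) ∎
  where
  open ≡-Reasoning
  c = length ts

-- Tableaux are branched at their last letter, `schurStrict` at its first variable; the two
-- recursions agree after the exponent vector is reversed.
tabSum-schurEval : ∀ n ts → length ts ≡ n → Linked _≥_ ts → (φ : Test n) →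
  tabSum n ts (φ ∘ weight) ≡ schurEval n (addStaircase ts) (φ ∘ V.reverse)
tabSum-schurEval zero    []       len p φ = trans (ℤP.+-identityʳ _) (ℤP.*-identityˡ (φ []))
tabSum-schurEval (suc n) (t ∷ ts) len p φ = begin
  tabSum (suc n) (t ∷ ts) (φ ∘ weight)
    ≡⟨ tabSum-branch n p (φ ∘ weight) ⟩
  branch (t ∷ ts) (λ js μs → tabSum n μs (λ T → φ (weight (L.zipWith raise T js))))
    ≡⟨ branch-inner p (λ js μs → tabSum n μs (λ T → φ (weight (L.zipWith raise T js))))
         (λ js μs m len′ s → tabSum-tall n μs m (λ T → φ (weight (L.zipWith raise T js))) (trans len′ (ℕP.suc-injective len)) s) ⟩
  branchInner (t ∷ ts) (λ js νs → tabSum n (νs ++ 0 ∷ []) (λ T → φ (weight (L.zipWith raise T js))))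
    ≡⟨ branchInner-cong p step ⟩
  branchInner (t ∷ ts) (λ js νs → schurEval n (addStaircase νs) (λ u → φ (V.reverse (sumℕ js ∷ u))))
    ≡⟨ interlaceEval-branchInner p (λ js ms → schurEval n ms (λ u → φ (V.reverse (sumℕ js ∷ u)))) ⟨
  schurEval (suc n) (addStaircase (t ∷ ts)) (φ ∘ V.reverse) ∎
  where
  open ≡-Reasoning
  step : ∀ js νs → length js ≡ suc (length ts) → length νs ≡ length ts → Linked _≥_ (t ∷ νs) →
    tabSum n (νs ++ 0 ∷ []) (λ T → φ (weight (L.zipWith raise T js))) ≡
    schurEval n (addStaircase νs) (λ u → φ (V.reverse (sumℕ js ∷ u)))
  step js νs len-js len-νs s = begin
    tabSum n (νs ++ 0 ∷ []) (λ T → φ (weight (L.zipWith raise T js)))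
      ≡⟨ tabSum-empty-row n νs _ ⟩
    tabSum n νs (λ T → φ (weight (L.zipWith raise (T ++ [] ∷ []) js)))
      ≡⟨ tabSum-cong n νs (λ T sh → cong φ (trans (weight-raise (T ++ [] ∷ []) js (trans len-js (sym (size T sh))))
           (cong (_∷ʳ sumℕ js) (weight-empty-row T)))) ⟩
    tabSum n νs ((λ u → φ (u ∷ʳ sumℕ js)) ∘ weight)
      ≡⟨ tabSum-schurEval n νs (trans len-νs (ℕP.suc-injective len)) (Linked.tail s) (λ u → φ (u ∷ʳ sumℕ js)) ⟩
    schurEval n (addStaircase νs) (λ u → φ (V.reverse u ∷ʳ sumℕ js))
      ≡⟨ schurEval-cong n (addStaircase νs) (λ u → cong φ (sym (VP.reverse-∷ (sumℕ js) u))) ⟩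
    schurEval n (addStaircase νs) (λ u → φ (V.reverse (sumℕ js ∷ u))) ∎
    where
    size : ∀ T → shape T ≡ νs → length (T ++ [] ∷ []) ≡ suc (length ts)
    size T sh = trans (LP.length-++ T) (trans (ℕP.+-comm (length T) 1)
      (cong suc (trans (sym (LP.length-map length T)) (trans (cong length sh) len-νs))))

subStaircase : Vec ℕ n → Vec ℕ n
subStaircase []                  = []
subStaircase {suc n} (t ∷ u) = t ∸ n ∷ subStaircase u

strict-above : (t : ℕ) (u : Vec ℕ n) → Strict (t ∷ u) → n ℕ.≤ t
strict-above t []       s         = ℕ.z≤n
strict-above t (t′ ∷ u) (t>t′ ∷ s) = ℕP.≤-trans (ℕ.s≤s (strict-above t′ u s)) t>t′

addStaircase-sub : (l : Vec ℕ n) → Strict l → addStaircase (toList (subStaircase l)) ≡ toList l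
addStaircase-sub []      s = refl
addStaircase-sub {suc n} (t ∷ u) s = cong₂ _∷_
  (trans (cong (ℕ._+ (t ∸ n)) (VP.length-toList (subStaircase u))) (ℕP.m+[n∸m]≡n (strict-above t u s)))
  (addStaircase-sub u (Linked.tail s))

subStaircase-weak : (l : Vec ℕ n) → Strict l → Linked _≥_ (toList (subStaircase l))
subStaircase-weak []                  s            = []
subStaircase-weak (t ∷ [])            s            = [-]
subStaircase-weak {suc (suc n)} (t ∷ t′ ∷ u) (t>t′ ∷ s) = ℕP.∸-monoˡ-≤ (suc n) t>t′ ∷ subStaircase-weak (t′ ∷ u) s

weak-partition : (u : Vec ℕ n) → Linked _≥_ (toList u) → IsPartition u
weak-partition (t ∷ u) s zero    zero    le = ℕP.≤-refl
weak-partition (t ∷ u) s zero    (suc j) le = bound u s j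
  where
  bound : ∀ {n t} (u : Vec ℕ n) → Linked _≥_ (t ∷ toList u) → ∀ j → lookup u j ℕ.≤ t
  bound (x ∷ u) (t≥x ∷ s) zero    = t≥x
  bound (x ∷ u) (t≥x ∷ s) (suc j) = ℕP.≤-trans (bound u s j) t≥x
weak-partition (t ∷ u) s (suc i) (suc j) le = weak-partition u (Linked.tail s) i j (ℕ.s≤s⁻¹ le)

partition : (l : Vec ℕ n) → Strict l → Partition n
partition l s = subStaircase l , weak-partition (subStaircase l) (subStaircase-weak l s)

∑-filter : {A : Set} (P : A → Bool) (as : List A) {g : A → ℤ} →
  ∑ (L.filter (λ a → P a Bool.≟ true) as) g ≡ ∑ as (λ a → ind (P a) * g a)
∑-filter P []       = refl
∑-filter P (a ∷ as) {g} with P a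
... | true  = cong₂ _+_ (sym (ℤP.*-identityˡ (g a))) (∑-filter P as)
... | false = trans (∑-filter P as) (sym (ℤP.+-identityˡ _))

coeff-∑ : (α : Monomial n) (p : Poly n) → ⁺ coeff α p ≡ ∑ p (δ α)
coeff-∑ α []      = refl
coeff-∑ α (β ∷ p) with VP.≡-dec ℕP._≟_ α β
... | yes refl = trans (ℤP.pos-+ 1 (coeff α p)) (cong₂ _+_ (sym (δ-refl α)) (coeff-∑ α p))
... | no  α≢β  = trans (coeff-∑ α p) (trans (sym (ℤP.+-identityˡ _)) (cong (_+ ∑ p (δ α)) (sym (δ-≢ α β α≢β))))

δ-reverse : (α u : Vec ℕ n) → δ α (V.reverse u) ≡ δ (V.reverse α) u
δ-reverse α u with VP.≡-dec ℕP._≟_ α (V.reverse u)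
... | yes refl = trans (δ-refl (V.reverse u)) (sym (trans (cong (λ w → δ w u) (VP.reverse-involutive u)) (δ-refl u)))
... | no  ne   = trans (δ-≢ α (V.reverse u) ne) (sym (δ-≢ (V.reverse α) u
  (λ e → ne (trans (sym (VP.reverse-involutive α)) (cong V.reverse e)))))

schur-coefficient : (l : Vec ℕ n) (s : Strict l) (α : Monomial n) →
  ⁺ coeff α (schur (partition l s)) ≡ coefficient (V.reverse α) (schurPol l)
schur-coefficient {n} l s α = begin
  ⁺ coeff α (schur (partition l s))
    ≡⟨ coeff-∑ α (schur (partition l s)) ⟩
  ∑ (schur (partition l s)) (δ α)
    ≡⟨ trans (∑-map weight (SSYT (partition l s))) (∑-filter isSSYT (fillings n ts)) ⟩
  tabSum n ts (δ α ∘ weight)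
    ≡⟨ tabSum-schurEval n ts (VP.length-toList (subStaircase l)) (subStaircase-weak l s) (δ α) ⟩
  schurEval n (addStaircase ts) (δ α ∘ V.reverse)
    ≡⟨ cong (λ ls → schurEval n ls (δ α ∘ V.reverse)) (addStaircase-sub l s) ⟩
  schurEval n (toList l) (δ α ∘ V.reverse)
    ≡⟨ schurEval-cong n (toList l) (δ-reverse α) ⟩
  schurEval n (toList l) (δ (V.reverse α))
    ≡⟨ ⟦schurStrict⟧ n (toList l) (δ (V.reverse α)) ⟨
  coefficient (V.reverse α) (schurPol l) ∎
  where
  open ≡-Reasoning
  ts = toList (subStaircase l)

module _ where
  private
    rotate : ∀ {n} (K : Vec ℕ (suc n) → ℤ) → (∀ i β → K (swapAt i β) ≡ K β) → ∀ x u → K (u ∷ʳ x) ≡ K (x ∷ u)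
    rotate K inv x []      = refl
    rotate K inv x (y ∷ u) = trans (rotate (λ w → K (y ∷ w)) (λ i β → inv (suc i) (y ∷ β)) x u) (inv zero (x ∷ y ∷ u))

  invariant-reverse : (K : Vec ℕ (suc n) → ℤ) → (∀ i β → K (swapAt i β) ≡ K β) → ∀ β → K (V.reverse β) ≡ K β
  invariant-reverse K inv (x ∷ [])    = refl
  invariant-reverse K inv (x ∷ y ∷ u) = trans (cong K (VP.reverse-∷ x (y ∷ u))) (trans
    (rotate K inv x (V.reverse (y ∷ u)))
    (invariant-reverse (λ w → K (x ∷ w)) (λ i β → inv (suc i) (x ∷ β)) (y ∷ u)))

symmetric-reverse : (f : Pol (suc n)) → Symmetric f → ∀ α → coefficient (V.reverse α) f ≡ coefficient α f
symmetric-reverse f sym-f = invariant-reverse (λ β → coefficient β f)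
  (λ i β → trans (⟦⟧-cong f (δ-swap i β)) (sym-f i (δ β)))

∑-scaleP : (c : ℕ) (p : Poly n) (φ : Test n) → ∑ (scaleP c p) φ ≡ ⁺ c * ∑ p φ
∑-scaleP zero    p φ = refl
∑-scaleP (suc c) p φ = trans (∑-++ p (scaleP c p)) (trans (cong (∑ p φ +_) (∑-scaleP c p φ)) (sym (ℤP.suc-* (⁺ c) (∑ p φ))))

boolean-schurPositive : (cols : List (Subset (suc n))) → Unique cols → CardClosed cols → (p : Poly (suc n)) →
  embed p ≋ boolean cols → SchurPositive p
boolean-schurPositive {n} cols un closed p eq = terms Λ strict , λ α → ℤP.+-injective (begin
  ⁺ coeff α p
    ≡⟨ trans (coeff-∑ α p) (sym (⟦embed⟧ p (δ α))) ⟩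
  coefficient α (embed p)
    ≡⟨ at eq (δ α) ⟩
  coefficient α f
    -- Symmetry of f absorbs the reversal of variables between tableaux and `schurPol`.
    ≡⟨ symmetric-reverse f sym-f α ⟨
  coefficient (V.reverse α) f
    ≡⟨ expansion (V.reverse α) ⟩
  ∑ Λ (λ l → schurCoefficient f l * coefficient (V.reverse α) (schurPol l))
    ≡⟨ collect α Λ strict ⟩
  ∑ (assemble (terms Λ strict)) (δ α)
    ≡⟨ coeff-∑ α (assemble (terms Λ strict)) ⟨
  ⁺ coeff α (assemble (terms Λ strict)) ∎)
  where
  open ≡-Reasoning
  f = boolean cols
  sym-f = boolean-symmetric cols un closed
  Λ = proj₁ (schur-expansion f sym-f)
  strict = proj₁ (proj₂ (schur-expansion f sym-f))
  expansion = proj₂ (proj₂ (schur-expansion f sym-f))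

  terms : (Λ : List (Vec ℕ (suc n))) → All Strict Λ → List (ℕ × Partition (suc n))
  terms []      []       = []
  terms (l ∷ Λ) (s ∷ ss) = (∣ schurCoefficient f l ∣ , partition l s) ∷ terms Λ ss

  assemble : List (ℕ × Partition (suc n)) → Poly (suc n)
  assemble = L.foldr (λ { (c , λ′) acc → scaleP c (schur λ′) +P acc }) []

  collect : ∀ α Λ (ss : All Strict Λ) →
    ∑ Λ (λ l → schurCoefficient f l * coefficient (V.reverse α) (schurPol l)) ≡ ∑ (assemble (terms Λ ss)) (δ α)
  collect α []      []       = refl
  collect α (l ∷ Λ) (s ∷ ss) = trans (cong₂ _+_
      (trans (cong₂ _*_ (sym (ℤP.0≤i⇒+∣i∣≡i (boolean-positive cols un closed l s)))
          (trans (sym (schur-coefficient l s α)) (coeff-∑ α (schur (partition l s)))))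
        (sym (∑-scaleP ∣ schurCoefficient f l ∣ (schur (partition l s)) (δ α))))
      (collect α Λ ss))
    (sym (∑-++ (scaleP ∣ schurCoefficient f l ∣ (schur (partition l s))) (assemble (terms Λ ss))))

-- The families of subsets in the statement

∈-allSubsets : (S : Subset n) → S ∈ allSubsets n
∈-allSubsets []      = here refl
∈-allSubsets (x ∷ S) = extend x (∈-allSubsets S)
  where
  extend : ∀ x {as} → S ∈ as → x ∷ S ∈ L.concatMap (λ S → (true ∷ S) ∷ (false ∷ S) ∷ []) as
  extend true  (here refl) = here refl
  extend false (here refl) = there (here refl)
  extend x     (there S∈)  = there (there (extend x S∈))

allSubsets-unique : ∀ n → Unique (allSubsets n)
allSubsets-unique zero    = [] ∷ []
allSubsets-unique (suc n) = extend (allSubsets-unique n)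
  where
  double : Subset n → List (Subset (suc n))
  double S = (true ∷ S) ∷ (false ∷ S) ∷ []
  restrict : ∀ {x S as} → x ∷ S ∈ L.concatMap double as → S ∈ as
  restrict {as = _ ∷ _} (here refl)         = here refl
  restrict {as = _ ∷ _} (there (here refl)) = here refl
  restrict {as = _ ∷ _} (there (there S∈))  = there (restrict S∈)
  extend : ∀ {as} → Unique as → Unique (L.concatMap double as)
  extend []                  = []
  extend {S ∷ as} (new ∷ un) = ((λ ()) ∷ fresh) ∷ (fresh ∷ extend un)
    where
    fresh : ∀ {x} → All (x ∷ S ≢_) (L.concatMap double as)
    fresh = All.tabulate (λ T∈ e → All.lookup new (restrict (subst (_∈ L.concatMap double as) (sym e) T∈)) refl)

kSubsets-unique : ∀ n k → Unique (kSubsets n k)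
kSubsets-unique n k = UP.filter⁺ (λ S → card S ℕP.≟ k) (allSubsets-unique n)

kSubsets-card : ∀ {n k} {S : Subset n} → S ∈ kSubsets n k → card S ≡ k
kSubsets-card {n} {k} S∈ = proj₂ (∈P.∈-filter⁻ (λ S → card S ℕP.≟ k) {xs = allSubsets n} S∈)

∈-kSubsets : ∀ {n k} (S : Subset n) → card S ≡ k → S ∈ kSubsets n k
∈-kSubsets {k = k} S e = ∈P.∈-filter⁺ (λ S → card S ℕP.≟ k) (∈-allSubsets S) e

-- All sizes form a single closed family, so the product over k is itself one Boolean product;
-- positivity of products of Schur polynomials is not involved.
subsetsOfSizes : ∀ n → List ℕ → List (Subset n)
subsetsOfSizes n = L.concatMap (λ k → kSubsets n (suc k))

∈-subsetsOfSizes⁻ : ∀ n ks {S} → S ∈ subsetsOfSizes n ks → ∃ λ k → k ∈ ks × card S ≡ suc k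
∈-subsetsOfSizes⁻ n (k ∷ ks) S∈ with ∈P.∈-++⁻ (kSubsets n (suc k)) S∈
... | inj₁ S∈k  = k , here refl , kSubsets-card S∈k
... | inj₂ S∈ks with ∈-subsetsOfSizes⁻ n ks S∈ks
...   | k′ , k′∈ , e = k′ , there k′∈ , e

∈-subsetsOfSizes⁺ : ∀ n ks S {k} → k ∈ ks → card S ≡ suc k → S ∈ subsetsOfSizes n ks
∈-subsetsOfSizes⁺ n (k ∷ ks) S (here refl) e = ∈P.∈-++⁺ˡ (∈-kSubsets S e)
∈-subsetsOfSizes⁺ n (k ∷ ks) S (there k∈)  e = ∈P.∈-++⁺ʳ (kSubsets n (suc k)) (∈-subsetsOfSizes⁺ n ks S k∈ e)

subsetsOfSizes-unique : ∀ n ks → Unique ks → Unique (subsetsOfSizes n ks)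
subsetsOfSizes-unique n []       un         = []
subsetsOfSizes-unique n (k ∷ ks) (new ∷ un) = UP.++⁺ (kSubsets-unique n (suc k)) (subsetsOfSizes-unique n ks un) disjoint
  where
  disjoint : ∀ {S} → ¬ (S ∈ kSubsets n (suc k) × S ∈ subsetsOfSizes n ks)
  disjoint (S∈k , S∈ks) with ∈-subsetsOfSizes⁻ n ks S∈ks
  ... | k′ , k′∈ , e = All.lookup new k′∈ (ℕP.suc-injective (trans (sym (kSubsets-card S∈k)) e))

boolean-++ : (as bs : List (Subset n)) → boolean (as ++ bs) ≋ boolean as ⊛ boolean bs
boolean-++ []       bs = PR.sym (PR.trans (PR.*-congʳ one) (PR.*-identityˡ (boolean bs)))
  where
  one : embed oneP ≋ constant 1ℤ
  one = PR.refl
boolean-++ (a ∷ as) bs = PR.trans (boolean-∷ a (as ++ bs)) (PR.trans (PR.*-congˡ (boolean-++ as bs))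
  (PR.trans (PR.sym (PR.*-assoc (embed (linSum a)) (boolean as) (boolean bs))) (PR.*-congʳ (PR.sym (boolean-∷ a as)))))

embed-products : ∀ n ks → embed (prodP (L.map (λ k → B n (suc k)) ks)) ≋ boolean (subsetsOfSizes n ks)
embed-products n []       = PR.refl
embed-products n (k ∷ ks) = PR.trans (embed-* (B n (suc k)) (prodP (L.map (λ k → B n (suc k)) ks)))
  (PR.trans (PR.*-congˡ (embed-products n ks)) (PR.sym (boolean-++ (kSubsets n (suc k)) (subsetsOfSizes n ks))))

theorem3p3 : (n : ℕ) → 1 ℕ.≤ n →
    ((k : ℕ) → 1 ℕ.≤ k → k ℕ.≤ n → SchurPositive (B n k)) × SchurPositive (Bfull n)
theorem3p3 (suc n) _ =
  (λ k _ _ → boolean-schurPositive (kSubsets (suc n) k) (kSubsets-unique (suc n) k)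
    (λ S T S∈ e → ∈-kSubsets T (trans e (kSubsets-card S∈))) (B (suc n) k) PR.refl) ,
  boolean-schurPositive (subsetsOfSizes (suc n) sizes) (subsetsOfSizes-unique (suc n) sizes (UP.upTo⁺ (suc n))) closed
    (Bfull (suc n)) (embed-products (suc n) sizes)
  where
  sizes = L.upTo (suc n)
  closed : CardClosed (subsetsOfSizes (suc n) sizes)
  closed S T S∈ e with ∈-subsetsOfSizes⁻ (suc n) sizes S∈
  ... | k , k∈ , e′ = ∈-subsetsOfSizes⁺ (suc n) sizes T k∈ (trans e e′)
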